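{- Let $n,k,\ell$ be positive integers and let $b,b_1,\dots,b_n$ and $s_1,\dots,s_{\ell+1}$ be nonnegative integers with $\sum_{i=1}^n b_i=b$, $\sum_{i=1}^n i\,b_i\le n$, $\sum_{i=1}^{\ell+1}s_i=n$ and $s_1=n-b$. Then the number of multichains $\pi_1\le\pi_2\le\cdots\le\pi_\ell$ in $\widetilde{\mathrm{NC}}^{(2k)}(2n+1)$ with rank jump vector $(s_1,\dots,s_{\ell+1})$ and type $(b;b_1,\dots,b_n)$ for $\pi_1$ equals $$\binom{b}{b_1,b_2,\dots,b_n}\binom{2kn+k}{s_2}\cdots\binom{2kn+k}{s_{\ell+1}}.$$
   Context: A partition $\pi$ of $[N]$ is noncrossing if there are no $a<b<c<d$ with $a,c$ in a block $B$ and $b,d$ in a block $B'\ne B$. $\mathrm{NC}^{(2k)}(2n+1)$ is the set of noncrossing partitions of $[M]$, $M=2k(2n+1)$, all of whose block sizes are divisible by $2k$, ordered by refinement. With $\rho(i)\equiv i+(2kn+k)\pmod M$, $\widetilde{\mathrm{NC}}^{(2k)}(2n+1)$ is the subposet of those partitions invariant under $\rho$. Such a partition has exactly one block $B$ with $\rho(B)=B$, and its other blocks come in pairs $\{B,\rho(B)\}$, $\rho(B)\ne B$. The poset is graded with rank function $\mathrm{rank}(\pi)=n-p(\pi)$, where $p(\pi)$ is the number of such unordered pairs $\{B,\rho(B)\}$; the maximum element (one block) has rank $n$. The type of $\pi$ is $(b;b_1,\dots,b_n)$ where $b_i$ is the number of unordered pairs $\{B,\rho(B)\}$ with $\rho(B)\ne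 B$ and $|B|=2ki$, and $b=\sum b_i$. For a multichain (chain with repetitions allowed) $\pi_1\le\cdots\le\pi_\ell$, the rank jump vector is $(s_1,\dots,s_{\ell+1})$ with $s_1=\mathrm{rank}(\pi_1)$, $s_i=\mathrm{rank}(\pi_i)-\mathrm{rank}(\pi_{i-1})$ for $2\le i\le\ell$, $s_{\ell+1}=n-\mathrm{rank}(\pi_\ell)$. -}

module Defs where

open import Data.Nat using (ℕ; zero; suc; _+_; _*_; _∸_; _≤_; _<_; _/_; NonZero)
open import Data.Nat.Properties using (_≟_; _<?_; _≤?_; m*n≢0; _!≢0)
open import Data.Nat.DivMod using (_mod_)
open import Data.Nat.Divisibility using (_∣_; _∣?_)
open import Data.Nat.Combinatorics using (_C_)
open import Data.Nat.Base using (_!)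
open import Data.Fin using (Fin; toℕ)
open import Data.Fin.Properties using (all?; any?) renaming (_≟_ to _≟ᶠ_)
open import Data.Vec using (Vec; []; _∷_; lookup; tabulate; toList)
import Data.Vec as Vec
import Data.Vec.Properties as VecP
import Data.List.Properties as ListP
open import Data.List using (List; []; _∷_; [_]; length; filter; map; concatMap; zipWith; _++_; allFin)
import Data.List as List
open import Data.Nat.ListAction using (product)
open import Data.Product using (Σ; ∃; _×_; _,_)
open import Relation.Binary.PropositionalEquality using (_≡_)
open import Relation.Nullary using (¬_; Dec; yes; no)
open import Relation.Nullary.Decidable using (_×-dec_; _→-dec_; ¬?)

-- The ground set [M], M = 2k(2n+1), is modelled by Fin M = {0,…,M-1}
-- (a shift by one of the paper's {1,…,M}).

Mof : ℕ → ℕ → ℕ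
Mof k n = 2 * k * (2 * n + 1)

rotate : ∀ {M} → ℕ → Fin M → Fin M
rotate {zero}  h ()
rotate {suc m} h i = (toℕ i + h) mod (suc m)

ρ : (k n : ℕ) → Fin (Mof k n) → Fin (Mof k n)
ρ k n = rotate (2 * k * n + k)

-- A set partition of Fin M is represented canonically by the vector r
-- with  r[i] = the least element of the block containing i.

Rep : ℕ → Set
Rep M = Vec (Fin M) M

module _ {M : ℕ} (r : Rep M) where

  blk : Fin M → Fin M
  blk i = lookup r i

  SameBlock : Fin M → Fin M → Set
  SameBlock i j = blk i ≡ blk j

  sameBlock? : ∀ i j → Dec (SameBlock i j)
  sameBlock? i j = blk i ≟ᶠ blk j

  IsSetPartition : Set
  IsSetPartition = (∀ i → blk (blk i) ≡ blk i)
                 × (∀ i j → blk j ≡ blk i → toℕ (blk i) ≤ toℕ j)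

  blockSize : Fin M → ℕ
  blockSize i = length (filter (λ j → sameBlock? j i) (allFin M))

  BlocksDivisibleBy : ℕ → Set
  BlocksDivisibleBy d = ∀ i → d ∣ blockSize i

  Crossing : Set
  Crossing = Σ (Fin M) λ a → Σ (Fin M) λ b → Σ (Fin M) λ c → Σ (Fin M) λ d →
    (toℕ a < toℕ b) × (toℕ b < toℕ c) × (toℕ c < toℕ d)
    × SameBlock a c × SameBlock b d × ¬ SameBlock a b

  NonCrossing : Set
  NonCrossing = ¬ Crossing

  Refines : Rep M → Set
  Refines s = ∀ i j → SameBlock i j → blk' i ≡ blk' j
    where blk' = lookup s

  IsRepr : Fin M → Set
  IsRepr i = blk i ≡ i

  isRepr? : ∀ i → Dec (IsRepr i)
  isRepr? i = blk i ≟ᶠ i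

module _ (k n : ℕ) (r : Rep (Mof k n)) where

  RhoInvariant : Set
  RhoInvariant = ∀ i j → (SameBlock r i j → SameBlock r (ρ k n i) (ρ k n j))
                       × (SameBlock r (ρ k n i) (ρ k n j) → SameBlock r i j)

  InNCtilde : Set
  InNCtilde = IsSetPartition r × NonCrossing r × BlocksDivisibleBy r (2 * k)
            × RhoInvariant

  -- i represents a block B with ρ(B) ≠ B (for invariant π: ρ i ∉ B)
  NonFixedRepr : Fin (Mof k n) → Set
  NonFixedRepr i = IsRepr r i × ¬ SameBlock r (ρ k n i) i

  nonFixedRepr? : ∀ i → Dec (NonFixedRepr i)
  nonFixedRepr? i = isRepr? r i ×-dec ¬? (sameBlock? r (ρ k n i) i)

  -- p(π): number of unordered pairs {B, ρ(B)} with ρ(B) ≠ B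
  numPairs : ℕ
  numPairs = length (filter nonFixedRepr? (allFin (Mof k n))) / 2

  rank : ℕ
  rank = n ∸ numPairs

  -- b_m: number of unordered pairs {B, ρ(B)}, ρ(B) ≠ B, with |B| = 2km
  typeCount : ℕ → ℕ
  typeCount m = length (filter (λ i → nonFixedRepr? i ×-dec (blockSize r i ≟ 2 * k * m))
                               (allFin (Mof k n))) / 2

  typeVec : Vec ℕ n
  typeVec = tabulate (λ j → typeCount (suc (toℕ j)))

  typeB : ℕ
  typeB = Vec.sum typeVec

module _ {M : ℕ} (r : Rep M) where
  isSetPartition? : Dec (IsSetPartition r)
  isSetPartition? = all? (λ i → blk r (blk r i) ≟ᶠ blk r i)
    ×-dec all? (λ i → all? (λ j → (blk r j ≟ᶠ blk r i) →-dec (toℕ (blk r i) ≤? toℕ j)))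

  nonCrossing? : Dec (NonCrossing r)
  nonCrossing? = ¬? (any? λ a → any? λ b → any? λ c → any? λ d →
    (toℕ a <? toℕ b) ×-dec (toℕ b <? toℕ c) ×-dec (toℕ c <? toℕ d)
    ×-dec sameBlock? r a c ×-dec sameBlock? r b d ×-dec ¬? (sameBlock? r a b))

  divisible? : ∀ d → Dec (BlocksDivisibleBy r d)
  divisible? d = all? (λ i → d ∣? blockSize r i)

  refines? : ∀ s → Dec (Refines r s)
  refines? s = all? λ i → all? λ j → sameBlock? r i j →-dec (lookup s i ≟ᶠ lookup s j)

module _ (k n : ℕ) (r : Rep (Mof k n)) where
  rhoInvariant? : Dec (RhoInvariant k n r)
  rhoInvariant? = all? λ i → all? λ j →
      (sameBlock? r i j →-dec sameBlock? r (ρ k n i) (ρ k n j))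
      ×-dec (sameBlock? r (ρ k n i) (ρ k n j) →-dec sameBlock? r i j)

  inNCtilde? : Dec (InNCtilde k n r)
  inNCtilde? = isSetPartition? r ×-dec nonCrossing? r ×-dec divisible? r (2 * k)
             ×-dec rhoInvariant?

IsMultichain : (k n ℓ : ℕ) → Vec (Rep (Mof k n)) ℓ → Set
IsMultichain k n ℓ πs =
  (∀ i → InNCtilde k n (lookup πs i))
  × (∀ (i j : Fin ℓ) → suc (toℕ i) ≡ toℕ j → Refines (lookup πs i) (lookup πs j))

rankJumps : ℕ → List ℕ → List ℕ
rankJumps n rs = zipWith _∸_ (rs ++ [ n ]) (0 ∷ rs)

multichainRankJumps : (k n ℓ : ℕ) → Vec (Rep (Mof k n)) ℓ → List ℕ
multichainRankJumps k n ℓ πs = rankJumps n (List.map (rank k n) (toList πs))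

Counted : (k n ℓ b : ℕ) → Vec ℕ n → Vec ℕ (suc ℓ) → Vec (Rep (Mof k n)) ℓ → Set
Counted k n ℓ b bs s πs =
  IsMultichain k n ℓ πs
  × multichainRankJumps k n ℓ πs ≡ toList s
  × (∀ (i : Fin ℓ) → toℕ i ≡ 0 → (typeB k n (lookup πs i) ≡ b) × (typeVec k n (lookup πs i) ≡ bs))

counted? : ∀ k n ℓ b bs s πs → Dec (Counted k n ℓ b bs s πs)
counted? k n ℓ b bs s πs =
  ((all? λ i → inNCtilde? k n (lookup πs i))
   ×-dec (all? λ i → all? λ j → (suc (toℕ i) ≟ toℕ j) →-dec refines? (lookup πs i) (lookup πs j)))
  ×-dec ListP.≡-dec _≟_ (multichainRankJumps k n ℓ πs) (toList s)
  ×-dec (all? λ i → (toℕ i ≟ 0) →-dec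
           ((typeB k n (lookup πs i) ≟ b) ×-dec VecP.≡-dec _≟_ (typeVec k n (lookup πs i)) bs))

allVecs : ∀ {A : Set} → List A → (m : ℕ) → List (Vec A m)
allVecs xs zero    = [ [] ]
allVecs xs (suc m) = concatMap (λ x → List.map (x ∷_) (allVecs xs m)) xs

numMultichains : (k n ℓ b : ℕ) → Vec ℕ n → Vec ℕ (suc ℓ) → ℕ
numMultichains k n ℓ b bs s =
  length (filter (counted? k n ℓ b bs s)
                 (allVecs (allVecs (allFin (Mof k n)) (Mof k n)) ℓ))

weightedSum : ∀ {n} → Vec ℕ n → ℕ
weightedSum {n} bs = Vec.sum (tabulate (λ (j : Fin n) → suc (toℕ j) * lookup bs j))

prodFact : List ℕ → ℕ
prodFact xs = product (List.map _! xs)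

prodFact≢0 : ∀ xs → NonZero (prodFact xs)
prodFact≢0 []       = _
prodFact≢0 (x ∷ xs) = m*n≢0 (x !) (prodFact xs) {{x !≢0}} {{prodFact≢0 xs}}

multinomial : ∀ {n} → ℕ → Vec ℕ n → ℕ
multinomial b bs = _/_ (b !) (prodFact (toList bs)) {{prodFact≢0 (toList bs)}}

{-# OPTIONS --safe #-}

-- Put N = 2kn + k, so that ρ is the half turn of ℤ/2N, and lift everything to
-- the universal cover ℕ.  An invariant noncrossing partition is then the map
-- sending e to the last element of its block, and a block different from its
-- rotation has a first and a last element.  For a multichain π₁ ≤ … ≤ π_ℓ every
-- last element l of a block of π₁ gets a level, the largest v for which l still
-- ends its block in π_v, and an opening position, the first element of that
-- block; the bracket from (position, level) to l is labelled by the size of the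
-- π₁-block of l.  Levels and positions modulo N give a code: an N × ℓ matrix of
-- labels 2km or 0, with s_{v+1} nonzero entries at level v and b_m entries 2km.
-- Conversely a code determines its brackets, as in a Łukasiewicz path: a bracket
-- closes as soon as the labels opened since (and including) its own have been
-- used up by the positions passed; this happens within one turn because the
-- total label is at most N.  The brackets of level ≥ v then recover π_v, whose
-- blocks end at the innermost bracket around each element.  The choices of the
-- nonzero entries give the factors C(N, s_{v+1}), and the distribution of the labels
-- over them the multinomial coefficient.

module Submission where

open import Defs
open import Data.Nat using (ℕ; suc; _+_; _*_; _∸_; _≤_)
open import Data.Nat.Combinatorics using (_C_)
open import Data.Nat.ListAction using (product)
open import Data.Vec using (Vec; head; tail; sum; toList)
open import Data.List using (map)
open import Relation.Binary.PropositionalEquality using (_≡_)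

open import Data.Bool using (Bool; true; T; if_then_else_; _∧_; not)
open import Data.Bool.Properties using (T-∧)
open import Data.Empty using (⊥; ⊥-elim)
open import Data.Fin as Fin using (Fin; zero; suc; toℕ; fromℕ<)
open import Data.Fin.Properties using (toℕ<n; toℕ-injective; toℕ-fromℕ<; fromℕ<-toℕ)
open import Data.List as List using (List; []; _∷_; [_]; _++_; length; filter; concatMap; cartesianProductWith; zipWith; allFin)
open import Data.List.Properties using (length-++; filter-accept; filter-reject; map-tabulate; ∷-injectiveˡ; ∷-injectiveʳ)
open import Data.List.Membership.Propositional using (_∈_)
open import Data.List.Membership.Propositional.Properties
  using (∈-∃++; ∈-++⁻; ∈-++⁺ˡ; ∈-++⁺ʳ; ∈-cartesianProductWith⁺; ∈-filter⁺; ∈-filter⁻; ∈-allFin)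
open import Data.List.Relation.Unary.All as All using ([]; _∷_)
open import Data.List.Relation.Unary.AllPairs using ([]; _∷_)
open import Data.List.Relation.Unary.Any using (here; there)
open import Data.List.Relation.Unary.Unique.Propositional using (Unique)
open import Data.List.Relation.Unary.Unique.Propositional.Properties using (cartesianProductWith⁺; filter⁺; allFin⁺)
open import Data.Maybe as Maybe using (Maybe; just; nothing; maybe′; Is-just)
open import Data.Maybe.Relation.Unary.Any using (just)
open import Data.Nat
open import Data.Nat.Combinatorics using (nCk+nC[k+1]≡[n+1]C[k+1])
open import Data.Nat.Divisibility using (_∣_; _∣0; m∣m*n; ∣m∣n⇒∣m+n; ∣m+n∣m⇒∣n)
open import Data.Nat.DivMod
open import Data.Nat.Induction using (<-rec)
open import Data.Nat.ListAction as ListAction using ()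
open import Data.Nat.Properties
open import Data.Nat.Solver using (module +-*-Solver)
open import Data.Nat.Tactic.RingSolver using (solve-∀)
open import Data.Product using (∃; ∃₂; _×_; _,_; proj₁; proj₂)
open import Data.Sum using (_⊎_; inj₁; inj₂; [_,_]′)
open import Data.Unit using (⊤; tt)
open import Data.Vec as Vec using ([]; _∷_; lookup; tabulate)
open import Data.Vec.Properties using (lookup-map; lookup∘tabulate; tabulate∘lookup; tabulate-cong; ∷-injective)
open import Function using (_∘_; id; flip)
open import Function.Bundles using (Equivalence)
open import Relation.Binary.Definitions using (tri<; tri≈; tri>)
open import Relation.Binary.PropositionalEquality hiding ([_])
open import Relation.Nullary using (¬_; Dec; yes; no; does; contradiction)
open import Relation.Nullary.Decidable using (_×-dec_; map′; ¬?; decidable-stable)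
open import Relation.Unary using (Decidable)

-- Linear arithmetic over ℕ

-- Fourier–Motzkin elimination searches for a nonnegative combination of
-- the hypotheses and of the negated goal that is absurd; only the check of that
-- combination is proved sound.

-- Last elements make sense because a block other than its rotation stays within less than half a
-- turn: otherwise it would cross its rotation, and the two would merge into an invariant block
-- (`no-return`). Two crossing diameters show likewise that there is only one invariant block. It
-- gets no bracket, being what no bracket covers. A cycle has no first point from which to read a
-- path, hence the cover; as `ℕ` has no negative positions, arguments are shifted by `N` wherever
-- something earlier must exist. The constants: the brackets use up 2k Σ i bᵢ ≤ 2kn positions of a
-- half turn, fewer than N = 2kn + k, so they all close, and the invariant block keeps 2k(2(n - Σ i
-- bᵢ) + 1) elements, a multiple of 2k. The hypothesis s₁ = n - b makes the number of brackets equal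
-- to the number b of labels, so that no label is left over. Divisibility passes to coarser
-- partitions, so sizes matter in π₁ alone.

module LinearArithmetic where

  infixl 6 _:+_
  infixl 7 _:*_
  infix 4 _:≤_ _:<_ _:≡_
  infixr 3 _⇒_
  infix 3 ⊢_

  data Expr (n : ℕ) : Set where
    var  : Fin n → Expr n
    con  : ℕ → Expr n
    _:+_ : Expr n → Expr n → Expr n
    _:*_ : ℕ → Expr n → Expr n

  data Atom (n : ℕ) : Set where
    _:≤_ _:<_ _:≡_ : Expr n → Expr n → Atom n
    :⊥             : Atom n

  data Problem (n : ℕ) : Set where
    ⊢_  : Atom n → Problem n
    _⇒_ : Atom n → Problem n → Problem n

  Env : ℕ → Set
  Env n = Vec ℕ n

  ⟦_⟧ : ∀ {n} → Expr n → Env n → ℕ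
  ⟦ var i ⟧ η  = Vec.lookup η i
  ⟦ con k ⟧ η  = k
  ⟦ a :+ b ⟧ η = ⟦ a ⟧ η + ⟦ b ⟧ η
  ⟦ k :* a ⟧ η = k * ⟦ a ⟧ η

  ⟦_⟧ᴬ : ∀ {n} → Atom n → Env n → Set
  ⟦ a :≤ b ⟧ᴬ η = ⟦ a ⟧ η ≤ ⟦ b ⟧ η
  ⟦ a :< b ⟧ᴬ η = ⟦ a ⟧ η < ⟦ b ⟧ η
  ⟦ a :≡ b ⟧ᴬ η = ⟦ a ⟧ η ≡ ⟦ b ⟧ η
  ⟦ :⊥ ⟧ᴬ η     = ⊥

  ⟦_⟧ᴾ : ∀ {n} → Problem n → Env n → Set
  ⟦ ⊢ g ⟧ᴾ η   = ⟦ g ⟧ᴬ η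
  ⟦ h ⇒ p ⟧ᴾ η = ⟦ h ⟧ᴬ η → ⟦ p ⟧ᴾ η

  -- A linear form: the constant term followed by the coefficients.
  Lin : ℕ → Set
  Lin n = ℕ × Vec ℕ n

  dot : ∀ {n} → Vec ℕ n → Env n → ℕ
  dot []       []      = 0
  dot (c ∷ cs) (x ∷ η) = c * x + dot cs η

  ⟦_⟧ᴸ : ∀ {n} → Lin n → Env n → ℕ
  ⟦ k , cs ⟧ᴸ η = k + dot cs η

  addᴸ : ∀ {n} → Lin n → Lin n → Lin n
  addᴸ (k , cs) (l , ds) = k + l , Vec.zipWith _+_ cs ds

  mulᴸ : ∀ {n} → ℕ → Lin n → Lin n
  mulᴸ m (k , cs) = m * k , Vec.map (m *_) cs

  unit : ∀ {n} → Fin n → Vec ℕ n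
  unit zero    = 1 ∷ Vec.replicate _ 0
  unit (suc i) = 0 ∷ unit i

  lin : ∀ {n} → Expr n → Lin n
  lin (var i)  = 0 , unit i
  lin (con k)  = k , Vec.replicate _ 0
  lin (a :+ b) = addᴸ (lin a) (lin b)
  lin (k :* a) = mulᴸ k (lin a)

  dot-zero : ∀ {n} (η : Env n) → dot (Vec.replicate n 0) η ≡ 0
  dot-zero []      = refl
  dot-zero (x ∷ η) = dot-zero η

  dot-unit : ∀ {n} (i : Fin n) η → dot (unit i) η ≡ Vec.lookup η i
  dot-unit zero    (x ∷ η) rewrite dot-zero η = trans (+-identityʳ (x + 0)) (+-identityʳ x)
  dot-unit (suc i) (x ∷ η) = dot-unit i η

  dot-add : ∀ {n} (cs ds : Vec ℕ n) η → dot (Vec.zipWith _+_ cs ds) η ≡ dot cs η + dot ds η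
  dot-add []       []       []      = refl
  dot-add (c ∷ cs) (d ∷ ds) (x ∷ η) rewrite dot-add cs ds η =
    solve 5 (λ c d x u v → (c :+′ d) :*′ x :+′ (u :+′ v) := c :*′ x :+′ u :+′ (d :*′ x :+′ v)) refl
      c d x (dot cs η) (dot ds η)
    where open +-*-Solver using (solve; _:=_) renaming (_:+_ to _:+′_; _:*_ to _:*′_)

  dot-mul : ∀ {n} m (cs : Vec ℕ n) η → dot (Vec.map (m *_) cs) η ≡ m * dot cs η
  dot-mul m []       []      = sym (*-zeroʳ m)
  dot-mul m (c ∷ cs) (x ∷ η) rewrite dot-mul m cs η | *-assoc m c x =
    sym (*-distribˡ-+ m (c * x) (dot cs η))

  ⟦addᴸ⟧ : ∀ {n} (a b : Lin n) η → ⟦ addᴸ a b ⟧ᴸ η ≡ ⟦ a ⟧ᴸ η + ⟦ b ⟧ᴸ η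
  ⟦addᴸ⟧ (k , cs) (l , ds) η rewrite dot-add cs ds η =
    solve 4 (λ k l u v → k :+′ l :+′ (u :+′ v) := k :+′ u :+′ (l :+′ v)) refl k l (dot cs η) (dot ds η)
    where open +-*-Solver using (solve; _:=_) renaming (_:+_ to _:+′_)

  ⟦mulᴸ⟧ : ∀ {n} m (a : Lin n) η → ⟦ mulᴸ m a ⟧ᴸ η ≡ m * ⟦ a ⟧ᴸ η
  ⟦mulᴸ⟧ m (k , cs) η rewrite dot-mul m cs η = sym (*-distribˡ-+ m k (dot cs η))

  ⟦lin⟧ : ∀ {n} (a : Expr n) η → ⟦ lin a ⟧ᴸ η ≡ ⟦ a ⟧ η
  ⟦lin⟧ (var i)  η = dot-unit i η
  ⟦lin⟧ (con k)  η rewrite dot-zero η = +-identityʳ k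
  ⟦lin⟧ (a :+ b) η = trans (⟦addᴸ⟧ (lin a) (lin b) η) (cong₂ _+_ (⟦lin⟧ a η) (⟦lin⟧ b η))
  ⟦lin⟧ (k :* a) η = trans (⟦mulᴸ⟧ k (lin a) η) (cong (k *_) (⟦lin⟧ a η))

  -- Coefficients are natural numbers, so nothing is moved across the inequality and a variable may
  -- occur on both sides.
  Ineq : ℕ → Set
  Ineq n = Lin n × Lin n

  Holds : ∀ {n} → Env n → Ineq n → Set
  Holds η (l , r) = ⟦ l ⟧ᴸ η ≤ ⟦ r ⟧ᴸ η

  addᴵ : ∀ {n} → Ineq n → Ineq n → Ineq n
  addᴵ (l , r) (l′ , r′) = addᴸ l l′ , addᴸ r r′

  mulᴵ : ∀ {n} → ℕ → Ineq n → Ineq n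
  mulᴵ m (l , r) = mulᴸ m l , mulᴸ m r

  zeroᴵ : ∀ {n} → Ineq n
  zeroᴵ = (0 , Vec.replicate _ 0) , (0 , Vec.replicate _ 0)

  coeffs≤ : ∀ {n} → Vec ℕ n → Vec ℕ n → Bool
  coeffs≤ []       []       = true
  coeffs≤ (c ∷ cs) (d ∷ ds) = (c ≤ᵇ d) ∧ coeffs≤ cs ds

  absurdᴵ : ∀ {n} → Ineq n → Bool
  absurdᴵ ((k , cs) , (l , ds)) = (suc l ≤ᵇ k) ∧ coeffs≤ ds cs

  combine : ∀ {n} → List ℕ → List (Ineq n) → Ineq n
  combine (m ∷ ms) (i ∷ is) = addᴵ (mulᴵ m i) (combine ms is)
  combine _        _        = zeroᴵ

  data Valid {n} (η : Env n) : List (Ineq n) → Set where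
    []  : Valid η []
    _∷_ : ∀ {i is} → Holds η i → Valid η is → Valid η (i ∷ is)

  combine-sound : ∀ {n} {η : Env n} ms {is} → Valid η is → Holds η (combine ms is)
  combine-sound []       _  = ≤-refl
  combine-sound (m ∷ ms) [] = ≤-refl
  combine-sound {η = η} (m ∷ ms) {i ∷ is} (h ∷ hs) = begin
    ⟦ addᴸ (mulᴸ m (proj₁ i)) (proj₁ (combine ms is)) ⟧ᴸ η       ≡⟨ step (proj₁ i) (proj₁ (combine ms is)) ⟩
    m * ⟦ proj₁ i ⟧ᴸ η + ⟦ proj₁ (combine ms is) ⟧ᴸ η            ≤⟨ +-mono-≤ (*-monoʳ-≤ m h) (combine-sound ms hs) ⟩
    m * ⟦ proj₂ i ⟧ᴸ η + ⟦ proj₂ (combine ms is) ⟧ᴸ η            ≡⟨ sym (step (proj₂ i) (proj₂ (combine ms is))) ⟩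
    ⟦ addᴸ (mulᴸ m (proj₂ i)) (proj₂ (combine ms is)) ⟧ᴸ η       ∎
    where
    open ≤-Reasoning
    step : ∀ a b → ⟦ addᴸ (mulᴸ m a) b ⟧ᴸ η ≡ m * ⟦ a ⟧ᴸ η + ⟦ b ⟧ᴸ η
    step a b = trans (⟦addᴸ⟧ (mulᴸ m a) b η) (cong (_+ ⟦ b ⟧ᴸ η) (⟦mulᴸ⟧ m a η))

  coeffs≤-sound : ∀ {n} (cs ds : Vec ℕ n) η → T (coeffs≤ cs ds) → dot cs η ≤ dot ds η
  coeffs≤-sound []       []       []      _ = z≤n
  coeffs≤-sound (c ∷ cs) (d ∷ ds) (x ∷ η) t =
    let c≤d , rest = Equivalence.to T-∧ t in
    +-mono-≤ (*-monoˡ-≤ x (≤ᵇ⇒≤ c d c≤d)) (coeffs≤-sound cs ds η rest)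

  absurdᴵ-sound : ∀ {n} (i : Ineq n) {η} → T (absurdᴵ i) → Holds η i → ⊥
  absurdᴵ-sound ((k , cs) , (l , ds)) {η} t h =
    let l<k , rest = Equivalence.to T-∧ t in
    <⇒≱ (+-mono-<-≤ (≤ᵇ⇒≤ (suc l) k l<k) (coeffs≤-sound ds cs η rest)) h

  ineqs : ∀ {n} → Atom n → List (Ineq n)
  ineqs (a :≤ b) = (lin a , lin b) ∷ []
  ineqs (a :< b) = (lin (con 1 :+ a) , lin b) ∷ []
  ineqs (a :≡ b) = (lin a , lin b) ∷ (lin b , lin a) ∷ []
  ineqs :⊥       = (lin (con 1) , lin (con 0)) ∷ []

  ineqs-sound : ∀ {n} (h : Atom n) {η is} → ⟦ h ⟧ᴬ η → Valid η is → Valid η (ineqs h ++ is)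
  ineqs-sound (a :≤ b) {η} h hs = subst₂ _≤_ (sym (⟦lin⟧ a η)) (sym (⟦lin⟧ b η)) h ∷ hs
  ineqs-sound (a :< b) {η} h hs = subst₂ _≤_ (sym (⟦lin⟧ (con 1 :+ a) η)) (sym (⟦lin⟧ b η)) h ∷ hs
  ineqs-sound (a :≡ b) {η} h hs =
    ≤-reflexive (trans (⟦lin⟧ a η) (trans h (sym (⟦lin⟧ b η)))) ∷
    ≤-reflexive (trans (⟦lin⟧ b η) (trans (sym h) (sym (⟦lin⟧ a η)))) ∷ hs

  -- The list holds the multipliers with which the initial inequalities add up to the second
  -- component; `search` returns it as the certificate.
  Row : ℕ → Set
  Row n = List ℕ × Ineq n

  addᴹ : List ℕ → List ℕ → List ℕ
  addᴹ (x ∷ xs) (y ∷ ys) = x + y ∷ addᴹ xs ys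
  addᴹ []       ys       = ys
  addᴹ xs       []       = xs

  -- Variables are nonnegative, so a row in which the variable occurs with a
  -- larger coefficient on the left survives its elimination unchanged.
  eliminate : ∀ {n} → Fin n → List (Row n) → List (Row n)
  eliminate i rows = List.filterᵇ (λ r → right r ≤ᵇ left r) rows ++
                     concatMap (λ r → concatMap (resolve r) rows) rows
    where
    left right : Row _ → ℕ
    left  (_ , ((_ , cs) , _)) = Vec.lookup cs i
    right (_ , (_ , (_ , ds))) = Vec.lookup ds i
    resolve : Row _ → Row _ → List (Row _)
    resolve r@(ms , a) s@(ms′ , b) =
      -- `r` bounds the variable from above and `s` from below. Weighted by each other's excess,
      -- they give it equal coefficients on both sides, which is enough for `absurdᴵ`.
      if (suc (right r) ≤ᵇ left r) ∧ (suc (left s) ≤ᵇ right s)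
      then (addᴹ (map ((right s ∸ left s) *_) ms) (map ((left r ∸ right r) *_) ms′)
             , addᴵ (mulᴵ (right s ∸ left s) a) (mulᴵ (left r ∸ right r) b)) ∷ []
      else []

  trivial : ∀ {n} → Ineq n → Bool
  trivial ((k , cs) , (l , ds)) = (k ≤ᵇ l) ∧ coeffs≤ cs ds

  -- Imbert's criterion: after k eliminations only combinations of at most k + 1 inequalities matter.
  prune : ∀ {n} → ℕ → List (Row n) → List (Row n)
  prune k = List.filterᵇ (λ (ms , i) → not (trivial i) ∧ (List.length (List.filterᵇ (1 ≤ᵇ_) ms) ≤ᵇ suc k))

  eliminateAll : ∀ {n} → ℕ → List (Fin n) → List (Row n) → List (Row n)
  eliminateAll k []       rows = rows
  eliminateAll k (i ∷ is) rows = eliminateAll (suc k) is (prune (suc k) (eliminate i rows))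

  initial : ∀ {n} → List ℕ → List (Ineq n) → List (Row n)
  initial ms []       = []
  initial ms (i ∷ is) = (ms ++ (1 ∷ []) , i) ∷ initial (0 ∷ ms) is

  search : ∀ {n} → List (Row n) → List ℕ
  search []             = []
  search ((ms , i) ∷ r) = if absurdᴵ i then ms else search r

  certificate : ∀ {n} → List (Ineq n) → List ℕ
  certificate is = search (eliminateAll 0 (List.allFin _) (initial [] is))

  refutable : ∀ {n} → List (Ineq n) → Bool
  refutable is = absurdᴵ (combine (certificate is) is)

  refute : ∀ {n} {η : Env n} is → T (refutable is) → Valid η is → ⊥
  refute is t hs = absurdᴵ-sound (combine (certificate is) is) t (combine-sound (certificate is) hs)

  provable : ∀ {n} → List (Ineq n) → Problem n → Bool
  provable is (h ⇒ p)      = provable (ineqs h ++ is) p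
  provable is (⊢ (a :≤ b)) = refutable (ineqs (b :< a) ++ is)
  provable is (⊢ (a :< b)) = refutable (ineqs (b :≤ a) ++ is)
  provable is (⊢ (a :≡ b)) = refutable (ineqs (b :< a) ++ is) ∧ refutable (ineqs (a :< b) ++ is)
  provable is (⊢ :⊥)       = refutable is

  provable-sound : ∀ {n} (p : Problem n) {is} {η : Env n} → T (provable is p) → Valid η is → ⟦ p ⟧ᴾ η
  provable-sound (h ⇒ p)      t hs = λ x → provable-sound p t (ineqs-sound h x hs)
  provable-sound (⊢ (a :≤ b)) t hs = ≮⇒≥ λ b<a → refute _ t (ineqs-sound (b :< a) b<a hs)
  provable-sound (⊢ (a :< b)) t hs = ≰⇒> λ b≤a → refute _ t (ineqs-sound (b :≤ a) b≤a hs)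
  provable-sound (⊢ (a :≡ b)) {is} t hs =
    let t₁ , t₂ = Equivalence.to T-∧ t in
    ≤-antisym (≮⇒≥ λ b<a → refute (ineqs (b :< a) ++ is) t₁ (ineqs-sound (b :< a) b<a hs))
              (≮⇒≥ λ a<b → refute (ineqs (a :< b) ++ is) t₂ (ineqs-sound (a :< b) a<b hs))
  provable-sound (⊢ :⊥)       t hs = refute _ t hs

  -- Problems are written as functions of their variables, to which `instantiate` feeds the indexed
  -- variables.
  Family : ℕ → ℕ → Set
  Family n zero    = Problem n
  Family n (suc m) = Expr n → Family n m

  instantiate : ∀ {n m} → Family n m → Vec (Expr n) m → Problem n
  instantiate f []       = f
  instantiate f (x ∷ xs) = instantiate (f x) xs

  ForAll : ∀ {n} → (Env n → Set) → Set
  ForAll {zero}  P = P []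
  ForAll {suc n} P = (x : ℕ) → ForAll (P ∘ (x ∷_))

  forAll : ∀ {n} {P : Env n → Set} → (∀ η → P η) → ForAll P
  forAll {zero}  p = p []
  forAll {suc n} p x = forAll (p ∘ (x ∷_))

  -- The implicit argument is solved by evaluation: for a concrete `f` the search runs during type
  -- checking, and success turns the type of the argument into the unit type.
  lia : ∀ n (f : Family n n) → let p = instantiate f (Vec.map var (Vec.allFin n)) in
        {_ : T (provable [] p)} → ForAll ⟦ p ⟧ᴾ
  lia n f {t} = forAll {P = ⟦ instantiate f (Vec.map var (Vec.allFin n)) ⟧ᴾ} λ η → provable-sound (instantiate f (Vec.map var (Vec.allFin n))) {[]} {η} t []

open LinearArithmetic using (lia; con; _:+_; _:*_; _:≤_; _:<_; _:≡_; :⊥; _⇒_; ⊢_)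

-- Finite sums over initial segments of ℕ

∑ : ℕ → (ℕ → ℕ) → ℕ
∑ zero    f = 0
∑ (suc n) f = f 0 + ∑ n (f ∘ suc)

∑-cong : ∀ n {f g} → (∀ x → x < n → f x ≡ g x) → ∑ n f ≡ ∑ n g
∑-cong zero    eq = refl
∑-cong (suc n) eq = cong₂ _+_ (eq 0 z<s) (∑-cong n λ x x<n → eq (suc x) (s<s x<n))

∑-mono : ∀ n {f g} → (∀ x → x < n → f x ≤ g x) → ∑ n f ≤ ∑ n g
∑-mono zero    le = z≤n
∑-mono (suc n) le = +-mono-≤ (le 0 z<s) (∑-mono n λ x x<n → le (suc x) (s<s x<n))

∑-zero : ∀ n {f} → (∀ x → x < n → f x ≡ 0) → ∑ n f ≡ 0
∑-zero zero    eq = refl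
∑-zero (suc n) eq rewrite eq 0 z<s = ∑-zero n λ x x<n → eq (suc x) (s<s x<n)

∑-one : ∀ n {f} → (∀ x → x < n → f x ≡ 1) → ∑ n f ≡ n
∑-one zero    eq = refl
∑-one (suc n) eq rewrite eq 0 z<s = cong suc (∑-one n λ x x<n → eq (suc x) (s<s x<n))

∑-+ : ∀ n f g → ∑ n (λ x → f x + g x) ≡ ∑ n f + ∑ n g
∑-+ zero    f g = refl
∑-+ (suc n) f g = trans (cong (f 0 + g 0 +_) (∑-+ n (f ∘ suc) (g ∘ suc)))
  (lia 4 (λ a b c d → ⊢ a :+ b :+ (c :+ d) :≡ a :+ c :+ (b :+ d)) (f 0) (g 0) (∑ n (f ∘ suc)) (∑ n (g ∘ suc)))

∑-* : ∀ n c f → ∑ n (λ x → c * f x) ≡ c * ∑ n f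
∑-* zero    c f = sym (*-zeroʳ c)
∑-* (suc n) c f = trans (cong (c * f 0 +_) (∑-* n c (f ∘ suc))) (sym (*-distribˡ-+ c (f 0) _))

∑-split : ∀ m n f → ∑ (m + n) f ≡ ∑ m f + ∑ n (λ x → f (m + x))
∑-split zero    n f = refl
∑-split (suc m) n f = trans (cong (f 0 +_) (∑-split m n (f ∘ suc))) (sym (+-assoc (f 0) _ _))

∑-last : ∀ n f → ∑ (suc n) f ≡ ∑ n f + f n
∑-last zero    f = +-comm (f 0) 0
∑-last (suc n) f = trans (cong (f 0 +_) (∑-last n (f ∘ suc))) (sym (+-assoc (f 0) _ _))

∑-swap : ∀ m n (f : ℕ → ℕ → ℕ) → ∑ m (λ x → ∑ n (f x)) ≡ ∑ n (λ y → ∑ m (λ x → f x y))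
∑-swap zero    n f = sym (∑-zero n λ _ _ → refl)
∑-swap (suc m) n f = trans (cong (∑ n (f 0) +_) (∑-swap m n (f ∘ suc)))
  (sym (∑-+ n (f 0) (λ y → ∑ m (λ x → f (suc x) y))))

term≤∑ : ∀ n f {x} → x < n → f x ≤ ∑ n f
term≤∑ (suc n) f {zero}  x<n       = m≤m+n (f 0) _
term≤∑ (suc n) f {suc x} (s<s x<n) = ≤-trans (term≤∑ n (f ∘ suc) x<n) (m≤n+m _ (f 0))

∑-≤-extend : ∀ {m n} f → m ≤ n → ∑ m f ≤ ∑ n f
∑-≤-extend {m} {n} f m≤n rewrite sym (m+[n∸m]≡n m≤n) | ∑-split m (n ∸ m) f = m≤m+n _ _

∑>0⇒∃ : ∀ n f → 0 < ∑ n f → ∃ λ x → x < n × 0 < f x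
∑>0⇒∃ (suc n) f pos with f 0 in eq
... | suc _ = 0 , z<s , subst (0 <_) (sym eq) z<s
... | zero  = let x , x<n , p = ∑>0⇒∃ n (f ∘ suc) pos in suc x , s<s x<n , p

+-≤1 : ∀ {a b} → a ≤ 1 → b ≤ 1 → (0 < a → 0 < b → ⊥) → a + b ≤ 1
+-≤1 {zero}              _  b≤1 _ = b≤1
+-≤1 {suc zero} {zero}   _  _   _ = ≤-refl
+-≤1 {suc zero} {suc _}  _  _   h = ⊥-elim (h z<s z<s)
+-≤1 {suc (suc _)} (s≤s ()) _   _

∑-≤1 : ∀ n f → (∀ x → x < n → f x ≤ 1) →
       (∀ x y → x < n → y < n → 0 < f x → 0 < f y → x ≡ y) → ∑ n f ≤ 1
∑-≤1 zero    f le uniq = z≤n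
∑-≤1 (suc n) f le uniq = +-≤1 (le 0 z<s)
  (∑-≤1 n (f ∘ suc) (λ x x<n → le (suc x) (s<s x<n))
    (λ x y x<n y<n p q → suc-injective (uniq (suc x) (suc y) (s<s x<n) (s<s y<n) p q)))
  λ p q → let x , x<n , r = ∑>0⇒∃ n (f ∘ suc) q in
    case-0 (uniq 0 (suc x) z<s (s<s x<n) p r)
  where
  case-0 : ∀ {x} → 0 ≡ suc x → ⊥
  case-0 ()

-- Moving the window one step trades `f a` for `f (a + n)`, which are equal.
∑-shift : ∀ n f → (∀ x → f (x + n) ≡ f x) → ∀ a → ∑ n (λ x → f (a + x)) ≡ ∑ n f
∑-shift n f per zero    = refl
∑-shift n f per (suc a) = trans (+-cancelˡ-≡ (f a) _ _ rotated) (∑-shift n f per a)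
  where
  open ≡-Reasoning
  rotated : f a + ∑ n (λ x → f (suc a + x)) ≡ f a + ∑ n (λ x → f (a + x))
  rotated = begin
    f a + ∑ n (λ x → f (suc a + x))               ≡⟨ cong₂ _+_ (cong f (sym (+-identityʳ a)))
                                                       (∑-cong n λ x _ → cong f (sym (+-suc a x))) ⟩
    ∑ (suc n) (λ x → f (a + x))                   ≡⟨ ∑-last n (λ x → f (a + x)) ⟩
    ∑ n (λ x → f (a + x)) + f (a + n)             ≡⟨ cong (∑ n (λ x → f (a + x)) +_) (per a) ⟩
    ∑ n (λ x → f (a + x)) + f a                   ≡⟨ +-comm _ (f a) ⟩
    f a + ∑ n (λ x → f (a + x))                   ∎

-- Widening a window that already holds the support adds only zeros. This lets brackets with
-- different opening positions be summed over one common window.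
∑-window : ∀ {p s n w} (f : ℕ → ℕ) → p ≤ s → s + n ≤ p + w →
           (∀ e → 0 < f e → s ≤ e × e < s + n) →
           ∑ n (λ i → f (s + i)) ≡ ∑ w (λ i → f (p + i))
∑-window {p} {s} {n} {w} f p≤s s+n≤p+w supp = begin
  ∑ n (λ x → f (s + x))                                    ≡⟨ ∑-cong n (λ x _ → cong f (s+x≡ x)) ⟩
  ∑ n (λ x → g (u + x))                                    ≡⟨ cong (_+ ∑ n (λ x → g (u + x))) (∑-zero u below) ⟨
  ∑ u g + ∑ n (λ x → g (u + x))                            ≡⟨ ∑-split u n g ⟨
  ∑ (u + n) g                                              ≡⟨ +-identityʳ _ ⟨
  ∑ (u + n) g + 0                                          ≡⟨ cong (∑ (u + n) g +_) (∑-zero v above) ⟨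
  ∑ (u + n) g + ∑ v (λ x → g (u + n + x))                  ≡⟨ ∑-split (u + n) v g ⟨
  ∑ (u + n + v) g                                          ≡⟨ cong (λ w → ∑ w g) u+n+v≡w ⟩
  ∑ w g                                                    ∎
  where
  open ≡-Reasoning
  u v : ℕ
  u = s ∸ p
  v = w ∸ (u + n)
  g : ℕ → ℕ
  g i = f (p + i)
  p+u≡s : p + u ≡ s
  p+u≡s = m+[n∸m]≡n p≤s
  u+n+v≡w : u + n + v ≡ w
  u+n+v≡w = m+[n∸m]≡n (lia 5 (λ p u s n w → p :+ u :≡ s ⇒ s :+ n :≤ p :+ w ⇒ ⊢ u :+ n :≤ w) p u s n w p+u≡s s+n≤p+w)
  s+x≡ : ∀ x → s + x ≡ p + (u + x)
  s+x≡ x = trans (cong (_+ x) (sym p+u≡s)) (+-assoc p u x)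
  vanish : ∀ e → (s ≤ e → e < s + n → ⊥) → f e ≡ 0
  vanish e out with f e in eq
  ... | zero  = refl
  ... | suc _ = let a , b = supp e (subst (0 <_) (sym eq) z<s) in ⊥-elim (out a b)
  below : ∀ x → x < u → g x ≡ 0
  below x x<u = vanish (p + x) λ s≤ _ →
    lia 4 (λ p u s x → p :+ u :≡ s ⇒ x :< u ⇒ s :≤ p :+ x ⇒ ⊢ :⊥) p u s x p+u≡s x<u s≤
  above : ∀ x → x < v → g (u + n + x) ≡ 0
  above x _ = vanish (p + (u + n + x)) λ _ →
    lia 5 (λ p u s n x → p :+ u :≡ s ⇒ p :+ (u :+ n :+ x) :< s :+ n ⇒ ⊢ :⊥) p u s n x p+u≡s

-- Indicators and bounded search

𝟙 : ∀ {P : Set} → Dec P → ℕ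
𝟙 d = if does d then 1 else 0

𝟙≤1 : ∀ {P : Set} (d : Dec P) → 𝟙 d ≤ 1
𝟙≤1 (yes _) = ≤-refl
𝟙≤1 (no _)  = z≤n

𝟙-yes : ∀ {P : Set} (d : Dec P) → P → 𝟙 d ≡ 1
𝟙-yes (yes _) p = refl
𝟙-yes (no ¬p) p = contradiction p ¬p

𝟙-no : ∀ {P : Set} (d : Dec P) → ¬ P → 𝟙 d ≡ 0
𝟙-no (yes p) ¬p = contradiction p ¬p
𝟙-no (no _)  ¬p = refl

𝟙>0 : ∀ {P : Set} (d : Dec P) → 0 < 𝟙 d → P
𝟙>0 (yes p) _ = p

𝟙-cong : ∀ {P Q : Set} (d : Dec P) (d′ : Dec Q) → (P → Q) → (Q → P) → 𝟙 d ≡ 𝟙 d′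
𝟙-cong (yes p) d′ f g = sym (𝟙-yes d′ (f p))
𝟙-cong (no ¬p) d′ f g = sym (𝟙-no d′ (¬p ∘ g))

∑-𝟙-unique : ∀ n {P : ℕ → Set} (P? : Decidable P) {x} → x < n → P x →
             (∀ y → y < n → P y → y ≡ x) → ∑ n (𝟙 ∘ P?) ≡ 1
∑-𝟙-unique n P? {x} x<n px uniq = ≤-antisym
  (∑-≤1 n (𝟙 ∘ P?) (λ y _ → 𝟙≤1 (P? y)) λ y z y<n z<n p q →
    trans (uniq y y<n (𝟙>0 (P? y) p)) (sym (uniq z z<n (𝟙>0 (P? z) q))))
  (≤-trans (≤-reflexive (sym (𝟙-yes (P? x) px))) (term≤∑ n (𝟙 ∘ P?) x<n))

-- The relation `C` is a 0-1 matrix with a single 1 in each row satisfying `P` and in each column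
-- satisfying `Q`, and no others; both counts are its total.
double-counting : ∀ m n {P Q : ℕ → Set} {C : ℕ → ℕ → Set}
  (P? : Decidable P) (Q? : Decidable Q) (C? : ∀ x y → Dec (C x y)) →
  (∀ x → x < m → P x → ∃ λ y → y < n × C x y) →
  (∀ y → y < n → Q y → ∃ λ x → x < m × C x y) →
  (∀ {x y} → x < m → y < n → C x y → P x × Q y) →
  (∀ {x y y′} → x < m → y < n → y′ < n → C x y → C x y′ → y ≡ y′) →
  (∀ {x x′ y} → x < m → x′ < m → y < n → C x y → C x′ y → x ≡ x′) →
  ∑ m (𝟙 ∘ P?) ≡ ∑ n (𝟙 ∘ Q?)
double-counting m n {C = C} P? Q? C? left right sound uniqʳ uniqˡ = begin
  ∑ m (𝟙 ∘ P?)                          ≡⟨ ∑-cong m rows ⟩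
  ∑ m (λ x → ∑ n (λ y → 𝟙 (C? x y)))    ≡⟨ ∑-swap m n _ ⟩
  ∑ n (λ y → ∑ m (λ x → 𝟙 (C? x y)))    ≡⟨ ∑-cong n columns ⟨
  ∑ n (𝟙 ∘ Q?)                          ∎
  where
  open ≡-Reasoning
  rows : ∀ x → x < m → 𝟙 (P? x) ≡ ∑ n (λ y → 𝟙 (C? x y))
  rows x x<m with P? x
  ... | yes px = let y , y<n , c = left x x<m px in
    sym (∑-𝟙-unique n (C? x) y<n c λ y′ y′<n c′ → uniqʳ x<m y′<n y<n c′ c)
  ... | no ¬px = sym (∑-zero n λ y y<n → 𝟙-no (C? x y) (¬px ∘ proj₁ ∘ sound x<m y<n))
  columns : ∀ y → y < n → 𝟙 (Q? y) ≡ ∑ m (λ x → 𝟙 (C? x y))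
  columns y y<n with Q? y
  ... | yes qy = let x , x<m , c = right y y<n qy in
    sym (∑-𝟙-unique m (flip C? y) x<m c λ x′ x′<m c′ → uniqˡ x′<m x<m y<n c′ c)
  ... | no ¬qy = sym (∑-zero m λ x x<m → 𝟙-no (C? x y) (¬qy ∘ proj₂ ∘ sound x<m y<n))

abstract

  -- A failed search returns the bound; `span` and `offset` rely on this default.
  least : ∀ {P : ℕ → Set} → Decidable P → ℕ → ℕ
  least P? zero    = 0
  least P? (suc n) = if does (P? 0) then 0 else suc (least (λ x → P? (suc x)) n)

  least≤ : ∀ {P : ℕ → Set} (P? : Decidable P) n → least P? n ≤ n
  least≤ P? zero    = z≤n
  least≤ P? (suc n) with P? 0
  ... | yes _ = z≤n
  ... | no  _ = s≤s (least≤ (λ x → P? (suc x)) n)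

  least-minimal : ∀ {P : ℕ → Set} (P? : Decidable P) n {x} → x < least P? n → ¬ P x
  least-minimal P? (suc n) {x} x<l p with P? 0
  least-minimal P? (suc n) {zero}  x<l       p | no ¬p = ¬p p
  least-minimal P? (suc n) {suc x} (s<s x<l) p | no ¬p = least-minimal (λ x → P? (suc x)) n x<l p

  least-≤ : ∀ {P : ℕ → Set} (P? : Decidable P) n {x} → P x → least P? n ≤ x
  least-≤ P? n p = ≮⇒≥ λ x<l → least-minimal P? n x<l p

  least-satisfies : ∀ {P : ℕ → Set} (P? : Decidable P) n → least P? n < n → P (least P? n)
  least-satisfies P? (suc n) l<n with P? 0
  ... | yes p = p
  ... | no  _ = least-satisfies (λ x → P? (suc x)) n (s<s⁻¹ l<n)

  least-cong : ∀ {P Q : ℕ → Set} (P? : Decidable P) (Q? : Decidable Q) n →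
               (∀ x → P x → Q x) → (∀ x → Q x → P x) → least P? n ≡ least Q? n
  least-cong P? Q? zero    f g = refl
  least-cong P? Q? (suc n) f g with P? 0 | Q? 0
  ... | yes _ | yes _ = refl
  ... | yes p | no ¬q = contradiction (f 0 p) ¬q
  ... | no ¬p | yes q = contradiction (g 0 q) ¬p
  ... | no _  | no _  = cong suc (least-cong (λ x → P? (suc x)) (λ x → Q? (suc x)) n (λ x → f (suc x)) (λ x → g (suc x)))

  greatest : ∀ {P : ℕ → Set} → Decidable P → ℕ → ℕ
  greatest P? zero    = 0
  greatest P? (suc n) = if does (P? n) then n else greatest P? n

  greatest-satisfies : ∀ {P : ℕ → Set} (P? : Decidable P) n {x} → x < n → P x → P (greatest P? n)
  greatest-satisfies P? (suc n) {x} x<n p with P? n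
  ... | yes q = q
  ... | no ¬q with m≤n⇒m<n∨m≡n (s≤s⁻¹ x<n)
  ...   | inj₁ x<n′ = greatest-satisfies P? n x<n′ p
  ...   | inj₂ refl = contradiction p ¬q

  greatest< : ∀ {P : ℕ → Set} (P? : Decidable P) n → 0 < n → greatest P? n < n
  greatest< P? (suc n) _ with P? n
  ... | yes _ = ≤-refl
  greatest< P? (suc zero)    _ | no _ = ≤-refl
  greatest< P? (suc (suc n)) _ | no _ = m≤n⇒m≤1+n (greatest< P? (suc n) z<s)

  ≤-greatest : ∀ {P : ℕ → Set} (P? : Decidable P) n {x} → x < n → P x → x ≤ greatest P? n
  ≤-greatest P? (suc n) x<n p with P? n
  ... | yes _ = s≤s⁻¹ x<n
  ... | no ¬q with m≤n⇒m<n∨m≡n (s≤s⁻¹ x<n)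
  ...   | inj₁ x<n′ = ≤-greatest P? n x<n′ p
  ...   | inj₂ refl = contradiction p ¬q

last-of-run : ∀ {P : ℕ → Set} (P? : Decidable P) {j} m → P j → ¬ P (j + m) →
              ∃ λ x → j ≤ x × P x × ¬ P (suc x)
last-of-run {P} P? {j} zero    p ¬q = contradiction p (subst (λ x → ¬ P x) (+-identityʳ j) ¬q)
last-of-run {P} P? {j} (suc m) p ¬q with P? (suc j)
... | no ¬p′ = j , ≤-refl , p , ¬p′
... | yes p′ = let x , j<x , r = last-of-run P? m p′ (subst (λ x → ¬ P x) (+-suc j m) ¬q) in
               x , <⇒≤ j<x , r

-- From codes to partitions

module Correspondence (N ℓ : ℕ) (N>0 : 0 < N) where

  -- L j e is the last element of the block of e in the j-th partition, lifted
  -- to the universal cover ℕ of ℤ/N; the value e + N means that the block is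
  -- the ρ-invariant one.  Levels are counted from 0, and those ≥ ℓ stand for the
  -- one-block partition.

  Closed : (ℕ → ℕ → ℕ) → ℕ → ℕ → Set
  Closed L j e = L j e < e + N

  -- `nested` is the noncrossing condition. Refinement is split in two: `coarser` for elements
  -- outside the invariant `j`-block, while `reflects` says that an `i`-block, not itself invariant,
  -- with an element in the invariant `j`-block also has its last element there.
  record LastChain (L : ℕ → ℕ → ℕ) : Set where
    field
      extensive : ∀ j e → e ≤ L j e
      bounded   : ∀ j e → L j e ≤ e + N
      periodic  : ∀ j e → L j (e + N) ≡ L j e + N
      nested    : ∀ {j e e′} → Closed L j e → e ≤ e′ → e′ ≤ L j e → L j e′ ≤ L j e
      monotone  : ∀ {i j} e → i ≤ j → L i e ≤ L j e
      coarser   : ∀ {i j e} → i ≤ j → Closed L j e → L j (L i e) ≡ L j e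
      reflects  : ∀ {i j e} → i ≤ j → Closed L i e → Closed L j (L i e) → Closed L j e
      top       : ∀ {j} e → ℓ ≤ j → L j e ≡ e + N

    closed-↓ : ∀ {i j e} → i ≤ j → Closed L j e → Closed L i e
    closed-↓ {e = e} i≤j c = ≤-<-trans (monotone e i≤j) c

    idempotent : ∀ {j e} → Closed L j e → L j (L j e) ≡ L j e
    idempotent {j} {e} c = ≤-antisym (nested c (extensive j e) ≤-refl) (extensive j (L j e))

    fixed⇒closed : ∀ {j e} → L j (L j e) ≡ L j e → Closed L j e
    fixed⇒closed {j} {e} fix with m≤n⇒m<n∨m≡n (bounded j e)
    ... | inj₁ c  = c
    ... | inj₂ eq = ⊥-elim (lia 4 (λ l e ll N → con 0 :< N ⇒ ll :≡ l :+ N ⇒ ll :≡ l ⇒ ⊢ :⊥)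
                      (L j e) e (L j (L j e)) N N>0 step fix)
      where
      step : L j (L j e) ≡ L j e + N
      step = trans (cong (L j) eq) (periodic j e)

    closed-+N : ∀ {j e} → Closed L j e → Closed L j (e + N)
    closed-+N {j} {e} c = subst (_< e + N + N) (sym (periodic j e)) (+-monoˡ-< N c)

    closed-−N : ∀ {j e} → Closed L j (e + N) → Closed L j e
    closed-−N {j} {e} c = +-cancelʳ-< N _ _ (subst (_< e + N + N) (periodic j e) c)

    closed⇒level : ∀ {j e} → Closed L j e → j < ℓ
    closed⇒level {j} {e} c = ≰⇒> λ ℓ≤j → <⇒≢ c (top e ℓ≤j)

  -- a p v is the label of the bracket of level v opening at p, or 0 if there is
  -- none.  At one position the brackets of larger level are the outer ones.
  record Code (a : ℕ → ℕ → ℕ) : Set where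
    field
      periodic : ∀ p v → a (p + N) v ≡ a p v
      top      : ∀ {v} p → ℓ ≤ v → a p v ≡ 0
      light    : ∑ N (λ p → ∑ ℓ (a p)) ≤ N

  module Decode (a : ℕ → ℕ → ℕ) where

    -- The labels of the bracket (p , v), of those inside it at p, and of all
    -- brackets opening at the next d positions.
    opened : ℕ → ℕ → ℕ → ℕ
    opened p v d = ∑ (suc v) (a p) + ∑ d (λ i → ∑ ℓ (a (p + suc i)))

    abstract

      -- `suc d` is the number of positions from `p` to `p + d`, each using up one unit of label;
      -- the closing position itself counts.
      span : ℕ → ℕ → ℕ
      span p v = least (λ d → opened p v d ≤? suc d) N

      span-≤ : ∀ p v {d} → opened p v d ≤ suc d → span p v ≤ d
      span-≤ p v = least-≤ (λ d → opened p v d ≤? suc d) N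

      span-satisfies : ∀ p v → span p v < N → opened p v (span p v) ≤ suc (span p v)
      span-satisfies p v = least-satisfies (λ d → opened p v d ≤? suc d) N

      span-cong : ∀ p v p′ v′ → (∀ d → opened p v d ≡ opened p′ v′ d) → span p v ≡ span p′ v′
      span-cong p v p′ v′ eq = least-cong _ _ N (λ d → subst (_≤ suc d) (eq d)) (λ d → subst (_≤ suc d) (sym (eq d)))

    close : ℕ → ℕ → ℕ
    close p v = p + span p v

    -- Asked for only with `e ≤ l`, which makes the bracket contain `e`.
    record Covers (j e l : ℕ) : Set where
      constructor covers
      field
        {pos level} : ℕ
        above    : j ≤ level
        present  : 0 < a pos level
        before   : pos ≤ e
        closes   : close pos level ≡ l

    abstract

      -- Both existentials are bounded: `top` confines labels to levels below `ℓ`, and the opening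
      -- position is at most `e`.
      covers? : (∀ {v} p → ℓ ≤ v → a p v ≡ 0) → ∀ j e l → Dec (Covers j e l)
      covers? top j e l = map′
        (λ { (_ , _ , _ , v≥j , (s≤s p≤e) , pr , eq) → covers v≥j pr p≤e eq })
        (λ { (covers {p} {v} v≥j pr p≤e eq) → v , level< pr , p , v≥j , s≤s p≤e , pr , eq })
        (anyUpTo? (λ v → map′ (λ (p , p<e , v≥j , pr , eq) → p , v≥j , p<e , pr , eq)
                              (λ (p , v≥j , p<e , pr , eq) → p , p<e , v≥j , pr , eq)
           (anyUpTo? (λ p → (j ≤? v) ×-dec (0 <? a p v) ×-dec (close p v ≟ l)) (suc e))) ℓ)
        where
        level< : ∀ {p v} → 0 < a p v → v < ℓ
        level< {p} {v} pr = ≰⇒> λ ℓ≤v → <⇒≢ pr (sym (top p ℓ≤v))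

  module Decoding {a : ℕ → ℕ → ℕ} (code : Code a) where
    open Code code
    open Decode a public

    present-+N : ∀ {p v} → 0 < a p v → 0 < a (p + N) v
    present-+N {p} {v} = subst (0 <_) (sym (periodic p v))

    present-−N : ∀ {p v} → 0 < a (p + N) v → 0 < a p v
    present-−N {p} {v} = subst (0 <_) (periodic p v)

    level<ℓ : ∀ {p v} → 0 < a p v → v < ℓ
    level<ℓ {p} {v} pr = ≰⇒> λ ℓ≤v → <⇒≢ pr (sym (top p ℓ≤v))

    opened-+N : ∀ p v d → opened (p + N) v d ≡ opened p v d
    opened-+N p v d = cong₂ _+_ (∑-cong (suc v) λ w _ → periodic p w)
      (∑-cong d λ i _ → ∑-cong ℓ λ w _ →
        trans (cong (λ q → a q w) (lia 3 (λ p N i → ⊢ p :+ N :+ (con 1 :+ i) :≡ p :+ (con 1 :+ i) :+ N) p N i))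
              (periodic (p + suc i) w))

    span-+N : ∀ p v → span (p + N) v ≡ span p v
    span-+N p v = span-cong (p + N) v p v (opened-+N p v)

    close-+N : ∀ p v → close (p + N) v ≡ close p v + N
    close-+N p v = trans (cong (p + N +_) (span-+N p v))
      (lia 3 (λ p N l → ⊢ p :+ N :+ l :≡ p :+ l :+ N) p N (span p v))

    -- The brackets counted here are among those of one full period, whose labels total at most `N`
    -- by `light`. This forces every bracket to close within `N` positions.
    opened-period : ∀ {p v} → 0 < a p v → opened p v (N ∸ 1) ≤ N
    opened-period {p} {v} pr = begin
      ∑ (suc v) (a p) + ∑ (N ∸ 1) (λ i → ∑ ℓ (a (p + suc i)))
        ≤⟨ +-monoˡ-≤ _ (∑-≤-extend (a p) (level<ℓ pr)) ⟩
      ∑ ℓ (a p) + ∑ (N ∸ 1) (λ i → ∑ ℓ (a (p + suc i)))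
        ≡⟨ cong (λ q → ∑ ℓ (a q) + ∑ (N ∸ 1) (λ i → ∑ ℓ (a (p + suc i)))) (sym (+-identityʳ p)) ⟩
      ∑ (suc (N ∸ 1)) (λ i → ∑ ℓ (a (p + i)))
        ≡⟨ cong (λ n → ∑ n (λ i → ∑ ℓ (a (p + i)))) (m+[n∸m]≡n N>0) ⟩
      ∑ N (λ i → ∑ ℓ (a (p + i)))
        ≡⟨ ∑-shift N (λ q → ∑ ℓ (a q)) (λ q → ∑-cong ℓ λ w _ → periodic q w) p ⟩
      ∑ N (λ q → ∑ ℓ (a q))
        ≤⟨ light ⟩
      N ∎
      where open ≤-Reasoning

    span<N : ∀ {p v} → 0 < a p v → span p v < N
    span<N {p} {v} pr = ≤-<-trans (span-≤ p v
      (≤-trans (opened-period pr) (≤-reflexive (sym (m+[n∸m]≡n N>0))))) (∸-monoʳ-< z<s N>0)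

    opened-length : ∀ {p v} → 0 < a p v → opened p v (span p v) ≤ suc (span p v)
    opened-length {p} {v} pr = span-satisfies p v (span<N pr)

    opened-before : ∀ {p v d} → d < span p v → suc d < opened p v d
    opened-before {p} {v} d<l = ≰⇒> λ le → <⇒≱ d<l (span-≤ p v le)

    present≤opened : ∀ p v d → a p v ≤ opened p v d
    present≤opened p v d = ≤-trans (term≤∑ (suc v) (a p) ≤-refl) (m≤m+n _ _)

    opened-mono : ∀ p v {d d′} → d ≤ d′ → opened p v d ≤ opened p v d′
    opened-mono p v d≤d′ = +-monoʳ-≤ (∑ (suc v) (a p)) (∑-≤-extend _ d≤d′)

    span-small : ∀ {p v} r → 0 < a p v → opened p v r ≤ r → span p v < r
    span-small {p} {v} zero    pr le = ⊥-elim (<⇒≱ pr (≤-trans (present≤opened p v 0) le))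
    span-small {p} {v} (suc r) pr le =
      s≤s (span-≤ p v (≤-trans (opened-mono p v (n≤1+n r)) le))

    Outside : ℕ → ℕ → ℕ → ℕ → Set
    Outside p v p′ v′ = p < p′ ⊎ p ≡ p′ × v′ < v

    -- One position before `p′` the outer bracket is still open, so the labels opened by then exceed
    -- the positions passed; at its close they no longer do. Hence the labels opened from `p′` up to
    -- that close total less than the positions there, and the inner bracket, which counts only some
    -- of them, is exhausted earlier. At equal positions the outer bracket's own label makes the
    -- difference.
    nesting : ∀ {p v p′ v′} → 0 < a p v → 0 < a p′ v′ → Outside p v p′ v′ →
              p′ ≤ close p v → close p′ v′ < close p v
    nesting {p} {v} {p′} {v′} pr pr′ (inj₁ p<p′) p′≤c
      with i , refl ← m≤n⇒∃[o]m+o≡n p<p′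
      with r , eq ← m≤n⇒∃[o]m+o≡n (+-cancelˡ-≤ p _ _ (≤-trans (≤-reflexive (+-suc p i)) p′≤c)) =
      lia 5 (λ p i r l′ c → con 1 :+ i :+ r :≡ c ⇒ l′ :< r ⇒ ⊢ con 1 :+ p :+ i :+ l′ :< p :+ c)
        p i r (span (suc p + i) v′) (span p v) eq (span-small r pr′ small)
      where
      f : ℕ → ℕ
      f x = ∑ ℓ (a (p + suc x))
      p+1+i : p + suc i ≡ suc p + i
      p+1+i = +-suc p i
      beyond : ∑ r (λ x → f (suc i + x)) ≡ ∑ r (λ x → ∑ ℓ (a (suc p + i + suc x)))
      beyond = ∑-cong r λ x _ → cong (λ q → ∑ ℓ (a q))
        (lia 3 (λ p i x → ⊢ p :+ (con 1 :+ (con 1 :+ i :+ x)) :≡ con 1 :+ p :+ i :+ (con 1 :+ x)) p i x)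
      split : opened p v (span p v) ≡ opened p v i + f i + ∑ r (λ x → f (suc i + x))
      split = begin
        opened p v (span p v)
          ≡⟨ cong (opened p v) eq ⟨
        ∑ (suc v) (a p) + ∑ (suc i + r) f
          ≡⟨ cong (∑ (suc v) (a p) +_) (trans (∑-split (suc i) r f) (cong (_+ ∑ r (λ x → f (suc i + x))) (∑-last i f))) ⟩
        ∑ (suc v) (a p) + (∑ i f + f i + ∑ r (λ x → f (suc i + x)))
          ≡⟨ lia 4 (λ a b c d → ⊢ a :+ (b :+ c :+ d) :≡ a :+ b :+ c :+ d) (∑ (suc v) (a p)) (∑ i f) (f i) _ ⟩
        opened p v i + f i + ∑ r (λ x → f (suc i + x)) ∎
        where open ≡-Reasoning
      before : suc i < opened p v i
      before = opened-before {p} {v} (subst (i <_) eq (m≤m+n (suc i) r))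
      G≤ : ∑ (suc v′) (a (suc p + i)) ≤ f i
      G≤ = ≤-trans (∑-≤-extend (a (suc p + i)) (level<ℓ pr′)) (≤-reflexive (cong (λ q → ∑ ℓ (a q)) (sym p+1+i)))
      small : opened (suc p + i) v′ r ≤ r
      small = lia 8 (λ S c Si fi R r i G → S :≤ con 1 :+ c ⇒ S :≡ Si :+ fi :+ R ⇒ con 1 :+ i :< Si ⇒ G :≤ fi ⇒ con 1 :+ i :+ r :≡ c ⇒
                      ⊢ G :+ R :≤ r)
        (opened p v (span p v)) (span p v) (opened p v i) (f i) (∑ r (λ x → ∑ ℓ (a (suc p + i + suc x)))) r i
        (∑ (suc v′) (a (suc p + i)))
        (opened-length pr) (trans split (cong (opened p v i + f i +_) beyond)) before G≤ eq
    nesting {p} {v} {.p} {v′} pr pr′ (inj₂ (refl , v′<v)) _ = +-monoʳ-< p (span-small (span p v) pr′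
      (s≤s⁻¹ (≤-trans fewer (opened-length pr))))
      where
      open ≤-Reasoning
      fewer : suc (opened p v′ (span p v)) ≤ opened p v (span p v)
      fewer = +-monoˡ-≤ _ (begin
        suc (∑ (suc v′) (a p))   ≡⟨ +-comm 1 _ ⟩
        ∑ (suc v′) (a p) + 1     ≤⟨ +-mono-≤ (∑-≤-extend (a p) v′<v) pr ⟩
        ∑ v (a p) + a p v        ≡⟨ ∑-last v (a p) ⟨
        ∑ (suc v) (a p)          ∎)

    -- The search takes place at e + N, where every bracket around e has an
    -- opening position in ℕ.
    abstract

      offset : ℕ → ℕ → ℕ
      offset j e = least (λ d → covers? top j (e + N) (e + N + d)) N

      offset-≤N : ∀ j e → offset j e ≤ N
      offset-≤N j e = least≤ (λ d → covers? top j (e + N) (e + N + d)) N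

      offset-≤ : ∀ j e {d} → Covers j (e + N) (e + N + d) → offset j e ≤ d
      offset-≤ j e = least-≤ (λ d → covers? top j (e + N) (e + N + d)) N

      offset-satisfies : ∀ j e → offset j e < N → Covers j (e + N) (e + N + offset j e)
      offset-satisfies j e = least-satisfies (λ d → covers? top j (e + N) (e + N + d)) N

      offset-cong : ∀ j e e′ → (∀ d → Covers j (e + N) (e + N + d) → Covers j (e′ + N) (e′ + N + d)) →
                    (∀ d → Covers j (e′ + N) (e′ + N + d) → Covers j (e + N) (e + N + d)) → offset j e ≡ offset j e′
      offset-cong j e e′ = least-cong _ _ N

    -- Without a covering bracket the offset is `N`, which gives the value `e + N` that marks the
    -- invariant block.
    dec : ℕ → ℕ → ℕ
    dec j e = e + offset j e

    dec-covers : ∀ {j e} → Closed dec j e → Covers j (e + N) (dec j e + N)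
    dec-covers {j} {e} c = subst (Covers j (e + N))
      (lia 3 (λ e N d → ⊢ e :+ N :+ d :≡ e :+ d :+ N) e N (offset j e))
      (offset-satisfies j e (+-cancelˡ-< e _ _ c))

    dec-minimal : ∀ {j e p v} → j ≤ v → 0 < a p v → p ≤ e + N → e + N ≤ close p v → dec j e + N ≤ close p v
    dec-minimal {j} {e} {p} {v} j≤v pr p≤e e≤c with d , eq ← m≤n⇒∃[o]m+o≡n e≤c =
      lia 5 (λ e N o d c → e :+ N :+ d :≡ c ⇒ o :≤ d ⇒ ⊢ e :+ o :+ N :≤ c) e N (offset j e) d (close p v) eq
        (offset-≤ j e {d} (covers j≤v pr p≤e (sym eq)))

    dec-≤ : ∀ {j e} l {p v} → j ≤ v → 0 < a p v → p ≤ e + N → e ≤ l → close p v ≡ l + N → dec j e ≤ l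
    dec-≤ {j} {e} l {p} {v} j≤v pr p≤e e≤l eq = +-cancelʳ-≤ N (dec j e) l (≤-trans
      (dec-minimal j≤v pr p≤e (≤-trans (+-monoˡ-≤ N e≤l) (≤-reflexive (sym eq)))) (≤-reflexive eq))

    close< : ∀ {e p v} → 0 < a p v → p ≤ e + N → close p v < e + N + N
    close< pr p≤e = +-mono-≤-< p≤e (span<N pr)

    dec-bounded : ∀ j e → dec j e ≤ e + N
    dec-bounded j e = +-monoʳ-≤ e (offset-≤N j e)

    dec-periodic : ∀ j e → dec j (e + N) ≡ dec j e + N
    dec-periodic j e = trans (cong (e + N +_) (offset-cong j (e + N) e down up))
      (lia 3 (λ e N o → ⊢ e :+ N :+ o :≡ e :+ o :+ N) e N (offset j e))
      where
      up : ∀ d → Covers j (e + N) (e + N + d) → Covers j (e + N + N) (e + N + N + d)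
      up d (covers {p} {v} j≤v pr p≤e eq) = covers j≤v (present-+N pr) (+-monoˡ-≤ N p≤e)
        (trans (close-+N p v) (trans (cong (_+ N) eq)
          (lia 3 (λ e N d → ⊢ e :+ N :+ d :+ N :≡ e :+ N :+ N :+ d) e N d)))
      down : ∀ d → Covers j (e + N + N) (e + N + N + d) → Covers j (e + N) (e + N + d)
      down d (covers {p} {v} j≤v pr p≤e eq) =
        covers {pos = q} j≤v (present-−N pr′) q≤ (+-cancelʳ-≡ N _ _
          (trans (sym (close-+N q v)) (trans (cong (λ x → close x v) q+N≡p) (trans eq
            (lia 3 (λ e N d → ⊢ e :+ N :+ N :+ d :≡ e :+ N :+ d :+ N) e N d)))))
        where
        N≤p : N ≤ p
        N≤p = lia 5 (λ p c e N d → p :+ c :≡ e :+ N :+ N :+ d ⇒ c :< N ⇒ ⊢ N :≤ p) p (span p v) e N d eq (span<N pr)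
        q : ℕ
        q = p ∸ N
        q+N≡p : q + N ≡ p
        q+N≡p = m∸n+n≡m N≤p
        pr′ : 0 < a (q + N) v
        pr′ = subst (λ x → 0 < a x v) (sym q+N≡p) pr
        q≤ : q ≤ e + N
        q≤ = +-cancelʳ-≤ N _ _ (≤-trans (≤-reflexive q+N≡p) p≤e)

    dec-nested : ∀ {j e e′} → Closed dec j e → e ≤ e′ → e′ ≤ dec j e → dec j e′ ≤ dec j e
    dec-nested {j} {e} c e≤e′ e′≤l = let covers j≤v pr p≤e eq = dec-covers c in
      dec-≤ (dec j e) j≤v pr (≤-trans p≤e (+-monoˡ-≤ N e≤e′)) e′≤l eq

    dec-monotone : ∀ {i j} e → i ≤ j → dec i e ≤ dec j e
    dec-monotone {i} {j} e i≤j with m≤n⇒m<n∨m≡n (dec-bounded j e)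
    ... | inj₂ eq = ≤-trans (dec-bounded i e) (≤-reflexive (sym eq))
    ... | inj₁ c = let covers j≤v pr p≤e eq = dec-covers c in
      dec-≤ (dec j e) (≤-trans i≤j j≤v) pr p≤e (m≤m+n e _) eq

    -- The level-`j` bracket around the end of the `i`-block of `e` also contains `e`: had it opened
    -- after `e`, it would open inside the bracket closing at that end and, by `nesting`, close
    -- before it.
    dec-lifts : ∀ {i j e} → i ≤ j → Closed dec i e → Closed dec j (dec i e) →
            dec j e ≤ dec j (dec i e) × Closed dec j e
    dec-lifts {i} {j} {e} i≤j ci cj = go (dec-covers ci) (dec-covers cj)
      where
      go : Covers i (e + N) (dec i e + N) → Covers j (dec i e + N) (dec j (dec i e) + N) →
           dec j e ≤ dec j (dec i e) × Closed dec j e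
      go (covers i≤v pr p≤e eq) (covers {p′} {v′} j≤v′ pr′ p′≤l eq′) =
        minimal ,
        +-cancelʳ-< N _ _ (≤-<-trans (≤-trans (+-monoˡ-≤ N minimal) (≤-reflexive (sym eq′))) (close< pr′ p′≤e))
        where
        e≤l : e ≤ dec i e
        e≤l = m≤m+n e _
        p′≤e : p′ ≤ e + N
        p′≤e = ≮⇒≥ λ e<p′ → <⇒≱ (nesting pr pr′ (inj₁ (≤-<-trans p≤e e<p′)) (≤-trans p′≤l (≤-reflexive (sym eq))))
                 (≤-trans (≤-reflexive eq) (≤-trans (+-monoˡ-≤ N (m≤m+n (dec i e) _)) (≤-reflexive (sym eq′))))
        minimal : dec j e ≤ dec j (dec i e)
        minimal = dec-≤ (dec j (dec i e)) j≤v′ pr′ p′≤e (≤-trans e≤l (m≤m+n (dec i e) _)) eq′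

    dec-coarser : ∀ {i j e} → i ≤ j → Closed dec j e → dec j (dec i e) ≡ dec j e
    dec-coarser {i} {j} {e} i≤j cj = ≤-antisym le (proj₁ (dec-lifts i≤j (≤-<-trans (dec-monotone e i≤j) cj)
        (≤-<-trans le (<-≤-trans cj (+-monoˡ-≤ N (m≤m+n e _))))))
      where
      le : dec j (dec i e) ≤ dec j e
      le = let covers j≤v pr p≤e eq = dec-covers cj in
        dec-≤ (dec j e) j≤v pr (≤-trans p≤e (+-monoˡ-≤ N (m≤m+n e _))) (dec-monotone e i≤j) eq

    dec-top : ∀ {j} e → ℓ ≤ j → dec j e ≡ e + N
    dec-top {j} e ℓ≤j with m≤n⇒m<n∨m≡n (dec-bounded j e)
    ... | inj₂ eq = eq
    ... | inj₁ c = let covers j≤v pr _ _ = dec-covers c in ⊥-elim (<⇒≱ (level<ℓ pr) (≤-trans ℓ≤j j≤v))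

    lastChain : LastChain dec
    lastChain = record
      { extensive = λ j e → m≤m+n e _
      ; bounded   = dec-bounded
      ; periodic  = dec-periodic
      ; nested    = dec-nested
      ; monotone  = dec-monotone
      ; coarser   = dec-coarser
      ; reflects  = λ i≤j ci cj → proj₂ (dec-lifts i≤j ci cj)
      ; top       = dec-top
      }

-- From partitions to codes

module Encoding (N ℓ : ℕ) (N>0 : 0 < N) where
  open Correspondence N ℓ N>0

  module Encode (L : ℕ → ℕ → ℕ) where

    -- Stated at p + N, so that all earlier elements of the block lie in ℕ.
    First : ℕ → ℕ → Set
    First p v = ∀ e → e < p + N → L v e ≢ L v p + N

    -- These are the nonzero cells of the code: `first` makes `p` the opening position of its block
    -- at level `v`, and `jump` makes `v` the level of its last element, to which `jump-end`
    -- transfers it.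
    record Token (p v : ℕ) : Set where
      constructor token
      field
        closed : Closed L v p
        jump   : L (suc v) p ≢ L v p
        first  : First p v

    Owns : ℕ → ℕ → ℕ → Set
    Owns p v e = Token p v × L 0 e ≡ L v p

    abstract

      token? : ∀ p v → Dec (Token p v)
      token? p v = map′ (λ (c , j , f) → token c j λ e → f {e}) (λ (token c j f) → c , j , λ {e} → f e)
        ((L v p <? p + N) ×-dec ¬? (L (suc v) p ≟ L v p) ×-dec allUpTo? (λ e → ¬? (L v e ≟ L v p + N)) (p + N))

    owns? : ∀ p v e → Dec (Owns p v e)
    owns? p v e = token? p v ×-dec (L 0 e ≟ L v p)

    -- For a token, the size of the block of `L v p` in the first partition: that block lies between
    -- `p` and `L v p`, hence in the window of `N` positions from `p`.
    enc : ℕ → ℕ → ℕ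
    enc p v = ∑ N (λ i → 𝟙 (owns? p v (p + i)))

  module EncodingOf {L : ℕ → ℕ → ℕ} (chain : LastChain L) where
    open LastChain chain
    open Encode L public

    token-+N : ∀ {p v} → Token p v → Token (p + N) v
    token-+N {p} {v} (token c j f) = token (closed-+N c)
      (λ eq → j (+-cancelʳ-≡ N _ _ (trans (sym (periodic (suc v) p)) (trans eq (periodic v p)))))
      λ e e< eq → later e e< (trans eq (cong (_+ N) (periodic v p)))
      where
      later : ∀ e → e < p + N + N → L v e ≢ L v p + N + N
      later e e< eq = f (e ∸ N) e∸N< (+-cancelʳ-≡ N _ _ (trans (sym (periodic v (e ∸ N)))
                        (trans (cong (L v) (m∸n+n≡m N≤e)) eq)))
        where
        N≤e : N ≤ e
        N≤e = lia 5 (λ l e p x N → l :≡ x :+ N :+ N ⇒ l :≤ e :+ N ⇒ ⊢ N :≤ e) (L v e) e p (L v p) N eq (bounded v e)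
        e∸N< : e ∸ N < p + N
        e∸N< = +-cancelʳ-< N _ _ (≤-<-trans (≤-reflexive (m∸n+n≡m N≤e)) e<)

    token-−N : ∀ {p v} → Token (p + N) v → Token p v
    token-−N {p} {v} (token c j f) = token (closed-−N c)
      (λ eq → j (trans (periodic (suc v) p) (trans (cong (_+ N) eq) (sym (periodic v p)))))
      λ e e< eq → f (e + N) (+-monoˡ-< N e<) (trans (periodic v e) (trans (cong (_+ N) eq) (cong (_+ N) (sym (periodic v p)))))

    owns-+N : ∀ {p v e} → Owns p v e → Owns (p + N) v (e + N)
    owns-+N {p} {v} {e} (t , eq) = token-+N t , trans (periodic 0 e) (trans (cong (_+ N) eq) (sym (periodic v p)))

    owns-−N : ∀ {p v e} → Owns (p + N) v (e + N) → Owns p v e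
    owns-−N {p} {v} {e} (t , eq) = token-−N t ,
      +-cancelʳ-≡ N _ _ (trans (sym (periodic 0 e)) (trans eq (periodic v p)))

    enc-periodic : ∀ p v → enc (p + N) v ≡ enc p v
    enc-periodic p v = ∑-cong N λ i _ → trans
      (cong (λ e → 𝟙 (owns? (p + N) v e)) (lia 3 (λ p N i → ⊢ p :+ N :+ i :≡ p :+ i :+ N) p N i))
      (𝟙-cong (owns? (p + N) v (p + i + N)) (owns? p v (p + i)) owns-−N owns-+N)

    enc-top : ∀ {v} p → ℓ ≤ v → enc p v ≡ 0
    enc-top {v} p ℓ≤v = ∑-zero N λ i _ → 𝟙-no (owns? p v (p + i)) λ (token c _ _ , _) → <⇒≱ (closed⇒level c) ℓ≤v

    first-+N : ∀ {p v e} → Token p v → e < p → L v e ≢ L v p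
    first-+N {p} {v} {e} (token _ _ f) e<p eq = f (e + N) (+-monoˡ-< N e<p) (trans (periodic v e) (cong (_+ N) eq))

    jump-end : ∀ {p v} → Token p v → L (suc v) (L v p) ≢ L v p
    jump-end {p} {v} (token c j _) eq = j (trans (sym (coarser (n≤1+n v) c′)) eq)
      where
      c′ : Closed L (suc v) p
      c′ = reflects (n≤1+n v) c (subst (_< L v p + N) (sym eq) (m<m+n (L v p) N>0))

    token-fixed : ∀ {p v} → Token p v → L v (L v p) ≡ L v p
    token-fixed (token c _ _) = idempotent c

    fixed-↓ : ∀ {i j l} → i ≤ j → L j l ≡ l → L i l ≡ l
    fixed-↓ {i} {j} {l} i≤j eq = ≤-antisym (≤-trans (monotone l i≤j) (≤-reflexive eq)) (extensive i l)

    -- Being an end is inherited by lower levels. Of two tokens with a common end, the one of higher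
    -- level would make it an end just above the level of the other, against `jump-end`.
    token-level : ∀ {p v p′ v′} → Token p v → Token p′ v′ → L v p ≡ L v′ p′ → v ≡ v′
    token-level {p} {v} {p′} {v′} t t′ eq = ≤-antisym (≮⇒≥ λ v′<v → jump-end t′ (fixed-↓ v′<v
        (trans (cong (L v) (sym eq)) (trans (token-fixed t) eq))))
      (≮⇒≥ λ v<v′ → jump-end t (fixed-↓ v<v′ (trans (cong (L v′) eq) (trans (token-fixed t′) (sym eq)))))

    token-position : ∀ {p v p′} → Token p v → Token p′ v → L v p ≡ L v p′ → p ≡ p′
    token-position {p} {v} {p′} t t′ eq with <-cmp p p′
    ... | tri< p<p′ _ _ = contradiction eq (first-+N t′ p<p′)
    ... | tri≈ _ p≡p′ _ = p≡p′
    ... | tri> _ _ p′<p = contradiction (sym eq) (first-+N t p′<p)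

    owns-closed : ∀ {p v e} → Owns p v e → Closed L 0 e × L v e ≡ L v p × Closed L v e
    owns-closed {p} {v} {e} (t , eq) = c₀ , trans (sym (coarser z≤n cᵥ)) (trans (cong (L v) eq) (token-fixed t)) , cᵥ
      where
      fixedᵥ : L v (L 0 e) ≡ L 0 e
      fixedᵥ = subst (λ l → L v l ≡ l) (sym eq) (token-fixed t)
      c₀ : Closed L 0 e
      c₀ = fixed⇒closed (fixed-↓ z≤n fixedᵥ)
      cᵥ : Closed L v e
      cᵥ = reflects z≤n c₀ (subst (_< L 0 e + N) (sym fixedᵥ) (m<m+n (L 0 e) N>0))

    owns-≥ : ∀ {p v e} → Owns p v e → p ≤ e
    owns-≥ o = ≮⇒≥ λ e<p → first-+N (proj₁ o) e<p (proj₁ (proj₂ (owns-closed o)))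

    owns-≤ : ∀ {p v e} → Owns p v e → e ≤ L v p
    owns-≤ {e = e} (t , eq) = ≤-trans (extensive 0 e) (≤-reflexive eq)

    owns-window : ∀ {p v e} → Owns p v e → p ≤ e × e < p + N
    owns-window o@(t , _) = owns-≥ o , ≤-<-trans (owns-≤ o) (Token.closed t)

    owns-level : ∀ {p v p′ v′ e} → Owns p v e → Owns p′ v′ e → v ≡ v′
    owns-level (t , eq) (t′ , eq′) = token-level t t′ (trans (sym eq) eq′)

    owns-position : ∀ {p v p′ e} → Owns p v e → Owns p′ v e → p ≡ p′
    owns-position (t , eq) (t′ , eq′) = token-position t t′ (trans (sym eq) eq′)

    owns-end : ∀ {p v} → Token p v → Owns p v (L v p)
    owns-end t = t , fixed-↓ z≤n (token-fixed t)

    token⇒present : ∀ {p v} → Token p v → 0 < enc p v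
    token⇒present {p} {v} t@(token c _ _) = let d , eq = m≤n⇒∃[o]m+o≡n (extensive v p) in
      ≤-trans (≤-reflexive (sym (𝟙-yes (owns? p v (p + d)) (subst (Owns p v) (sym eq) (owns-end t)))))
        (term≤∑ N (λ i → 𝟙 (owns? p v (p + i))) (+-cancelˡ-< p _ _ (≤-<-trans (≤-reflexive eq) c)))

    present⇒token : ∀ {p v} → 0 < enc p v → Token p v
    present⇒token {p} {v} pos = let i , _ , o = ∑>0⇒∃ N _ pos in proj₁ (𝟙>0 (owns? p v (p + i)) o)

    -- A search from 0 finds the true first element on the cover: the block reaches fewer than `N`
    -- positions below its last element `l`, and `N ≤ e ≤ l`.
    make-token : ∀ {e v l} → N ≤ e → L v e ≡ l → L v l ≡ l → L (suc v) l ≢ l →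
                 ∃ λ p → p ≤ e × Token p v × L v p ≡ l
    make-token {e} {v} {l} N≤e eq fix jmp = p , p≤e , token closed jump first , Lp
      where
      isl? : ∀ x → Dec (L v x ≡ l)
      isl? x = L v x ≟ l
      p : ℕ
      p = least isl? (suc e)
      p≤e : p ≤ e
      p≤e = least-≤ isl? (suc e) eq
      Lp : L v p ≡ l
      Lp = least-satisfies isl? (suc e) (s≤s p≤e)
      closed : Closed L v p
      closed = fixed⇒closed (trans (cong (L v) Lp) (trans fix (sym Lp)))
      jump : L (suc v) p ≢ L v p
      jump eq′ = jmp (trans (cong (L (suc v)) (sym Lp)) (trans (coarser (n≤1+n v)
        (subst (_< p + N) (sym eq′) closed)) (trans eq′ Lp)))
      first : First p v
      first x x< eq′ = least-minimal isl? (suc e) {x ∸ N} (+-cancelʳ-< N _ _ (≤-<-trans (≤-reflexive x-N) x<))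
        (+-cancelʳ-≡ N _ _ (trans (sym (periodic v (x ∸ N))) (trans (cong (L v) x-N) (trans eq′ (cong (_+ N) Lp)))))
        where
        N≤x : N ≤ x
        N≤x = lia 6 (λ a x N b l e → a :≤ x :+ N ⇒ a :≡ b :+ N ⇒ b :≡ l ⇒ e :≤ l ⇒ N :≤ e ⇒ ⊢ N :≤ x) (L v x) x N (L v p) l e
          (bounded v x) eq′ Lp (≤-trans (extensive v e) (≤-reflexive eq)) N≤e
        x-N : x ∸ N + N ≡ x
        x-N = m∸n+n≡m N≤x

    -- The level of a token owning e is the last one at which the end of the block of e is still an end.
    block-token : ∀ {j e} → N ≤ e → Closed L j e → ∃₂ λ p v → j ≤ v × p ≤ e × Token p v × L v p ≡ L j e
    block-token {j} {e} N≤e c =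
      let l = L j e
          v , j≤v , fixᵥ , jmp = last-of-run (λ w → L w l ≟ l) {j} ℓ (idempotent c) top≢
          cᵥ = reflects j≤v c (subst (_< l + N) (sym fixᵥ) (m<m+n l N>0))
          p , p≤e , t , eq = make-token N≤e (trans (sym (coarser j≤v cᵥ)) fixᵥ) fixᵥ jmp
      in p , v , j≤v , p≤e , t , eq
      where
      top≢ : L (j + ℓ) (L j e) ≢ L j e
      top≢ eq = <⇒≢ (m<m+n (L j e) N>0) (sym (trans (sym (top (L j e) (m≤n+m ℓ j))) eq))

    owner : ∀ {e} → N ≤ e → Closed L 0 e → ∃₂ λ p v → Owns p v e
    owner N≤e c = let p , v , _ , _ , t , eq = block-token N≤e c in p , v , t , sym eq

    -- The reflexive version of `Outside`, with the same order of arguments.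
    Inside : ℕ → ℕ → ℕ → ℕ → Set
    Inside p v p′ v′ = p < p′ ⊎ p ≡ p′ × v′ ≤ v

    block-closed : ∀ {p v e} → Token p v → p ≤ e → e ≤ L v p → L v e ≤ L v p × Closed L v e
    block-closed t p≤e e≤l = le , ≤-<-trans le (<-≤-trans (Token.closed t) (+-monoˡ-≤ N p≤e))
      where le = nested (Token.closed t) p≤e e≤l

    -- Suppose the owner is not inside. If its level is at most `v`, its position already lies in
    -- the level-`v` block of `p`, against `first`; if its level is higher, both tokens have the
    -- same end, against `token-level`.
    owner-inside : ∀ {p v e p₀ v₀} → Token p v → p ≤ e → e ≤ L v p → Owns p₀ v₀ e → Inside p v p₀ v₀
    owner-inside {p} {v} {e} {p₀} {v₀} t p≤e e≤l o@(t₀ , eq₀) with <-cmp p p₀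
    ... | tri< p<p₀ _ _ = inj₁ p<p₀
    ... | tri≈ _ p≡p₀ _ = inj₂ (p≡p₀ , ≮⇒≥ (level-≤ (≤-reflexive (sym p≡p₀))))
      where
      level-≤ : p₀ ≤ p → ¬ v < v₀
      level-≤ p₀≤p v<v₀ = <⇒≢ v<v₀ (token-level t t₀ (≤-antisym
        (≤-trans (monotone p (<⇒≤ v<v₀)) (nested (Token.closed t₀) p₀≤p (≤-trans p≤e (owns-≤ o))))
        (≤-trans (≤-reflexive (sym eq₀)) (≤-trans (monotone e z≤n) (proj₁ (block-closed t p≤e e≤l))))))
    ... | tri> _ _ p₀<p with v₀ ≤? v
    ...   | no v₀≰v = ⊥-elim (<⇒≢ (≰⇒> v₀≰v) (token-level t t₀ (≤-antisym
        (≤-trans (monotone p (<⇒≤ (≰⇒> v₀≰v))) (nested (Token.closed t₀) (<⇒≤ p₀<p) (≤-trans p≤e (owns-≤ o))))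
        (≤-trans (≤-reflexive (sym eq₀)) (≤-trans (monotone e z≤n) (proj₁ (block-closed t p≤e e≤l)))))))
    ...   | yes v₀≤v = ⊥-elim (first-+N t p₀<p (≤-antisym Lp₀≤l l≤Lp₀))
      where
      l₀≤l : L v₀ p₀ ≤ L v p
      l₀≤l = ≤-trans (≤-reflexive (sym eq₀)) (≤-trans (monotone e z≤n) (proj₁ (block-closed t p≤e e≤l)))
      p≤l₀ : p ≤ L v₀ p₀
      p≤l₀ = ≤-trans p≤e (owns-≤ o)
      cp₀ : Closed L v p₀
      cp₀ = reflects v₀≤v (Token.closed t₀) (proj₂ (block-closed t p≤l₀ l₀≤l))
      Lp₀≤l : L v p₀ ≤ L v p
      Lp₀≤l = ≤-trans (≤-reflexive (sym (coarser v₀≤v cp₀))) (proj₁ (block-closed t p≤l₀ l₀≤l))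
      l≤Lp₀ : L v p ≤ L v p₀
      l≤Lp₀ = nested cp₀ (<⇒≤ p₀<p) (≤-trans p≤l₀ (monotone p₀ v₀≤v))

    -- A token opened inside also ends inside. With a higher level and an end beyond `L v p`, its
    -- block would contain `p` as well, which precedes its first element.
    inside-≤ : ∀ {p v e p₀ v₀} → Token p v → Owns p₀ v₀ e → Inside p v p₀ v₀ → p₀ ≤ L v p → e ≤ L v p
    inside-≤ {p} {v} {e} {p₀} {v₀} t o@(t₀ , _) ins p₀≤l = ≤-trans (owns-≤ o) (end≤ ins)
      where
      end≤-low : v₀ ≤ v → p ≤ p₀ → L v₀ p₀ ≤ L v p
      end≤-low v₀≤v p≤p₀ = ≤-trans (monotone p₀ v₀≤v) (nested (Token.closed t) p≤p₀ p₀≤l)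
      end≤-high : v < v₀ → p < p₀ → L v₀ p₀ ≤ L v p
      end≤-high v<v₀ p<p₀ = ≮⇒≥ λ l<l₀ →
        let Ll≤l₀ = nested (Token.closed t₀) p₀≤l (<⇒≤ l<l₀)
            cl = ≤-<-trans Ll≤l₀ (<-≤-trans (Token.closed t₀) (+-monoˡ-≤ N p₀≤l))
            cp = reflects (<⇒≤ v<v₀) (Token.closed t) cl
            Lp = coarser (<⇒≤ v<v₀) cp
            Lp≤l₀ = ≤-trans (≤-reflexive (sym Lp)) Ll≤l₀
            l₀≤Lp = nested cp (<⇒≤ p<p₀) (≤-trans p₀≤l (≤-trans (extensive v₀ (L v p)) (≤-reflexive Lp)))
        in first-+N t₀ p<p₀ (≤-antisym Lp≤l₀ l₀≤Lp)
      end≤ : Inside p v p₀ v₀ → L v₀ p₀ ≤ L v p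
      end≤ (inj₂ (refl , v₀≤v)) = end≤-low v₀≤v ≤-refl
      end≤ (inj₁ p<p₀) with v₀ ≤? v
      ... | yes v₀≤v = end≤-low v₀≤v (<⇒≤ p<p₀)
      ... | no v₀≰v  = end≤-high (≰⇒> v₀≰v) p<p₀

-- The two constructions are mutually inverse

module RoundTrips (N ℓ : ℕ) (N>0 : 0 < N) where
  open Correspondence N ℓ N>0
  open Encoding N ℓ N>0

  module Weights {L : ℕ → ℕ → ℕ} (chain : LastChain L) where
    open LastChain chain
    open EncodingOf chain
    open Decode enc using (opened; span; span-≤; span-satisfies)

    -- Counts the brackets contributing to `opened p v d` that own `e`; by `load≤1` there is at most
    -- one.
    load : ℕ → ℕ → ℕ → ℕ → ℕ
    load p v d e = ∑ (suc v) (λ w → 𝟙 (owns? p w e)) + ∑ d (λ i → ∑ ℓ (λ w → 𝟙 (owns? (p + suc i) w e)))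

    enc-window : ∀ {p q d} w → p ≤ q → q ≤ p + d → enc q w ≡ ∑ (d + N) (λ x → 𝟙 (owns? q w (p + x)))
    enc-window {p} {q} {d} w p≤q q≤ = ∑-window (λ e → 𝟙 (owns? q w e)) p≤q
      (≤-trans (+-monoˡ-≤ N q≤) (≤-reflexive (+-assoc p d N)))
      λ e pos → owns-window (𝟙>0 (owns? q w e) pos)

    -- Labels are block sizes, so their total can be counted element by element. The window has
    -- length `d + N` because brackets open at `p + d` at the latest and own elements less than `N`
    -- ahead.
    opened≡loads : ∀ p v d → opened p v d ≡ ∑ (d + N) (λ x → load p v d (p + x))
    opened≡loads p v d = begin
      ∑ (suc v) (enc p) + ∑ d (λ i → ∑ ℓ (enc (p + suc i)))
        ≡⟨ cong₂ _+_
             (trans (∑-cong (suc v) λ w _ → enc-window w ≤-refl (m≤m+n p d)) (∑-swap (suc v) (d + N) λ w x → 𝟙 (owns? p w (p + x))))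
             (trans (∑-cong d λ i i<d → trans
                       (∑-cong ℓ λ w _ → enc-window w (m≤m+n p (suc i)) (+-monoʳ-≤ p i<d))
                       (∑-swap ℓ (d + N) λ w x → 𝟙 (owns? (p + suc i) w (p + x))))
                    (∑-swap d (d + N) λ i x → ∑ ℓ (λ w → 𝟙 (owns? (p + suc i) w (p + x))))) ⟩
      ∑ (d + N) (λ x → ∑ (suc v) (λ w → 𝟙 (owns? p w (p + x)))) +
      ∑ (d + N) (λ x → ∑ d (λ i → ∑ ℓ (λ w → 𝟙 (owns? (p + suc i) w (p + x)))))
        ≡⟨ ∑-+ (d + N) _ _ ⟨
      ∑ (d + N) (λ x → load p v d (p + x)) ∎
      where open ≡-Reasoning

    loaded : ∀ {p v d e p₀ v₀} → Owns p₀ v₀ e → Inside p v p₀ v₀ → p₀ ≤ p + d → 1 ≤ load p v d e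
    loaded {p} {v} {d} {e} {v₀ = v₀} o (inj₂ (refl , v₀≤v)) _ =
      ≤-trans (≤-reflexive (sym (𝟙-yes (owns? p v₀ e) o)))
        (≤-trans (term≤∑ (suc v) (λ w → 𝟙 (owns? p w e)) (s≤s v₀≤v)) (m≤m+n _ _))
    loaded {p} {v} {d} {e} {p₀} {v₀} o (inj₁ p<p₀) p₀≤ =
      let i , eq = m≤n⇒∃[o]m+o≡n p<p₀
          eq′ = trans (+-suc p i) eq
      in ≤-trans (≤-reflexive (sym (𝟙-yes (owns? (p + suc i) v₀ e) (subst (λ q → Owns q v₀ e) (sym eq′) o))))
        (≤-trans (term≤∑ ℓ (λ w → 𝟙 (owns? (p + suc i) w e)) (closed⇒level (Token.closed (proj₁ o))))
        (≤-trans (term≤∑ d (λ i → ∑ ℓ (λ w → 𝟙 (owns? (p + suc i) w e)))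
                   (+-cancelˡ-≤ p _ _ (≤-trans (≤-reflexive eq′) p₀≤))) (m≤n+m _ _)))

    load⇒owner : ∀ {p v d e} → 0 < load p v d e →
                 ∃₂ λ p₀ v₀ → Owns p₀ v₀ e × Inside p v p₀ v₀ × p₀ ≤ p + d
    load⇒owner {p} {v} {d} {e} pos with ∑ (suc v) (λ w → 𝟙 (owns? p w e)) in eq
    ... | suc _ = let w , w≤v , o = ∑>0⇒∃ (suc v) (λ w → 𝟙 (owns? p w e)) (subst (0 <_) (sym eq) z<s) in
                  p , w , 𝟙>0 (owns? p w e) o , inj₂ (refl , s≤s⁻¹ w≤v) , m≤m+n p d
    ... | zero  = let i , i<d , pos′ = ∑>0⇒∃ d (λ i → ∑ ℓ (λ w → 𝟙 (owns? (p + suc i) w e))) pos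
                      w , _ , o = ∑>0⇒∃ ℓ (λ w → 𝟙 (owns? (p + suc i) w e)) pos′ in
                  p + suc i , w , 𝟙>0 (owns? (p + suc i) w e) o , inj₁ (m<m+n p z<s) , +-monoʳ-≤ p i<d

    load≤1 : ∀ p v d e → load p v d e ≤ 1
    load≤1 p v d e = +-≤1
      (levels≤1 (suc v) p)
      (∑-≤1 d _ (λ i _ → levels≤1 ℓ (p + suc i)) λ i j _ _ pos pos′ →
        let _ , _ , o = positive ℓ (p + suc i) pos
            _ , _ , o′ = positive ℓ (p + suc j) pos′
        in suc-injective (+-cancelˡ-≡ p _ _ (same o o′)))
      λ pos pos′ →
        let _ , _ , o = positive (suc v) p pos
            i , _ , pos″ = ∑>0⇒∃ d (λ i → ∑ ℓ (λ w → 𝟙 (owns? (p + suc i) w e))) pos′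
            _ , _ , o′ = positive ℓ (p + suc i) pos″
        in <⇒≢ (m<m+n p z<s) (same o o′)
      where
      levels≤1 : ∀ n q → ∑ n (λ w → 𝟙 (owns? q w e)) ≤ 1
      levels≤1 n q = ∑-≤1 n _ (λ w _ → 𝟙≤1 (owns? q w e))
        λ w w′ _ _ o o′ → owns-level (𝟙>0 (owns? q w e) o) (𝟙>0 (owns? q w′ e) o′)
      positive : ∀ n q → 0 < ∑ n (λ w → 𝟙 (owns? q w e)) → ∃ λ w → w < n × Owns q w e
      positive n q pos = let w , w<n , o = ∑>0⇒∃ n (λ w → 𝟙 (owns? q w e)) pos in w , w<n , 𝟙>0 (owns? q w e) o
      same : ∀ {q q′ w w′} → Owns q w e → Owns q′ w′ e → q ≡ q′
      same {q′ = q′} o o′ = owns-position o (subst (λ w → Owns q′ w e) (sym (owns-level o o′)) o′)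

    split-at : ∀ d (f : ℕ → ℕ) → ∑ (d + N) f ≡ ∑ (suc d) f + ∑ (N ∸ 1) (λ x → f (suc d + x))
    split-at d f = trans (cong (λ n → ∑ n f) (trans (cong (d +_) (sym (m+[n∸m]≡n N>0))) (+-suc d (N ∸ 1))))
      (∑-split (suc d) (N ∸ 1) f)

    module _ {p v} (N≤p : N ≤ p) (t : Token p v) where

      gap : ℕ
      gap = L v p ∸ p

      p+gap : p + gap ≡ L v p
      p+gap = m+[n∸m]≡n (extensive v p)

      gap<N : gap < N
      gap<N = +-cancelˡ-< p _ _ (≤-<-trans (≤-reflexive p+gap) (Token.closed t))

      covered : ∀ {d x} → x ≤ d → d ≤ gap → 1 ≤ load p v d (p + x)
      covered {d} {x} x≤d d≤gap =
        let p≤e = m≤m+n p x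
            e≤l = ≤-trans (+-monoʳ-≤ p (≤-trans x≤d d≤gap)) (≤-reflexive p+gap)
            p₀ , v₀ , o = owner (≤-trans N≤p p≤e) (closed-↓ z≤n (proj₂ (block-closed t p≤e e≤l)))
        in loaded o (owner-inside t p≤e e≤l o) (≤-trans (owns-≥ o) (+-monoʳ-≤ p x≤d))

      -- Each position from `p` to the end is owned by exactly one of the brackets opened so far,
      -- and no position beyond the end is.
      opened-end : opened p v gap ≡ suc gap
      opened-end = trans (opened≡loads p v gap) (trans (split-at gap _) (trans
        (cong₂ _+_
          (∑-one (suc gap) λ x x≤ → ≤-antisym (load≤1 p v gap (p + x)) (covered (s≤s⁻¹ x≤) ≤-refl))
          (∑-zero (N ∸ 1) λ x _ → vanish x))
        (+-identityʳ _)))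
        where
        vanish : ∀ x → load p v gap (p + (suc gap + x)) ≡ 0
        vanish x = n<1⇒n≡0 (≰⇒> λ pos →
          let _ , _ , o , ins , p₀≤ = load⇒owner pos
          in lia 4 (λ p g x l → p :+ g :≡ l ⇒ p :+ (con 1 :+ g :+ x) :≤ l ⇒ ⊢ :⊥) p gap x (L v p) p+gap
               (inside-≤ t o ins (≤-trans p₀≤ (≤-reflexive p+gap))))

      -- Besides the `suc d` positions passed, the end `L v p` is already owned, namely by the token
      -- at `p` itself, so the bracket cannot close yet.
      opened-early : ∀ {d} → d < gap → suc d < opened p v d
      opened-early {d} d<gap = let r , eq = m≤n⇒∃[o]m+o≡n d<gap in begin
        suc (suc d)                                                           ≡⟨ +-comm 1 (suc d) ⟩
        suc d + 1                                                             ≡⟨ cong (_+ 1) (∑-one (suc d) (λ _ _ → refl)) ⟨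
        ∑ (suc d) (λ _ → 1) + 1
          ≤⟨ +-mono-≤ (∑-mono (suc d) λ x x≤ → covered (s≤s⁻¹ x≤) (<⇒≤ d<gap))
               (≤-trans (end-loaded (trans (cong (p +_) eq) p+gap))
                        (term≤∑ (N ∸ 1) (λ x → load p v d (p + (suc d + x))) {r} (r< r eq))) ⟩
        ∑ (suc d) (λ x → load p v d (p + x)) + ∑ (N ∸ 1) (λ x → load p v d (p + (suc d + x)))
          ≡⟨ split-at d (λ x → load p v d (p + x)) ⟨
        ∑ (d + N) (λ x → load p v d (p + x))                                  ≡⟨ opened≡loads p v d ⟨
        opened p v d                                                          ∎
        where
        open ≤-Reasoning
        end-loaded : ∀ {e} → e ≡ L v p → 1 ≤ load p v d e
        end-loaded refl = loaded (owns-end t) (inj₂ (refl , ≤-refl)) (m≤m+n p d)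
        r< : ∀ r → suc d + r ≡ gap → r < N ∸ 1
        r< r eq = lia 5 (λ d r g N M → con 1 :+ d :+ r :≡ g ⇒ g :< N ⇒ con 1 :+ M :≡ N ⇒ ⊢ r :< M) d r gap N (N ∸ 1) eq gap<N (m+[n∸m]≡n N>0)

      span-token : span p v ≡ gap
      span-token = ≤-antisym (span-≤ p v (≤-reflexive opened-end))
        (≮⇒≥ λ short → <⇒≱ (opened-early short) (span-satisfies p v (<-trans short gap<N)))

  module DecodeEncode {L : ℕ → ℕ → ℕ} (chain : LastChain L)
                      (light : ∑ N (λ p → ∑ ℓ (Encode.enc L p)) ≤ N) where
    open LastChain chain
    open EncodingOf chain
    open Weights chain

    enc-code : Code enc
    enc-code = record { periodic = enc-periodic ; top = enc-top ; light = light }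

    open Decoding enc-code

    close-token : ∀ {p v} → Token p v → close p v ≡ L v p
    close-token {p} {v} t = +-cancelʳ-≡ N _ _ (begin
      close p v + N              ≡⟨ close-+N p v ⟨
      p + N + span (p + N) v   ≡⟨ cong (p + N +_) (span-token N≤ t′) ⟩
      p + N + gap N≤ t′          ≡⟨ p+gap N≤ t′ ⟩
      L v (p + N)                ≡⟨ periodic v p ⟩
      L v p + N                  ∎)
      where
      open ≡-Reasoning
      N≤ : N ≤ p + N
      N≤ = m≤n+m N p
      t′ : Token (p + N) v
      t′ = token-+N t

    -- The token of the `j`-block of `e` is a bracket around `e`, which bounds `dec`. Conversely the
    -- bracket found by `dec` is a token of level at least `j` around `e`, whose end bounds `L j e`.
    dec-enc : ∀ j e → dec j e ≡ L j e
    dec-enc j e = ≤-antisym dec≤ ≤dec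
      where
      dec≤ : dec j e ≤ L j e
      dec≤ with m≤n⇒m<n∨m≡n (bounded j e)
      ... | inj₂ eq = ≤-trans (dec-bounded j e) (≤-reflexive (sym eq))
      ... | inj₁ c  =
        let p , v , j≤v , p≤e , t , eq = block-token (m≤n+m N e) (closed-+N c)
        in dec-≤ (L j e) j≤v (token⇒present t) p≤e (extensive j e)
             (trans (close-token t) (trans eq (periodic j e)))
      ≤dec : L j e ≤ dec j e
      ≤dec with m≤n⇒m<n∨m≡n (dec-bounded j e)
      ... | inj₂ eq = ≤-trans (bounded j e) (≤-reflexive (sym eq))
      ... | inj₁ c  =
        let covers {p} {v} j≤v pr p≤e eq = dec-covers c
            t = present⇒token pr
            eq′ = trans (sym (close-token t)) eq
        in +-cancelʳ-≤ N _ _ (begin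
             L j e + N      ≡⟨ periodic j e ⟨
             L j (e + N)    ≤⟨ monotone (e + N) j≤v ⟩
             L v (e + N)    ≤⟨ nested (Token.closed t) p≤e (≤-trans (+-monoˡ-≤ N (m≤m+n e _)) (≤-reflexive (sym eq′))) ⟩
             L v p          ≡⟨ eq′ ⟩
             dec j e + N    ∎)
        where open ≤-Reasoning

  module EncodeDecode {a : ℕ → ℕ → ℕ} (code : Code a) where
    open Code code using (periodic)
    open Decoding code
    open EncodingOf lastChain
    open Weights lastChain
    open LastChain lastChain using () renaming (monotone to dec-mono; periodic to dec-per)

    -- The bracket covers its own opening position, and any other bracket of level at least `v`
    -- covering it is outside and closes later, by `nesting`.
    bracket-end : ∀ {p v} → 0 < a p v → dec v p ≡ close p v
    bracket-end {p} {v} pr = ≤-antisym upper (≮⇒≥ strict)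
      where
      upper : dec v p ≤ close p v
      upper = dec-≤ (close p v) ≤-refl (present-+N pr) ≤-refl (m≤m+n p _) (close-+N p v)
      strict : ¬ dec v p < close p v
      strict lt =
        let covers {p′} {v′} v≤v′ pr′ p′≤ eq = dec-covers {v} {p} (≤-<-trans upper (+-monoʳ-< p (span<N pr)))
        in outcome v≤v′ pr′ p′≤ eq
        where
        outcome : ∀ {p′ v′} → v ≤ v′ → 0 < a p′ v′ → p′ ≤ p + N → close p′ v′ ≡ dec v p + N → ⊥
        outcome {p′} {v′} v≤v′ pr′ p′≤ eq = <⇒≱ lt (+-cancelʳ-≤ N _ _ (begin
          close p v + N      ≡⟨ close-+N p v ⟨
          close (p + N) v    ≤⟨ before (m≤n⇒m<n∨m≡n p′≤) (m≤n⇒m<n∨m≡n v≤v′) ⟩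
          close p′ v′        ≡⟨ eq ⟩
          dec v p + N        ∎))
          where
          open ≤-Reasoning
          reach : p + N ≤ close p′ v′
          reach = ≤-trans (+-monoˡ-≤ N (m≤m+n p _)) (≤-reflexive (sym eq))
          before : p′ < p + N ⊎ p′ ≡ p + N → v < v′ ⊎ v ≡ v′ → close (p + N) v ≤ close p′ v′
          before (inj₁ p′<) _                 = <⇒≤ (nesting pr′ (present-+N pr) (inj₁ p′<) reach)
          before (inj₂ p′≡) (inj₁ v<v′)       = <⇒≤ (nesting pr′ (present-+N pr) (inj₂ (p′≡ , v<v′)) reach)
          before (inj₂ refl) (inj₂ refl)      = ≤-refl

    present⇒closed : ∀ {p v} → 0 < a p v → Closed dec v p
    present⇒closed {p} {v} pr = ≤-<-trans (≤-reflexive (bracket-end pr)) (+-monoʳ-< p (span<N pr))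

    -- A failure of `jump`, or of `first` at an element with a closed block, would yield a second
    -- bracket closing at the same place up to periods, which the strictness of `nesting` excludes.
    code⇒token : ∀ {p v} → 0 < a p v → Token p v
    code⇒token {p} {v} pr = token c jump first
      where
      c : Closed dec v p
      c = present⇒closed pr
      jump : dec (suc v) p ≢ dec v p
      jump eq = let covers v<v′ pr′ p′≤ eq′ = dec-covers {suc v} {p} (≤-<-trans (≤-reflexive eq) c)
                in outcome v<v′ pr′ (m≤n⇒m<n∨m≡n p′≤) (trans eq′ (cong (_+ N) (trans eq (bracket-end pr))))
        where
        outcome : ∀ {p′ v′} → v < v′ → 0 < a p′ v′ → p′ < p + N ⊎ p′ ≡ p + N → close p′ v′ ≡ close p v + N → ⊥
        outcome {p′} {v′} v<v′ pr′ p′≤ eq′ = <⇒≢ (nesting pr′ (present-+N pr) (outside p′≤)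
            (≤-trans (+-monoˡ-≤ N (m≤m+n p _)) (≤-reflexive (sym eq′)))) (trans (close-+N p v) (sym eq′))
          where
          outside : p′ < p + N ⊎ p′ ≡ p + N → Outside p′ v′ (p + N) v
          outside (inj₁ p′<) = inj₁ p′<
          outside (inj₂ p′≡) = inj₂ (p′≡ , v<v′)
      first : First p v
      first e e< eq with m≤n⇒m<n∨m≡n (dec-bounded v e)
      ... | inj₂ eq′ = <⇒≱ end-open (dec-nested c (m≤m+n p _) ≤-refl)
        where
        e≡ : e ≡ dec v p
        e≡ = +-cancelʳ-≡ N _ _ (trans (sym eq′) eq)
        end-open : dec v p < dec v (dec v p)
        end-open = ≤-trans (m<m+n (dec v p) N>0) (≤-reflexive (trans (sym eq) (cong (dec v) e≡)))
      ... | inj₁ c′ = let covers v≤v′ pr′ p′≤ eq′ = dec-covers {v} {e} c′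
                      in outcome pr′ p′≤ (trans eq′ (cong (_+ N) (trans eq (cong (_+ N) (bracket-end pr)))))
        where
        outcome : ∀ {p′ v′} → 0 < a p′ v′ → p′ ≤ e + N → close p′ v′ ≡ close p v + N + N → ⊥
        outcome {p′} {v′} pr′ p′≤ eq′ = <⇒≢ (nesting pr′ (present-+N (present-+N pr)) (inj₁ (≤-<-trans p′≤ (+-monoˡ-< N e<)))
            (≤-trans (+-monoˡ-≤ N (+-monoˡ-≤ N (m≤m+n p _))) (≤-reflexive (sym eq′))))
          (trans (close-+N (p + N) v) (trans (cong (_+ N) (close-+N p v)) (sym eq′)))

    -- The bracket that `dec` finds around `p` must be the one at `p` and `v`, up to a period:
    -- `jump` excludes a higher level and `first` an earlier position.
    token⇒code : ∀ {p v} → Token p v → 0 < a p v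
    token⇒code {p} {v} (token c jump first) =
      let covers v≤v′ pr′ p′≤ eq = dec-covers c in outcome v≤v′ pr′ p′≤ eq
      where
      outcome : ∀ {p′ v′} → v ≤ v′ → 0 < a p′ v′ → p′ ≤ p + N → close p′ v′ ≡ dec v p + N → 0 < a p v
      outcome {p′} {v′} v≤v′ pr′ p′≤ eq with m≤n⇒m<n∨m≡n v≤v′
      ... | inj₁ v<v′ = contradiction
        (≤-antisym (dec-≤ (dec v p) v<v′ pr′ p′≤ (m≤m+n p _) eq) (dec-mono p (n≤1+n v))) jump
      ... | inj₂ refl with m≤n⇒m<n∨m≡n p′≤
      ...   | inj₁ p′< = contradiction (trans (bracket-end pr′) eq) (first p′ p′<)
      ...   | inj₂ refl = present-−N pr′

    absent : ∀ {p v} → ¬ 0 < a p v → a p v ≡ enc p v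
    absent {p} {v} no-code = trans (n<1⇒n≡0 (≰⇒> no-code))
      (sym (n<1⇒n≡0 (≰⇒> λ pos → no-code (token⇒code (present⇒token pos)))))

    -- The brackets inside (p , v) are shorter, and the total weight opened
    -- inside (p , v) is its number of positions for both codes.
    same-weight : ∀ c {p v} → N ≤ p → 0 < a p v → span p v ≡ c → a p v ≡ enc p v
    same-weight = <-rec _ λ c rec {p} {v} N≤p pr len →
      let t = code⇒token pr
          inner : ∀ {q w} → Outside p v q w → q ≤ close p v → a q w ≡ enc q w
          inner {q} {w} out q≤ = inner-cell rec N≤p pr len out q≤
          gap≡ : gap N≤p t ≡ span p v
          gap≡ = +-cancelˡ-≡ p _ _ (trans (p+gap N≤p t) (bracket-end pr))
          rest = ∑ (span p v) (λ i → ∑ ℓ (a (p + suc i)))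
          rest≡ : rest ≡ ∑ (span p v) (λ i → ∑ ℓ (enc (p + suc i)))
          rest≡ = ∑-cong (span p v) λ i i< → ∑-cong ℓ λ w _ → inner (inj₁ (m<m+n p z<s)) (+-monoʳ-≤ p i<)
          below≡ : ∑ v (a p) ≡ ∑ v (enc p)
          below≡ = ∑-cong v λ w w<v → inner (inj₂ (refl , w<v)) (m≤m+n p _)
          full : Decode.opened enc p v (span p v) ≡ suc (span p v)
          full = subst (λ d → Decode.opened enc p v d ≡ suc d) gap≡ (opened-end N≤p t)
      in cancel (∑ v (a p)) (∑ v (enc p)) rest (∑ (span p v) (λ i → ∑ ℓ (enc (p + suc i)))) below≡ rest≡
           (trans (cong (_+ rest) (sym (∑-last v (a p)))) (trans (exact pr)
             (trans (sym full) (cong (_+ ∑ (span p v) (λ i → ∑ ℓ (enc (p + suc i)))) (∑-last v (enc p))))))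
      where
      inner-cell : ∀ {c p v q w} → (∀ {c′} → c′ < c → ∀ {p v} → N ≤ p → 0 < a p v → span p v ≡ c′ → a p v ≡ enc p v) →
                   N ≤ p → 0 < a p v → span p v ≡ c → Outside p v q w → q ≤ close p v → a q w ≡ enc q w
      inner-cell {c} {p} {v} {q} {w} rec N≤p pr len out q≤ with 0 <? a q w
      ... | no ¬pr = absent ¬pr
      ... | yes pr′ = rec (subst (span q w <_) len (shorter (nesting pr pr′ out q≤) (p≤q out)))
                          (≤-trans N≤p (p≤q out)) pr′ refl
        where
        p≤q : Outside p v q w → p ≤ q
        p≤q (inj₁ p<q)        = <⇒≤ p<q
        p≤q (inj₂ (refl , _)) = ≤-refl
        shorter : close q w < close p v → p ≤ q → span q w < span p v
        shorter lt le = lia 4 (λ q m p l → q :+ m :< p :+ l ⇒ p :≤ q ⇒ ⊢ m :< l) q (span q w) p (span p v) lt le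
      -- One position before the close the total still exceeded the positions passed, so it had
      -- already reached the number of positions at the close.
      exact : ∀ {p v} → 0 < a p v → opened p v (span p v) ≡ suc (span p v)
      exact {p} {v} pr = ≤-antisym (opened-length pr) (lower (span p v) refl)
        where
        lower : ∀ d → d ≡ span p v → suc d ≤ opened p v d
        lower zero    _  = ≤-trans pr (present≤opened p v 0)
        lower (suc d) eq = ≤-trans (opened-before (≤-reflexive eq)) (opened-mono p v (n≤1+n d))
      cancel : ∀ A B R S {x y} → A ≡ B → R ≡ S → A + x + R ≡ B + y + S → x ≡ y
      cancel A B R S {x} {y} = lia 6 (λ A B R S x y → A :≡ B ⇒ R :≡ S ⇒ A :+ x :+ R :≡ B :+ y :+ S ⇒ ⊢ x :≡ y) A B R S x y

    enc-dec : ∀ p v → enc p v ≡ a p v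
    enc-dec p v = trans (sym (enc-periodic p v)) (trans shifted (periodic p v))
      where
      shifted : enc (p + N) v ≡ a (p + N) v
      shifted with 0 <? a (p + N) v
      ... | yes pr = sym (same-weight _ (m≤n+m N p) pr refl)
      ... | no ¬pr = sym (absent ¬pr)

-- Noncrossing relations on the universal cover

module Periodic (N : ℕ) (N>0 : 0 < N) where

  -- The lift to ℕ of a noncrossing equivalence relation on ℤ/2N that is invariant under x ↦ x + N.
  record NonCrossingRelation (R : ℕ → ℕ → Set) : Set where
    field
      _~?_     : ∀ e f → Dec (R e f)
      ~-refl   : ∀ {e} → R e e
      ~-sym    : ∀ {e f} → R e f → R f e
      ~-trans  : ∀ {e f g} → R e f → R f g → R e g
      wrap     : ∀ {e} → R e (e + N + N)
      shift    : ∀ {e f} → R e f → R (e + N) (f + N)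
      noncross : ∀ {a b c d} → a < b → b < c → c < d → d < a + N + N → R a c → R b d → R a b

    unshift : ∀ {e f} → R (e + N) (f + N) → R e f
    unshift r = ~-trans wrap (~-trans (shift r) (~-sym wrap))

  module _ {R : ℕ → ℕ → Set} (R? : ∀ e f → Dec (R e f)) where

    abstract

      -- Looking `N` positions ahead is enough, since a block that is not invariant stays within
      -- half a turn (`no-return`).
      lastOf : ℕ → ℕ
      lastOf e = if′ (R? e (e + N))
        where
        if′ : Dec (R e (e + N)) → ℕ
        if′ (yes _) = e + N
        if′ (no _)  = e + greatest (λ i → R? e (e + i)) N

      lastOf-zero : ∀ {e} → R e (e + N) → lastOf e ≡ e + N
      lastOf-zero {e} z with R? e (e + N)
      ... | yes _ = refl
      ... | no ¬z = contradiction z ¬z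

      lastOf< : ∀ {e} → ¬ R e (e + N) → lastOf e < e + N
      lastOf< {e} ¬z with R? e (e + N)
      ... | yes z = contradiction z ¬z
      ... | no _  = +-monoʳ-< e (greatest< (λ i → R? e (e + i)) N N>0)

      lastOf-≥ : ∀ {e} → e ≤ lastOf e
      lastOf-≥ {e} with R? e (e + N)
      ... | yes _ = m≤m+n e N
      ... | no _  = m≤m+n e _

      lastOf-related : ∀ {e} → R e e → R e (lastOf e)
      lastOf-related {e} r with R? e (e + N)
      ... | yes z = z
      ... | no _  = greatest-satisfies (λ i → R? e (e + i)) N N>0 (subst (R e) (sym (+-identityʳ e)) r)

      lastOf-max : ∀ {e x} → ¬ R e (e + N) → e ≤ x → x < e + N → R e x → x ≤ lastOf e
      lastOf-max {e} {x} ¬z e≤x x< r with R? e (e + N)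
      ... | yes z = contradiction z ¬z
      ... | no _  = ≤-trans (≤-reflexive (sym x≡)) (+-monoʳ-≤ e (≤-greatest (λ i → R? e (e + i)) N
                      (+-cancelˡ-< e _ _ (≤-<-trans (≤-reflexive x≡) x<)) (subst (R e) (sym x≡) r)))
        where
        x≡ : e + (x ∸ e) ≡ x
        x≡ = m+[n∸m]≡n e≤x

    lastOf≤ : ∀ {e} → lastOf e ≤ e + N
    lastOf≤ {e} with R? e (e + N)
    ... | yes z = ≤-reflexive (lastOf-zero z)
    ... | no ¬z = <⇒≤ (lastOf< ¬z)

    nonzero : ∀ {e} → lastOf e < e + N → ¬ R e (e + N)
    nonzero c z = <⇒≢ c (lastOf-zero z)

    lastOf-unique : ∀ {e l} → R e e → ¬ R e (e + N) → e ≤ l → l < e + N → R e l →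
                    (∀ {x} → l < x → x < e + N → ¬ R e x) → lastOf e ≡ l
    lastOf-unique rfl ¬z e≤l l< r max = ≤-antisym
      (≮⇒≥ λ l<L → max l<L (lastOf< ¬z) (lastOf-related rfl)) (lastOf-max ¬z e≤l l< r)

  module RelationLast {R : ℕ → ℕ → Set} (rel : NonCrossingRelation R) where
    open NonCrossingRelation rel

    last : ℕ → ℕ
    last = lastOf _~?_

    zero-transport : ∀ {e f} → R e f → R e (e + N) → R f (f + N)
    zero-transport r z = ~-trans (~-sym r) (~-trans z (shift r))

    last-related : ∀ e → R e (last e)
    last-related e = lastOf-related _~?_ ~-refl

    closed⇒nonzero : ∀ {e} → last e < e + N → ¬ R e (e + N)
    closed⇒nonzero = nonzero _~?_

    -- If the block of `e` met `y + N` with `e < y < l`, then by rotation `y` would be related to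
    -- `e + N`, and this chord would cross the one from `e` to `l`.
    no-return : ∀ {e l x} → ¬ R e (e + N) → e ≤ l → l < e + N → R e l → x < l + N → R e x → x < e + N
    no-return {e} {l} {x} ¬z e≤l l< r x< rx = ≰⇒> λ e+N≤x →
      let y = x ∸ N
          y+N≡x = m∸n+n≡m (≤-trans (m≤n+m N e) e+N≤x)
          e≤y = +-cancelʳ-≤ N _ _ (≤-trans e+N≤x (≤-reflexive (sym y+N≡x)))
          y<l = +-cancelʳ-< N _ _ (≤-<-trans (≤-reflexive y+N≡x) x<)
      in crossing y<l (subst (R e) (sym y+N≡x) rx) (m≤n⇒m<n∨m≡n e≤y)
      where
      crossing : ∀ {y} → y < l → R e (y + N) → e < y ⊎ e ≡ y → ⊥
      crossing y<l ry (inj₂ refl) = ¬z ry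
      crossing {y} y<l ry (inj₁ e<y) = ¬z (~-trans (noncross e<y y<l l< (m<m+n (e + N) N>0) r y~e+N) y~e+N)
        where
        y~e+N : R y (e + N)
        y~e+N = unshift (~-sym (~-trans (~-sym wrap) ry))

    same-last : ∀ {e f} → ¬ R e (e + N) → e ≤ f → f < e + N → R e f → last f ≡ last e
    same-last {e} {f} ¬z e≤f f< r = ≤-antisym
      (lastOf-max _~?_ ¬z (≤-trans e≤f (lastOf-≥ _~?_))
        (no-return ¬z e≤f f< r (lastOf< _~?_ ¬zf) e~lf) e~lf)
      (lastOf-max _~?_ ¬zf (lastOf-max _~?_ ¬z e≤f f< r)
        (<-≤-trans (lastOf< _~?_ ¬z) (+-monoˡ-≤ N e≤f)) (~-trans (~-sym r) (last-related e)))
      where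
      ¬zf : ¬ R f (f + N)
      ¬zf z = ¬z (zero-transport (~-sym r) z)
      e~lf : R e (last f)
      e~lf = ~-trans r (last-related f)

    last-nested : ∀ {e f} → last e < e + N → e ≤ f → f ≤ last e → last f ≤ last e
    last-nested {e} {f} c e≤f f≤l = go (m≤n⇒m<n∨m≡n e≤f) (m≤n⇒m<n∨m≡n f≤l)
      where
      l : ℕ
      l = last e
      ¬z : ¬ R e (e + N)
      ¬z = closed⇒nonzero c
      go : e < f ⊎ e ≡ f → f < l ⊎ f ≡ l → last f ≤ l
      go (inj₂ refl) _ = ≤-refl
      go _ (inj₂ f≡l) = ≤-reflexive (same-last ¬z e≤f (≤-<-trans f≤l c) (subst (R e) (sym f≡l) (last-related e)))
      go (inj₁ e<f) (inj₁ f<l) = ≮⇒≥ λ l<lf → <⇒≢ l<lf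
        (sym (same-last ¬z e≤f (≤-<-trans f≤l c)
          (noncross e<f f<l l<lf (<-≤-trans (lastOf< _~?_ ¬zf) f+N≤) (last-related e) (last-related f))))
        where
        l<f+N : l < f + N
        l<f+N = <-≤-trans c (+-monoˡ-≤ N e≤f)
        f+N≤ : f + N ≤ e + N + N
        f+N≤ = +-monoˡ-≤ N (<⇒≤ (≤-<-trans f≤l c))
        ¬zf : ¬ R f (f + N)
        -- The diameter from `f` to `f + N` would cross the chord from `e` to `last e`.
        ¬zf z = ¬z (zero-transport (~-sym (noncross e<f f<l l<f+N (+-monoˡ-< N (≤-<-trans f≤l c)) (last-related e) z)) z)

    last-periodic : ∀ e → last (e + N) ≡ last e + N
    last-periodic e = by-cases (e ~? (e + N))
      where
      by-cases : Dec (R e (e + N)) → last (e + N) ≡ last e + N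
      by-cases (yes z) = trans (lastOf-zero _~?_ (shift z)) (cong (_+ N) (sym (lastOf-zero _~?_ z)))
      by-cases (no ¬z) = lastOf-unique _~?_ ~-refl (¬z ∘ unshift)
        (+-monoˡ-≤ N (lastOf-≥ _~?_)) (+-monoˡ-< N (lastOf< _~?_ ¬z)) (shift (last-related e))
        λ {x} l<x x< r →
          let N≤x = ≤-trans (m≤n+m N _) (<⇒≤ l<x)
              x≡ = m∸n+n≡m N≤x
              l<y = +-cancelʳ-< N _ _ (<-≤-trans l<x (≤-reflexive (sym x≡)))
              y< = +-cancelʳ-< N _ _ (≤-<-trans (≤-reflexive x≡) x<)
          in <⇒≱ l<y (lastOf-max _~?_ ¬z (≤-trans (lastOf-≥ _~?_) (<⇒≤ l<y)) y< (unshift (subst (R (e + N)) (sym x≡) r)))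

    -- Two distinct diameters cross, so all invariant blocks coincide.
    zero-unique : ∀ {e f} → R e (e + N) → R f (f + N) → e ≤ f → f < e + N + N → R e f
    zero-unique {e} {f} z z′ e≤f f< with <-cmp f (e + N)
    ... | tri≈ _ refl _ = z
    ... | tri< f<e+N _ _ with m≤n⇒m<n∨m≡n e≤f
    ...   | inj₂ refl = ~-refl
    ...   | inj₁ e<f = noncross e<f f<e+N (+-monoˡ-< N e<f) (+-monoˡ-< N f<e+N) z z′
    zero-unique {e} {f} z z′ e≤f f< | tri> _ _ e+N<f =
      ~-trans z (noncross e+N<f f< (+-monoˡ-< N e+N<f) (+-monoˡ-< N f<) (shift z) z′)

    -- The full turn from `e` on meets two lifts of its block, that of `e` and that of `e + N + N`,
    -- and `f` lies in one of them.
    related⇒last : ∀ {e f} → ¬ R e (e + N) → e ≤ f → f < e + N + N → R e f →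
                   last f ≡ last e ⊎ last (e + N + N) ≡ last f
    related⇒last {e} {f} ¬z e≤f f< r with f <? e + N
    ... | yes f<e+N = inj₁ (same-last ¬z e≤f f<e+N r)
    ... | no f≮e+N  = inj₂ (same-last (¬z ∘ zero-transport (~-sym r)) (<⇒≤ f<) (+-monoˡ-< N e+N<f) (~-trans (~-sym r) wrap))
      where
      e+N<f : e + N < f
      e+N<f = ≤∧≢⇒< (≮⇒≥ f≮e+N) λ e+N≡f → ¬z (subst (R e) (sym e+N≡f) r)

  module _ {R S : ℕ → ℕ → Set} (rel : NonCrossingRelation R) (rel′ : NonCrossingRelation S) where
    private
      module R = RelationLast rel
      module S = RelationLast rel′
      module R~ = NonCrossingRelation rel
      module S~ = NonCrossingRelation rel′

    module _ (R⊆S : ∀ {e f} → R e f → S e f) where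

      last-monotone : ∀ e → R.last e ≤ S.last e
      last-monotone e = by-cases (e S~.~? (e + N))
        where
        by-cases : Dec (S e (e + N)) → R.last e ≤ S.last e
        by-cases (yes z) = ≤-trans (lastOf≤ R~._~?_) (≤-reflexive (sym (lastOf-zero S~._~?_ z)))
        by-cases (no ¬z) = lastOf-max S~._~?_ ¬z (lastOf-≥ R~._~?_) (lastOf< R~._~?_ (¬z ∘ R⊆S)) (R⊆S (R.last-related e))

      last-coarser : ∀ {e} → S.last e < e + N → S.last (R.last e) ≡ S.last e
      last-coarser {e} c = S.same-last (S.closed⇒nonzero c) (lastOf-≥ R~._~?_)
        (≤-<-trans (last-monotone e) c) (R⊆S (R.last-related e))

      last-reflects : ∀ {e} → R.last e < e + N → S.last (R.last e) < R.last e + N → S.last e < e + N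
      last-reflects {e} c c′ = lastOf< S~._~?_ λ z →
        S.closed⇒nonzero c′ (S.zero-transport (R⊆S (R.last-related e)) z)

    -- The invariant block is recognised by the value `e + N`, every other block by its last element
    -- up to a full turn.
    related-by-last : (∀ e → R.last e ≡ S.last e) → ∀ {e f} → e ≤ f → f < e + N + N → R e f → S e f
    related-by-last same {e} {f} e≤f f< r = by-cases (e R~.~? (e + N))
      where
      zero-same : ∀ {x} → R x (x + N) → S x (x + N)
      zero-same {x} z with x S~.~? (x + N)
      ... | yes z′ = z′
      ... | no ¬z′ = contradiction (trans (sym (same x)) (lastOf-zero R~._~?_ z)) (<⇒≢ (lastOf< S~._~?_ ¬z′))
      joined : ∀ {x y} → R.last x ≡ R.last y → S x y
      joined {x} {y} eq = S~.~-trans (S.last-related x)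
        (subst (λ l → S l y) (trans (sym (same y)) (trans (sym eq) (same x))) (S~.~-sym (S.last-related y)))
      by-cases : Dec (R e (e + N)) → S e f
      by-cases (yes z) = S.zero-unique (zero-same z) (zero-same (R.zero-transport r z)) e≤f f<
      by-cases (no ¬z) with R.related⇒last ¬z e≤f f< r
      ... | inj₁ eq = S~.~-sym (joined eq)
      ... | inj₂ eq = S~.~-trans S~.wrap (joined eq)

-- Congruences, and the relations defined by last-element maps

%-window : ∀ x y n .{{_ : NonZero n}} → x % n ≡ y % n → x < y + n → y < x + n + n → x ≡ y ⊎ y ≡ x + n
%-window x y n eq x< y< with <-cmp (x / n) (y / n)
... | tri≈ _ q _ = inj₁ (trans (m≡m%n+[m/n]*n x n) (trans (cong₂ _+_ eq (cong (_* n) q)) (sym (m≡m%n+[m/n]*n y n))))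
... | tri> _ _ q = ⊥-elim (lia 6 (λ x y n r a b → x :≡ r :+ a ⇒ y :≡ r :+ b ⇒ n :+ b :≤ a ⇒ x :< y :+ n ⇒ ⊢ :⊥)
        x y n (y % n) (x / n * n) (y / n * n) (trans (m≡m%n+[m/n]*n x n) (cong (_+ x / n * n) eq)) (m≡m%n+[m/n]*n y n)
        (*-monoˡ-≤ n q) x<)
... | tri< q _ _ with m≤n⇒m<n∨m≡n q
...   | inj₁ q′ = ⊥-elim (lia 6 (λ x y n r a b → x :≡ r :+ a ⇒ y :≡ r :+ b ⇒ n :+ (n :+ a) :≤ b ⇒ y :< x :+ n :+ n ⇒ ⊢ :⊥)
        x y n (y % n) (x / n * n) (y / n * n) (trans (m≡m%n+[m/n]*n x n) (cong (_+ x / n * n) eq)) (m≡m%n+[m/n]*n y n)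
        (*-monoˡ-≤ n q′) y<)
...   | inj₂ q′ = inj₂ (lia 6 (λ x y n r a b → x :≡ r :+ a ⇒ y :≡ r :+ b ⇒ n :+ a :≡ b ⇒ ⊢ y :≡ x :+ n)
        x y n (y % n) (x / n * n) (y / n * n) (trans (m≡m%n+[m/n]*n x n) (cong (_+ x / n * n) eq)) (m≡m%n+[m/n]*n y n)
        (cong (_* n) q′))

periodic-% : ∀ {A : Set} n .{{_ : NonZero n}} (f : ℕ → A) → (∀ x → f (x + n) ≡ f x) → ∀ x → f x ≡ f (x % n)
periodic-% n f per x = trans (cong f (m≡m%n+[m/n]*n x n)) (multiples (x / n))
  where
  multiples : ∀ q → f (x % n + q * n) ≡ f (x % n)
  multiples zero    = cong f (+-identityʳ (x % n))
  multiples (suc q) = trans (cong f (lia 3 (λ r n m → ⊢ r :+ (n :+ m) :≡ r :+ m :+ n) (x % n) n (q * n)))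
                            (trans (per (x % n + q * n)) (multiples q))

%-+ʳ : ∀ x y c n .{{_ : NonZero n}} → x % n ≡ y % n → (x + c) % n ≡ (y + c) % n
%-+ʳ x y c n eq = trans (%-distribˡ-+ x c n) (trans (cong (λ r → (r + c % n) % n) eq) (sym (%-distribˡ-+ y c n)))

module Keys (N M ℓ : ℕ) (N>0 : 0 < N) (M≡N+N : M ≡ N + N) {{_ : NonZero M}} where
  open Correspondence N ℓ N>0
  open Periodic N N>0

  +M : ∀ x → x + M ≡ x + N + N
  +M x = trans (cong (x +_) M≡N+N) (sym (+-assoc x N N))

  module LastKeys {L : ℕ → ℕ → ℕ} (chain : LastChain L) where
    open LastChain chain

    closed? : ∀ j e → Dec (Closed L j e)
    closed? j e = L j e <? e + N

    keyOf : ∀ j e → Dec (Closed L j e) → ℕ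
    keyOf j e (yes _) = L j e % M
    keyOf j e (no _)  = M

    abstract

      -- Equal keys mean equal blocks; M marks the ρ-invariant block.
      key : ℕ → ℕ → ℕ
      key j e = keyOf j e (closed? j e)

      key-closed : ∀ {j e} → Closed L j e → key j e ≡ L j e % M
      key-closed {j} {e} c with closed? j e
      ... | yes _ = refl
      ... | no ¬c = contradiction c ¬c

      key-open : ∀ {j e} → ¬ Closed L j e → key j e ≡ M
      key-open {j} {e} ¬c with closed? j e
      ... | yes c = contradiction c ¬c
      ... | no _  = refl

      key<⇒closed : ∀ {j e} → key j e ≢ M → Closed L j e
      key<⇒closed {j} {e} k with closed? j e
      ... | yes c = c
      ... | no ¬c = contradiction refl k

      closed⇒key≢ : ∀ {j e} → Closed L j e → key j e ≢ M
      closed⇒key≢ {j} {e} c eq = <⇒≢ (m%n<n (L j e) M) (trans (sym (key-closed c)) eq)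

    closed-transport : ∀ {j e f} → key j e ≡ key j f → Closed L j e → Closed L j f
    closed-transport eq c = key<⇒closed λ eq′ → closed⇒key≢ c (trans eq eq′)

    L-periodic₂ : ∀ j e → L j (e + N + N) ≡ L j e + N + N
    L-periodic₂ j e = trans (periodic j (e + N)) (cong (_+ N) (periodic j e))

    key-≡ : ∀ {j e f} → (Closed L j e → Closed L j f) → (Closed L j f → Closed L j e) →
            (Closed L j e → Closed L j f → L j e % M ≡ L j f % M) → key j e ≡ key j f
    key-≡ {j} {e} {f} to from eq = by-cases (closed? j e)
      where
      by-cases : Dec (Closed L j e) → key j e ≡ key j f
      by-cases (yes c) = trans (key-closed c) (trans (eq c (to c)) (sym (key-closed (to c))))
      by-cases (no ¬c) = trans (key-open ¬c) (sym (key-open (¬c ∘ from)))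

    key-shift : ∀ {j e f} → key j e ≡ key j f → key j (e + N) ≡ key j (f + N)
    key-shift {j} {e} {f} eq = key-≡
      (closed-+N ∘ closed-transport eq ∘ closed-−N) (closed-+N ∘ closed-transport (sym eq) ∘ closed-−N)
      λ c c′ → trans (cong (_% M) (periodic j e)) (trans
        (%-+ʳ (L j e) (L j f) N M (trans (sym (key-closed (closed-−N c))) (trans eq (key-closed (closed-−N c′)))))
        (cong (_% M) (sym (periodic j f))))

    key-periodic : ∀ j e → key j (e + N + N) ≡ key j e
    key-periodic j e = key-≡ (closed-−N ∘ closed-−N) (closed-+N ∘ closed-+N)
      λ _ _ → trans (cong (_% M) (trans (L-periodic₂ j e) (sym (+M (L j e))))) ([m+n]%n≡m%n (L j e) M)

    same-key : ∀ {j e f} → e ≤ f → f < e + N + N → Closed L j e → key j e ≡ key j f →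
               L j f ≡ L j e ⊎ L j f ≡ L j (e + N + N)
    same-key {j} {e} {f} e≤f f< c eq = go (%-window (L j e) (L j f) M
        (trans (sym (key-closed c)) (trans eq (key-closed c′)))
        (lia 6 (λ a e f b N M → M :≡ N :+ N ⇒ a :< e :+ N ⇒ e :≤ f ⇒ f :≤ b ⇒ ⊢ a :< b :+ M)
          (L j e) e f (L j f) N M M≡N+N c e≤f (extensive j f))
        (lia 6 (λ a e f b N M → M :≡ N :+ N ⇒ b :< f :+ N ⇒ f :< e :+ N :+ N ⇒ e :≤ a ⇒ ⊢ b :< a :+ M :+ M)
          (L j e) e f (L j f) N M M≡N+N c′ f< (extensive j e)))
      where
      c′ : Closed L j f
      c′ = closed-transport eq c
      go : L j e ≡ L j f ⊎ L j f ≡ L j e + M → L j f ≡ L j e ⊎ L j f ≡ L j (e + N + N)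
      go (inj₁ eq) = inj₁ (sym eq)
      go (inj₂ eq) = inj₂ (trans eq (trans (+M (L j e)) (sym (L-periodic₂ j e))))

    same-last⇒key : ∀ {j e f} → Closed L j e → Closed L j f → L j e ≡ L j f → key j e ≡ key j f
    same-last⇒key c c′ eq = trans (key-closed c) (trans (cong (_% M) eq) (sym (key-closed c′)))

    spans : ∀ {j e f} → Closed L j e → e ≤ f → f ≤ L j e → L j f ≤ L j e × Closed L j f
    spans c e≤f f≤l = le , ≤-<-trans le (<-≤-trans c (+-monoˡ-≤ N e≤f))
      where le = nested c e≤f f≤l

    -- Equal keys leave two possibilities for `a` and `c`, and likewise for `b` and `d`: the same
    -- last element, or the same after a full turn of the first. In each of the four combinations
    -- `nested` gives opposite inequalities between last elements. The same containments show that
    -- `a` is closed exactly if `b` is.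
    key-noncross : ∀ {j a b c d} → a < b → b < c → c < d → d < a + N + N →
                   key j a ≡ key j c → key j b ≡ key j d → key j a ≡ key j b
    key-noncross {j} {a} {b} {c} {d} a<b b<c c<d d< ac bd = by-cases (closed? j a) (closed? j b)
      where
      a<c : a < c
      a<c = <-trans a<b b<c
      a′ b′ : ℕ
      a′ = a + N + N
      b′ = b + N + N
      a′<b′ : a′ < b′
      a′<b′ = +-monoˡ-< N (+-monoˡ-< N a<b)
      d≤L : ∀ {x} → L j d ≡ x → d ≤ x
      d≤L eq = ≤-trans (extensive j d) (≤-reflexive eq)
      c≤L : ∀ {x} → L j c ≡ x → c ≤ x
      c≤L eq = ≤-trans (extensive j c) (≤-reflexive eq)
      c-ends : Closed L j a → L j c ≡ L j a ⊎ L j c ≡ L j a′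
      c-ends ca = same-key (<⇒≤ a<c) (<-trans c<d d<) ca ac
      d-ends : Closed L j b → L j d ≡ L j b ⊎ L j d ≡ L j b′
      d-ends cb = same-key (<⇒≤ (<-trans b<c c<d)) (<-trans d< a′<b′) cb bd
      b-in-a : Closed L j a → L j c ≡ L j a → L j b ≤ L j a × Closed L j b
      b-in-a ca eq = spans ca (<⇒≤ a<b) (≤-trans (<⇒≤ b<c) (c≤L eq))
      d-in-c : Closed L j a → L j c ≡ L j a′ → L j d ≤ L j c × Closed L j d
      d-in-c ca eq = spans (closed-transport ac ca) (<⇒≤ c<d)
        (≤-trans (<⇒≤ d<) (≤-trans (extensive j a′) (≤-reflexive (sym eq))))
      c-in-b : Closed L j b → L j d ≡ L j b → L j c ≤ L j b × Closed L j c
      c-in-b cb eq = spans cb (<⇒≤ b<c) (≤-trans (<⇒≤ c<d) (d≤L eq))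
      a′-in-d : Closed L j b → L j d ≡ L j b′ → L j a′ ≤ L j d × Closed L j a′
      a′-in-d cb eq = spans (closed-transport bd cb) (<⇒≤ d<)
        (≤-trans (<⇒≤ a′<b′) (≤-trans (extensive j b′) (≤-reflexive (sym eq))))
      a-closed : Closed L j a → Closed L j b
      a-closed ca = [ (λ eq → proj₂ (b-in-a ca eq))
                    , (λ eq → closed-transport (sym bd) (proj₂ (d-in-c ca eq))) ]′ (c-ends ca)
      b-closed : Closed L j b → Closed L j a
      b-closed cb = [ (λ eq → closed-transport (sym ac) (proj₂ (c-in-b cb eq)))
                    , (λ eq → closed-−N (closed-−N (proj₂ (a′-in-d cb eq)))) ]′ (d-ends cb)
      module _ (ca : Closed L j a) (cb : Closed L j b) where
        first-turn : L j a ≡ L j b → key j a ≡ key j b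
        first-turn = same-last⇒key ca cb
        second-turn : L j a′ ≡ L j b → key j a ≡ key j b
        second-turn eq = trans (sym (key-periodic j a)) (same-last⇒key (closed-+N (closed-+N ca)) cb eq)
        both-turns : L j a′ ≡ L j b′ → key j a ≡ key j b
        both-turns eq = trans (sym (key-periodic j a)) (trans
          (same-last⇒key (closed-+N (closed-+N ca)) (closed-+N (closed-+N cb)) eq) (key-periodic j b))
        both : L j c ≡ L j a ⊎ L j c ≡ L j a′ → L j d ≡ L j b ⊎ L j d ≡ L j b′ → key j a ≡ key j b
        both (inj₁ eq) (inj₁ eq′) = first-turn (≤-antisym
          (≤-trans (≤-reflexive (sym eq)) (proj₁ (c-in-b cb eq′)))
          (proj₁ (b-in-a ca eq)))
        both (inj₁ eq) (inj₂ eq′) = both-turns (≤-antisym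
          (≤-trans (proj₁ (a′-in-d cb eq′)) (≤-reflexive eq′))
          (≤-trans (≤-reflexive (L-periodic₂ j b)) (≤-trans
            (+-monoˡ-≤ N (+-monoˡ-≤ N (proj₁ (b-in-a ca eq)))) (≤-reflexive (sym (L-periodic₂ j a))))))
        both (inj₂ eq) (inj₁ eq′) = second-turn (≤-antisym
          (≤-trans (≤-reflexive (sym eq)) (proj₁ (c-in-b cb eq′)))
          (≤-trans (≤-reflexive (sym eq′)) (≤-trans (proj₁ (d-in-c ca eq)) (≤-reflexive eq))))
        both (inj₂ eq) (inj₂ eq′) = both-turns (≤-antisym
          (≤-trans (proj₁ (a′-in-d cb eq′)) (≤-reflexive eq′))
          (≤-trans (≤-reflexive (sym eq′)) (≤-trans (proj₁ (d-in-c ca eq)) (≤-reflexive eq))))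
      by-cases : Dec (Closed L j a) → Dec (Closed L j b) → key j a ≡ key j b
      by-cases (no ¬ca) (no ¬cb) = trans (key-open ¬ca) (sym (key-open ¬cb))
      by-cases (no ¬ca) (yes cb) = contradiction (b-closed cb) ¬ca
      by-cases (yes ca) (no ¬cb) = contradiction (a-closed ca) ¬cb
      by-cases (yes ca) (yes cb) = both ca cb (c-ends ca) (d-ends cb)

    keyRelation : ∀ j → NonCrossingRelation (λ e f → key j e ≡ key j f)
    keyRelation j = record
      { _~?_     = λ e f → key j e ≟ key j f
      ; ~-refl   = refl
      ; ~-sym    = sym
      ; ~-trans  = trans
      ; wrap     = λ {e} → sym (key-periodic j e)
      ; shift    = key-shift
      ; noncross = key-noncross
      }

    key-last : ∀ {i j e} → i ≤ j → Closed L i e → key j (L i e) ≡ key j e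
    key-last {i} {j} {e} i≤j c = key-≡ (reflects i≤j c)
      (λ cj → subst (_< L i e + N) (sym (coarser i≤j cj)) (<-≤-trans cj (+-monoˡ-≤ N (extensive i e))))
      λ _ cj → cong (_% M) (coarser i≤j cj)

    key-% : ∀ j x → key j x ≡ key j (x % M)
    key-% j = periodic-% M (key j) λ x → trans (cong (key j) (+M x)) (key-periodic j x)

    -- An `i`-key is a last element modulo `M`, and passing to that last element preserves the
    -- `j`-key.
    key-coarser : ∀ {i j e f} → i ≤ j → key i e ≡ key i f → key j e ≡ key j f
    key-coarser {i} {j} {e} {f} i≤j eq = by-cases (closed? i e)
      where
      by-cases : Dec (Closed L i e) → key j e ≡ key j f
      by-cases (no ¬c) = trans (key-open (¬c ∘ closed-↓ i≤j))
        (sym (key-open (¬c ∘ closed-transport (sym eq) ∘ closed-↓ i≤j)))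
      by-cases (yes c) = begin
        key j e               ≡⟨ key-last i≤j c ⟨
        key j (L i e)         ≡⟨ key-% j (L i e) ⟩
        key j (L i e % M)     ≡⟨ cong (key j) (trans (sym (key-closed c)) (trans eq (key-closed c′))) ⟩
        key j (L i f % M)     ≡⟨ key-% j (L i f) ⟨
        key j (L i f)         ≡⟨ key-last i≤j c′ ⟩
        key j f               ∎
        where
        open ≡-Reasoning
        c′ : Closed L i f
        c′ = closed-transport eq c

    key-zero : ∀ {j e} → Closed L j e → key j e ≢ key j (e + N)
    key-zero {j} {e} c eq =
      [ (λ eq′ → <⇒≢ (m<m+n (L j e) N>0) (sym (trans (sym (periodic j e)) eq′)))
      , (λ eq′ → <⇒≢ (m<m+n (L j (e + N)) N>0) (trans eq′ (periodic j (e + N)))) ]′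
      (same-key {j} {e} {e + N} (m≤m+n e N) (m<m+n (e + N) N>0) c eq)

    key-recovers : ∀ j e → RelationLast.last (keyRelation j) e ≡ L j e
    key-recovers j e = by-cases (closed? j e)
      where
      by-cases : Dec (Closed L j e) → RelationLast.last (keyRelation j) e ≡ L j e
      by-cases (no ¬c) = trans (lastOf-zero _ (trans (key-open ¬c) (sym (key-open (¬c ∘ closed-−N)))))
        (≤-antisym (≮⇒≥ ¬c) (bounded j e))
      by-cases (yes c) = lastOf-unique _ refl (key-zero c) (extensive j e) c (sym (key-last ≤-refl c))
        λ {x} l<x x< eq → outside l<x x< (same-key (<⇒≤ (≤-<-trans (extensive j e) l<x))
          (<-≤-trans x< (m≤m+n (e + N) N)) c eq)
        where
        outside : ∀ {x} → L j e < x → x < e + N → L j x ≡ L j e ⊎ L j x ≡ L j (e + N + N) → ⊥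
        outside {x} l<x x< (inj₁ eq) = <⇒≱ l<x (≤-trans (extensive j x) (≤-reflexive eq))
        outside {x} l<x x< (inj₂ eq) = lia 5 (λ x e N a b → x :< e :+ N ⇒ a :≡ b ⇒ a :≤ x :+ N ⇒ e :+ N :+ N :≤ b ⇒ ⊢ :⊥)
          x e N (L j x) (L j (e + N + N)) x< eq (bounded j x) (extensive j (e + N + N))

-- Partitions of Fin M as relations on ℕ

lookup-ext : ∀ {A : Set} {n} {xs ys : Vec A n} → (∀ i → lookup xs i ≡ lookup ys i) → xs ≡ ys
lookup-ext {xs = xs} {ys} eq = trans (sym (tabulate∘lookup xs)) (trans (tabulate-cong eq) (tabulate∘lookup ys))

module _ {M : ℕ} .{{_ : NonZero M}} where

  at : ℕ → Fin M
  at x = x mod M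

  toℕ-at : ∀ x → toℕ (at x) ≡ x % M
  toℕ-at x = toℕ-fromℕ< (m%n<n x M)

  at-≡ : ∀ {x y} → x % M ≡ y % M → at x ≡ at y
  at-≡ {x} {y} eq = toℕ-injective (trans (toℕ-at x) (trans eq (sym (toℕ-at y))))

  at-toℕ : ∀ i → at (toℕ i) ≡ i
  at-toℕ i = toℕ-injective (trans (toℕ-at (toℕ i)) (m<n⇒m%n≡m (toℕ<n i)))

  toℕ-at-< : ∀ {x} → x < M → toℕ (at x) ≡ x
  toℕ-at-< {x} x<M = trans (toℕ-at x) (m<n⇒m%n≡m x<M)

  at-+M : ∀ x → at (x + M) ≡ at x
  at-+M x = at-≡ ([m+n]%n≡m%n x M)

rotate-at : ∀ {M} .{{_ : NonZero M}} h x → rotate {M} h (at x) ≡ at (x + h)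
rotate-at {suc m} h x = toℕ-injective (trans (toℕ-at (toℕ (at x) + h)) (trans
  (%-+ʳ (toℕ (at x)) x h (suc m) (trans (cong (_% suc m) (toℕ-at x)) (m%n%n≡m%n x (suc m))))
  (sym (toℕ-at (x + h)))))

module _ {M : ℕ} where

  rep-unique : ∀ {r s : Rep M} → IsSetPartition r → IsSetPartition s →
               (∀ i j → SameBlock r i j → SameBlock s i j) → (∀ i j → SameBlock s i j → SameBlock r i j) → r ≡ s
  rep-unique {r} {s} (idem , least) (idem′ , least′) to from = lookup-ext λ i → toℕ-injective (≤-antisym
    (least i (blk s i) (from (blk s i) i (idem′ i)))
    (least′ i (blk r i) (to (blk r i) i (idem i))))

module FromKey (M : ℕ) {{_ : NonZero M}} (κ : ℕ → ℕ) where

  leader : Fin M → ℕ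
  leader i = least (λ x → κ x ≟ κ (toℕ i)) M

  leader≤ : ∀ i {x} → κ x ≡ κ (toℕ i) → leader i ≤ x
  leader≤ i = least-≤ (λ x → κ x ≟ κ (toℕ i)) M

  leader< : ∀ i → leader i < M
  leader< i = ≤-<-trans (leader≤ i refl) (toℕ<n i)

  leader-key : ∀ i → κ (leader i) ≡ κ (toℕ i)
  leader-key i = least-satisfies (λ x → κ x ≟ κ (toℕ i)) M (leader< i)

  rep : Rep M
  rep = tabulate (at ∘ leader)

  toℕ-blk : ∀ i → toℕ (blk rep i) ≡ leader i
  toℕ-blk i = trans (cong toℕ (lookup∘tabulate (at ∘ leader) i)) (toℕ-at-< (leader< i))

  key-blk : ∀ i → κ (toℕ (blk rep i)) ≡ κ (toℕ i)
  key-blk i = trans (cong κ (toℕ-blk i)) (leader-key i)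

  same⇒key : ∀ {i j} → SameBlock rep i j → κ (toℕ i) ≡ κ (toℕ j)
  same⇒key {i} {j} eq = trans (sym (key-blk i)) (trans (cong (κ ∘ toℕ) eq) (key-blk j))

  key⇒same : ∀ {i j} → κ (toℕ i) ≡ κ (toℕ j) → SameBlock rep i j
  key⇒same {i} {j} eq = toℕ-injective (trans (toℕ-blk i) (trans
    (least-cong _ _ M (λ _ e → trans e eq) (λ _ e → trans e (sym eq))) (sym (toℕ-blk j))))

  rep-partition : IsSetPartition rep
  rep-partition = (λ i → key⇒same (key-blk i)) ,
    λ i j eq → ≤-trans (≤-reflexive (toℕ-blk i)) (leader≤ i (same⇒key eq))

module Lift (N M : ℕ) (N>0 : 0 < N) (M≡N+N : M ≡ N + N) {{_ : NonZero M}} where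
  open Periodic N N>0

  Lifted : Rep M → ℕ → ℕ → Set
  Lifted r e f = SameBlock r (at e) (at f)

  lifted? : ∀ r e f → Dec (Lifted r e f)
  lifted? r e f = sameBlock? r (at e) (at f)

  at-+2N : ∀ e → at {M} (e + N + N) ≡ at e
  at-+2N e = trans (cong at (trans (+-assoc e N N) (cong (e +_) (sym M≡N+N)))) (at-+M e)

  module _ {r : Rep M} (nc : NonCrossing r)
           (inv : ∀ i j → SameBlock r i j → SameBlock r (rotate N i) (rotate N j)) where

    lifted-shift : ∀ {e f} → Lifted r e f → Lifted r (e + N) (f + N)
    lifted-shift {e} {f} eq = subst₂ (SameBlock r) (rotate-at N e) (rotate-at N f) (inv (at e) (at f) eq)

    noncross-below : ∀ {a b c d} → a < b → b < c → c < d → d < M → Lifted r a c → Lifted r b d → Lifted r a b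
    noncross-below {a} {b} {c} {d} a<b b<c c<d d<M ac bd = decidable-stable (lifted? r a b) λ ¬ab →
      nc (at a , at b , at c , at d ,
          subst₂ _<_ (sym (toℕ-at-< a<M)) (sym (toℕ-at-< b<M)) a<b ,
          subst₂ _<_ (sym (toℕ-at-< b<M)) (sym (toℕ-at-< c<M)) b<c ,
          subst₂ _<_ (sym (toℕ-at-< c<M)) (sym (toℕ-at-< d<M)) c<d , ac , bd , ¬ab)
      where
      c<M : c < M
      c<M = <-trans c<d d<M
      b<M : b < M
      b<M = <-trans b<c c<M
      a<M : a < M
      a<M = <-trans a<b b<M

    -- `NonCrossing` speaks of linearly ordered positions. If the last one, two or three of the
    -- points pass `M`, subtracting `M` from them gives a cyclically permuted quadruple below `M`,
    -- in which the two pairs still cross.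
    noncross-around : ∀ {a b c d} → a < M → a < b → b < c → c < d → d < a + M → Lifted r a c → Lifted r b d → Lifted r a b
    noncross-around {a} {b} {c} {d} a<M a<b b<c c<d d<a+M ac bd = by-cases (d <? M) (c <? M) (b <? M)
      where
      down : ∀ {x} → ¬ x < M → x ∸ M + M ≡ x
      down x≮M = m∸n+n≡m (≮⇒≥ x≮M)
      at-down : ∀ {x} → ¬ x < M → at {M} (x ∸ M) ≡ at x
      at-down x≮M = trans (sym (at-+M _)) (cong at (down x≮M))
      lower : ∀ {x y} → (x≮ : ¬ x < M) → Lifted r x y → Lifted r (x ∸ M) y
      lower {y = y} x≮ = subst (λ i → SameBlock r i (at y)) (sym (at-down x≮))
      below : ∀ {x z} → ¬ x < M → x < z + M → x ∸ M < z
      below x≮ x< = +-cancelʳ-< M _ _ (≤-<-trans (≤-reflexive (down x≮)) x<)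
      by-cases : Dec (d < M) → Dec (c < M) → Dec (b < M) → Lifted r a b
      by-cases (yes d<M) _ _ = noncross-below a<b b<c c<d d<M ac bd
      by-cases (no d≮) (yes c<M) _ =
        trans (sym (trans (sym (lower d≮ refl)) (noncross-below (below d≮ d<a+M) a<b b<c c<M (lower d≮ (sym bd)) ac))) (sym bd)
      by-cases (no d≮) (no c≮) (yes b<M) = trans ac (trans
        (trans (sym (lower c≮ refl)) (trans
          (noncross-below (∸-monoˡ-< c<d (≮⇒≥ c≮)) (below d≮ d<a+M) a<b b<M (lower c≮ (sym ac)) (lower d≮ (sym bd)))
          (lower d≮ refl)))
        (sym bd))
      by-cases (no d≮) (no c≮) (no b≮) = trans ac (trans
        (trans (sym (lower c≮ refl)) (sym
          (noncross-below (∸-monoˡ-< b<c (≮⇒≥ b≮)) (∸-monoˡ-< c<d (≮⇒≥ c≮)) (below d≮ d<a+M) a<M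
            (lower b≮ (sym (lower d≮ (sym bd)))) (lower c≮ (sym ac)))))
        (lower b≮ refl))

    noncross-lift : ∀ {a b c d} → a < b → b < c → c < d → d < a + M → Lifted r a c → Lifted r b d → Lifted r a b
    noncross-lift {a} {b} {c} {d} a<b b<c c<d d<a+M ac bd =
      go (a / M) (m%n<n a M) (m≡m%n+[m/n]*n a M) a<b b<c c<d d<a+M ac bd
      where
      go : ∀ {a b c d x} q → x < M → a ≡ x + q * M → a < b → b < c → c < d → d < a + M →
           Lifted r a c → Lifted r b d → Lifted r a b
      go {x = x} zero x<M eq = noncross-around (subst (_< M) (sym (trans eq (+-identityʳ x))) x<M)
      go {a} {b} {c} {d} {x} (suc q) x<M eq a<b b<c c<d d< ac bd =
        subst₂ (SameBlock r) (at-down M≤a) (at-down M≤b)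
          (go q x<M (+-cancelʳ-≡ M _ _ (trans (m∸n+n≡m M≤a) (trans eq
               (lia 3 (λ x M y → ⊢ x :+ (M :+ y) :≡ x :+ y :+ M) x M (q * M)))))
             (∸-monoˡ-< a<b M≤a) (∸-monoˡ-< b<c M≤b) (∸-monoˡ-< c<d M≤c)
             (+-cancelʳ-< M _ _ (≤-<-trans (≤-reflexive (m∸n+n≡m M≤d))
               (<-≤-trans d< (≤-reflexive (cong (_+ M) (sym (m∸n+n≡m M≤a)))))))
             (subst₂ (SameBlock r) (sym (at-down M≤a)) (sym (at-down M≤c)) ac)
             (subst₂ (SameBlock r) (sym (at-down M≤b)) (sym (at-down M≤d)) bd))
        where
        M≤a : M ≤ a
        M≤a = ≤-trans (≤-trans (m≤m+n M _) (m≤n+m _ x)) (≤-reflexive (sym eq))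
        M≤b : M ≤ b
        M≤b = ≤-trans M≤a (<⇒≤ a<b)
        M≤c : M ≤ c
        M≤c = ≤-trans M≤b (<⇒≤ b<c)
        M≤d : M ≤ d
        M≤d = ≤-trans M≤c (<⇒≤ c<d)
        at-down : ∀ {x} → M ≤ x → at {M} (x ∸ M) ≡ at x
        at-down M≤x = trans (sym (at-+M _)) (cong at (m∸n+n≡m M≤x))

    liftedRelation : NonCrossingRelation (Lifted r)
    liftedRelation = record
      { _~?_     = lifted? r
      ; ~-refl   = refl
      ; ~-sym    = sym
      ; ~-trans  = trans
      ; wrap     = λ {e} → cong (blk r) (sym (at-+2N e))
      ; shift    = λ {e} {f} → lifted-shift {e} {f}
      ; noncross = λ {a} a<b b<c c<d d< → noncross-lift a<b b<c c<d
          (<-≤-trans d< (≤-reflexive (trans (+-assoc a N N) (cong (a +_) (sym M≡N+N)))))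
      }

  module _ {r : Rep M} (rel : NonCrossingRelation (Lifted r)) where
    open NonCrossingRelation rel

    noncrossing : NonCrossing r
    noncrossing (a , b , c , d , a<b , b<c , c<d , ac , bd , ¬ab) = ¬ab (subst₂ (SameBlock r) (at-toℕ a) (at-toℕ b)
      (noncross a<b b<c c<d (≤-trans (toℕ<n d) (≤-trans (m≤n+m M (toℕ a))
           (≤-reflexive (trans (cong (toℕ a +_) M≡N+N) (sym (+-assoc (toℕ a) N N))))))
         (subst₂ (SameBlock r) (sym (at-toℕ a)) (sym (at-toℕ c)) ac)
         (subst₂ (SameBlock r) (sym (at-toℕ b)) (sym (at-toℕ d)) bd)))

    rotate-toℕ : ∀ i → at (toℕ i + N) ≡ rotate N i
    rotate-toℕ i = trans (sym (rotate-at N (toℕ i))) (cong (rotate N) (at-toℕ i))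

    invariant : ∀ i j → (SameBlock r i j → SameBlock r (rotate N i) (rotate N j)) ×
                        (SameBlock r (rotate N i) (rotate N j) → SameBlock r i j)
    invariant i j =
      (λ eq → subst₂ (SameBlock r) (rotate-toℕ i) (rotate-toℕ j)
                (shift (subst₂ (SameBlock r) (sym (at-toℕ i)) (sym (at-toℕ j)) eq))) ,
      (λ eq → subst₂ (SameBlock r) (at-toℕ i) (at-toℕ j)
                (unshift (subst₂ (SameBlock r) (sym (rotate-toℕ i)) (sym (rotate-toℕ j)) eq)))

-- Counting blocks

filter-tabulate : ∀ {A : Set} {P : A → Set} (P? : ∀ x → Dec (P x)) n (f : Fin n → A) (g : ℕ → A) →
                  (∀ i → f i ≡ g (toℕ i)) → length (filter P? (List.tabulate f)) ≡ ∑ n (λ x → 𝟙 (P? (g x)))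
filter-tabulate P? zero    f g eq = refl
filter-tabulate {P = P} P? (suc n) f g eq = trans (by-cases (P? (f Fin.zero)))
  (cong₂ _+_ (𝟙-cong (P? (f Fin.zero)) (P? (g 0)) (subst P (eq Fin.zero)) (subst P (sym (eq Fin.zero))))
    (filter-tabulate P? n (f ∘ Fin.suc) (g ∘ suc) (eq ∘ Fin.suc)))
  where
  by-cases : Dec (P (f Fin.zero)) → length (filter P? (List.tabulate f)) ≡
             𝟙 (P? (f Fin.zero)) + length (filter P? (List.tabulate (f ∘ Fin.suc)))
  by-cases (yes p) = trans (cong length (filter-accept P? p))
    (cong (_+ length (filter P? (List.tabulate (f ∘ Fin.suc)))) (sym (𝟙-yes (P? (f Fin.zero)) p)))
  by-cases (no ¬p) = trans (cong length (filter-reject P? ¬p))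
    (cong (_+ length (filter P? (List.tabulate (f ∘ Fin.suc)))) (sym (𝟙-no (P? (f Fin.zero)) ¬p)))

filter-allFin : ∀ M .{{_ : NonZero M}} {P : Fin M → Set} (P? : ∀ i → Dec (P i)) →
                length (filter P? (allFin M)) ≡ ∑ M (λ x → 𝟙 (P? (at x)))
filter-allFin M P? = filter-tabulate P? M id at (sym ∘ at-toℕ)

∑-period : ∀ n (f : ℕ → ℕ) → (∀ x → f (x + n) ≡ f x) → ∑ (n + n) f ≡ 2 * ∑ n f
∑-period n f per = trans (∑-split n n f)
  (cong (∑ n f +_) (trans (∑-cong n λ x _ → trans (cong f (+-comm n x)) (per x)) (sym (+-identityʳ (∑ n f)))))

module FamilyChain (N ℓ : ℕ) (N>0 : 0 < N) where
  open Correspondence N ℓ N>0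
  open Periodic N N>0

  family-chain : {R : ℕ → ℕ → ℕ → Set} (rel : ∀ j → NonCrossingRelation (R j)) →
                 (∀ {i j e f} → i ≤ j → R i e f → R j e f) → (∀ {j e} → ℓ ≤ j → R j e (e + N)) →
                 LastChain (λ j → RelationLast.last (rel j))
  family-chain rel mono top = record
    { extensive = λ j e → lastOf-≥ _
    ; bounded   = λ j e → lastOf≤ _
    ; periodic  = λ j → RelationLast.last-periodic (rel j)
    ; nested    = λ {j} → RelationLast.last-nested (rel j)
    ; monotone  = λ {i} {j} e i≤j → last-monotone (rel i) (rel j) (mono i≤j) e
    ; coarser   = λ {i} {j} i≤j → last-coarser (rel i) (rel j) (mono i≤j)
    ; reflects  = λ {i} {j} i≤j → last-reflects (rel i) (rel j) (mono i≤j)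
    ; top       = λ e ℓ≤j → lastOf-zero _ (top ℓ≤j)
    }

module Representatives (N M : ℕ) (N>0 : 0 < N) (M≡N+N : M ≡ N + N) {{_ : NonZero M}} where
  open Periodic N N>0
  open Lift N M N>0 M≡N+N

  NonFixed : Rep M → Fin M → Set
  NonFixed r i = IsRepr r i × ¬ SameBlock r (rotate N i) i

  nonFixed? : ∀ r i → Dec (NonFixed r i)
  nonFixed? r i = isRepr? r i ×-dec ¬? (sameBlock? r (rotate N i) i)

  module _ {r : Rep M} (part : IsSetPartition r) (rel : NonCrossingRelation (Lifted r)) where
    open NonCrossingRelation rel
    open RelationLast rel

    Fixed : ℕ → Set
    Fixed y = last y ≡ y

    fixed⇒nonzero : ∀ {y} → Fixed y → ¬ Lifted r y (y + N)
    fixed⇒nonzero {y} fx z = <⇒≢ (m<m+n y N>0) (trans (sym fx) (lastOf-zero _ z))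

    last-fixed : ∀ {e} → last e < e + N → Fixed (last e)
    last-fixed {e} c = same-last (closed⇒nonzero c) (lastOf-≥ _) c (last-related e)

    fixed-+N : ∀ {y} → Fixed y → Fixed (y + N)
    fixed-+N {y} fx = trans (last-periodic y) (cong (_+ N) fx)

    fixed-−N : ∀ {y} → Fixed (y + N) → Fixed y
    fixed-−N {y} fx = +-cancelʳ-≡ N _ _ (trans (sym (last-periodic y)) fx)

    fixed-−M : ∀ q {y} → Fixed (y + q * M) → Fixed y
    fixed-−M zero    {y} fx = subst Fixed (+-identityʳ y) fx
    fixed-−M (suc q) {y} fx = fixed-−M q (fixed-−N (fixed-−N (subst Fixed
      (lia 4 (λ y N M m → M :≡ N :+ N ⇒ ⊢ y :+ (M :+ m) :≡ y :+ m :+ N :+ N) y N M (q * M) M≡N+N) fx)))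

    fixed-% : ∀ {y} → Fixed y → Fixed (y % M)
    fixed-% {y} fx = fixed-−M (y / M) (subst Fixed (m≡m%n+[m/n]*n y M) fx)

    nonFixed⇒nonzero : ∀ {x} → NonFixed r (at x) → ¬ Lifted r x (x + N)
    nonFixed⇒nonzero {x} (_ , ¬z) z = ¬z (sym (subst (SameBlock r (at x)) (sym (rotate-at N x)) z))

    fixed-apart : ∀ {y y′} → Fixed y → Fixed y′ → y < y′ → y′ < M → ¬ Lifted r y y′
    fixed-apart {y} {y′} fx fx′ y<y′ y′<M eq =
      [ (λ e → <⇒≢ y<y′ (sym (trans (sym fx′) (trans e fx))))
      , (λ e → <⇒≢ y′<y+2N (trans (sym fx′) (trans (sym e) (fixed-+N (fixed-+N fx))))) ]′
      (related⇒last (fixed⇒nonzero fx) (<⇒≤ y<y′) y′<y+2N eq)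
      where
      y′<y+2N : y′ < y + N + N
      y′<y+2N = lia 4 (λ y z N M → M :≡ N :+ N ⇒ z :< M ⇒ ⊢ z :< y :+ N :+ N) y y′ N M M≡N+N y′<M

    fixed-unique : ∀ {y y′} → Fixed y → Fixed y′ → y < M → y′ < M → Lifted r y y′ → y ≡ y′
    fixed-unique {y} {y′} fx fx′ y<M y′<M eq with <-cmp y y′
    ... | tri≈ _ y≡y′ _ = y≡y′
    ... | tri< y<y′ _ _ = contradiction eq (fixed-apart fx fx′ y<y′ y′<M)
    ... | tri> _ _ y′<y = contradiction (sym eq) (fixed-apart fx′ fx y′<y y<M)

    module _ {Q : Fin M → Set} (Q? : ∀ i → Dec (Q i)) (Q-block : ∀ {i j} → SameBlock r i j → Q i → Q j)
             (Q-shift : ∀ {x} → Q (at x) → Q (at (x + N))) where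

      private
        Q-unshift : ∀ {x} → Q (at (x + N)) → Q (at x)
        Q-unshift {x} q = subst Q (at-+2N x) (Q-shift q)

      -- A block is counted on the left at its least element in `Fin M`, on the right at its last
      -- element on the cover modulo `M`. The property `Q` will be trivial for the number of pairs
      -- and a prescribed size for the type.
      count-blocks : ∑ M (λ x → 𝟙 (nonFixed? r (at x) ×-dec Q? (at x))) ≡
                     ∑ M (λ y → 𝟙 ((last y ≟ y) ×-dec Q? (at y)))
      count-blocks = double-counting M M {C = λ x y → (NonFixed r (at x) × Q (at x)) × (Fixed y × Q (at y)) × Lifted r x y}
        (λ x → nonFixed? r (at x) ×-dec Q? (at x)) (λ y → (last y ≟ y) ×-dec Q? (at y))
        (λ x y → (nonFixed? r (at x) ×-dec Q? (at x)) ×-dec ((last y ≟ y) ×-dec Q? (at y)) ×-dec lifted? r x y)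
        (λ x x<M (nf , q) →
          let c  = lastOf< _~?_ (nonFixed⇒nonzero nf)
              l~ : Lifted r x (last x % M)
              l~ = trans (last-related x) (cong (blk r) (at-≡ (sym (m%n%n≡m%n (last x) M))))
          in last x % M , m%n<n (last x) M , (nf , q) , (fixed-% (last-fixed c) , Q-block l~ q) , l~)
        (λ y y<M (fx , q) →
          let i   = blk r (at y)
              i~  : SameBlock r (at (toℕ i)) (at y)
              i~  = trans (cong (blk r) (at-toℕ i)) (proj₁ part (at y))
              nf : NonFixed r (at (toℕ i))
              nf = trans (cong (blk r) (at-toℕ i)) (trans (proj₁ part (at y)) (sym (at-toℕ i))) ,
                   λ z → fixed⇒nonzero fx (zero-transport i~ (sym (subst (λ j → SameBlock r j (at (toℕ i))) (rotate-at N (toℕ i)) z)))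
          in toℕ i , toℕ<n i , (nf , Q-block (sym i~) q) , (fx , q) , i~)
        (λ _ _ (p , q , _) → p , q)
        (λ _ y<M y′<M (_ , (fx , _) , eq) (_ , (fx′ , _) , eq′) → fixed-unique fx fx′ y<M y′<M (trans (sym eq) eq′))
        (λ x<M x′<M _ (((repr , _) , _) , _ , eq) (((repr′ , _) , _) , _ , eq′) → trans (sym (toℕ-at-< x<M)) (trans
          (cong toℕ (trans (sym repr) (trans (trans eq (sym eq′)) repr′))) (toℕ-at-< x′<M)))

      -- Last elements have period `N`, so each pair of blocks has exactly one below `N`, and the
      -- division by 2 is exact.
      count-pairs : length (filter (λ i → nonFixed? r i ×-dec Q? i) (allFin M)) / 2 ≡
                    ∑ N (λ y → 𝟙 ((last y ≟ y) ×-dec Q? (at y)))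
      count-pairs = trans (cong (_/ 2) (begin
        length (filter (λ i → nonFixed? r i ×-dec Q? i) (allFin M))   ≡⟨ filter-allFin M (λ i → nonFixed? r i ×-dec Q? i) ⟩
        ∑ M (λ x → 𝟙 (nonFixed? r (at x) ×-dec Q? (at x)))            ≡⟨ count-blocks ⟩
        ∑ M fixed                                                     ≡⟨ cong (λ m → ∑ m fixed) M≡N+N ⟩
        ∑ (N + N) fixed                                               ≡⟨ ∑-period N fixed (λ y → 𝟙-cong (fixed? (y + N)) (fixed? y)
                                                                           (λ (fx , q) → fixed-−N fx , Q-unshift q)
                                                                           (λ (fx , q) → fixed-+N fx , Q-shift q)) ⟩
        2 * ∑ N fixed                                                 ≡⟨ *-comm 2 (∑ N fixed) ⟩
        ∑ N fixed * 2                                                 ∎)) (m*n/n≡m (∑ N fixed) 2)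
        where
        open ≡-Reasoning
        fixed? : ∀ y → Dec (Fixed y × Q (at y))
        fixed? y = (last y ≟ y) ×-dec Q? (at y)
        fixed : ℕ → ℕ
        fixed y = 𝟙 (fixed? y)

-- Ends of blocks counted by level

module TokenCounts (N ℓ : ℕ) (N>0 : 0 < N) where
  open Correspondence N ℓ N>0
  open Encoding N ℓ N>0

  module _ {L : ℕ → ℕ → ℕ} (chain : LastChain L) where
    open LastChain chain
    open EncodingOf chain

    fixed-+N′ : ∀ {v y} → L v y ≡ y → L v (y + N) ≡ y + N
    fixed-+N′ {v} {y} eq = trans (periodic v y) (cong (_+ N) eq)

    fixed-−N′ : ∀ {v y} → L v (y + N) ≡ y + N → L v y ≡ y
    fixed-−N′ {v} {y} eq = +-cancelʳ-≡ N _ _ (trans (sym (periodic v y)) eq)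

    nonzeroN : NonZero N
    nonzeroN = >-nonZero N>0

    reduce-% : ∀ {P : ℕ → Set} → (∀ {x} → P (x + N) → P x) → ∀ {x} → P x → P (_%_ x N {{nonzeroN}})
    reduce-% {P} down {x} px = multiples (_/_ x N {{nonzeroN}})
        (subst P (m≡m%n+[m/n]*n x N {{nonzeroN}}) px)
      where
      multiples : ∀ q {y} → P (y + q * N) → P y
      multiples zero    {y} p = subst P (+-identityʳ y) p
      multiples (suc q) {y} p = multiples q (down (subst P
        (lia 3 (λ y N m → ⊢ y :+ (N :+ m) :≡ y :+ m :+ N) y N (q * N)) p))

    token-% : ∀ {p v} → Token p v → Token (_%_ p N {{nonzeroN}}) v
    token-% {v = v} = reduce-% {λ p → Token p v} token-−N

    residue : ℕ → ℕ
    residue x = _%_ x N {{nonzeroN}}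

    residue< : ∀ x → residue x < N
    residue< x = m%n<n x N {{nonzeroN}}

    end-residue : ∀ v p → residue (L v p) ≡ residue (L v (residue p))
    end-residue v = periodic-% N {{nonzeroN}} (λ p → residue (L v p))
      λ p → trans (cong residue (periodic v p)) ([m+n]%n≡m%n (L v p) N {{nonzeroN}})

    End : ℕ → ℕ → Set
    End v y = L v y ≡ y × L (suc v) y ≢ y

    end? : ∀ v y → Dec (End v y)
    end? v y = (L v y ≟ y) ×-dec ¬? (L (suc v) y ≟ y)

    end-−N : ∀ {v y} → End v (y + N) → End v y
    end-−N (fx , jmp) = fixed-−N′ fx , jmp ∘ fixed-+N′

    token-end : ∀ {p v} → Token p v → End v (L v p)
    token-end t = token-fixed t , jump-end t

    module _ {Q : ℕ → Set} (Q? : ∀ y → Dec (Q y)) (Q-up : ∀ {y} → Q y → Q (y + N)) (Q-down : ∀ {y} → Q (y + N) → Q y) where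

      Q-% : ∀ {y} → Q y → Q (residue y)
      Q-% = reduce-% {Q} Q-down

      Q-mod : ∀ {y z} → residue y ≡ residue z → Q y → Q z
      Q-mod {y} {z} eq q = subst Q (sym (m≡m%n+[m/n]*n z N {{nonzeroN}})) (multiples (_/_ z N {{nonzeroN}}) (subst Q eq (Q-% q)))
        where
        multiples : ∀ m {y} → Q y → Q (y + m * N)
        multiples zero    {y} q = subst Q (sym (+-identityʳ y)) q
        multiples (suc m) {y} q = subst Q (lia 3 (λ y N m → ⊢ y :+ m :+ N :≡ y :+ (N :+ m)) y N (m * N)) (Q-up (multiples m q))

      -- A token corresponds to its end modulo `N`. Tokens with congruent ends differ by a multiple
      -- of `N`, and the positions counted are below `N`.
      level-count : ∀ v → ∑ N (λ y → 𝟙 (end? v y ×-dec Q? y)) ≡ ∑ N (λ p → 𝟙 (token? p v ×-dec Q? (L v p)))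
      level-count v = double-counting N N {C = λ y p → (End v y × Q y) × (Token p v × Q (L v p)) × residue (L v p) ≡ y}
        (λ y → end? v y ×-dec Q? y) (λ p → token? p v ×-dec Q? (L v p))
        (λ y p → (end? v y ×-dec Q? y) ×-dec (token? p v ×-dec Q? (L v p)) ×-dec (residue (L v p) ≟ y))
        (λ y y<N (e@(fx , jmp) , q) →
          let fx′ = fixed-+N′ fx
              p , _ , t , eq = make-token {y + N} {v} (m≤n+m N y) fx′ fx′ (jmp ∘ fixed-−N′)
              res : residue (L v (residue p)) ≡ y
              res = trans (sym (end-residue v p)) (trans (cong residue eq)
                      (trans ([m+n]%n≡m%n y N {{nonzeroN}}) (m<n⇒m%n≡m {{nonzeroN}} y<N)))
          in residue p , residue< p , (e , q) ,
             (token-% t , Q-mod (trans (m<n⇒m%n≡m {{nonzeroN}} y<N) (sym res)) q) , res)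
        (λ p p<N (t , q) → residue (L v p) , residue< (L v p) ,
          (reduce-% {End v} end-−N (token-end t) , Q-% q) , (t , q) , refl)
        (λ _ _ (e , t , _) → e , t)
        (λ y<N p<N p′<N (_ , (t , _) , eq) (_ , (t′ , _) , eq′) → same-token p<N p′<N t t′ (trans eq (sym eq′)))
        (λ _ _ _ (_ , _ , eq) (_ , _ , eq′) → trans (sym eq) eq′)
        where
        same-token : ∀ {p p′} → p < N → p′ < N → Token p v → Token p′ v → residue (L v p) ≡ residue (L v p′) → p ≡ p′
        same-token {p} {p′} p<N p′<N t t′ eq =
          [ (λ le → ordered p<N p′<N t t′ eq le) , (λ le → sym (ordered p′<N p<N t′ t (sym eq) le)) ]′ (≤-total (L v p) (L v p′))
          where
          ordered : ∀ {p p′} → p < N → p′ < N → Token p v → Token p′ v → residue (L v p) ≡ residue (L v p′) →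
                    L v p ≤ L v p′ → p ≡ p′
          ordered {p} {p′} p<N p′<N t t′ eq le =
            [ token-position t t′
            , (λ eq′ → ⊥-elim (<⇒≢ (<-≤-trans p′<N (m≤n+m N p)) (token-position t′ (token-+N t) (trans eq′ (sym (periodic v p)))))) ]′
            (%-window (L v p) (L v p′) N {{nonzeroN}} eq (≤-<-trans le (m<m+n (L v p′) N>0))
              (<-≤-trans (Token.closed t′) (+-monoˡ-≤ N (≤-trans (<⇒≤ p′<N) (m≤n+m N (L v p))))))

      -- An end at level `suc v` is an end at level `v`; those that get lost in between belong to
      -- the tokens of level exactly `v`.
      ends-split : ∀ v → ∑ N (λ y → 𝟙 ((L v y ≟ y) ×-dec Q? y)) ≡
                         ∑ N (λ p → 𝟙 (token? p v ×-dec Q? (L v p))) + ∑ N (λ y → 𝟙 ((L (suc v) y ≟ y) ×-dec Q? y))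
      ends-split v = trans (∑-cong N λ y _ → split (L v y ≟ y) (L (suc v) y ≟ y) (Q? y) (fixed-↓ (n≤1+n v)))
        (trans (∑-+ N (λ y → 𝟙 (end? v y ×-dec Q? y)) (λ y → 𝟙 ((L (suc v) y ≟ y) ×-dec Q? y)))
               (cong (_+ ∑ N (λ y → 𝟙 ((L (suc v) y ≟ y) ×-dec Q? y))) (level-count v)))
        where
        split : ∀ {A B C : Set} (a : Dec A) (b : Dec B) (c : Dec C) → (B → A) →
                𝟙 (a ×-dec c) ≡ 𝟙 ((a ×-dec ¬? b) ×-dec c) + 𝟙 (b ×-dec c)
        split (yes _) (yes _) (yes _) _ = refl
        split (yes _) (yes _) (no _)  _ = refl
        split (yes _) (no _)  (yes _) _ = refl
        split (yes _) (no _)  (no _)  _ = refl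
        split (no ¬a) (yes b) c       f = contradiction (f b) ¬a
        split (no _)  (no _)  c       _ = refl

      ends-top : ∑ N (λ y → 𝟙 ((L ℓ y ≟ y) ×-dec Q? y)) ≡ 0
      ends-top = ∑-zero N λ y _ → 𝟙-no ((L ℓ y ≟ y) ×-dec Q? y)
        λ (fx , _) → <⇒≢ (m<m+n y N>0) (trans (sym fx) (top y ≤-refl))

      ends-from : ∀ m v → v + m ≡ ℓ → ∑ N (λ y → 𝟙 ((L v y ≟ y) ×-dec Q? y)) ≡
                  ∑ m (λ i → ∑ N (λ p → 𝟙 (token? p (v + i) ×-dec Q? (L (v + i) p))))
      ends-from zero    v eq = subst (λ w → ∑ N (λ y → 𝟙 ((L w y ≟ y) ×-dec Q? y)) ≡ 0)
        (trans (sym eq) (+-identityʳ v)) ends-top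
      ends-from (suc m) v eq = trans (ends-split v) (cong₂ _+_
        (cong (λ w → ∑ N (λ p → 𝟙 (token? p w ×-dec Q? (L w p)))) (sym (+-identityʳ v)))
        (trans (ends-from m (suc v) (trans (sym (+-suc v m)) eq))
          (∑-cong m λ i _ → cong (λ w → ∑ N (λ p → 𝟙 (token? p w ×-dec Q? (L w p)))) (sym (+-suc v i)))))

module BlockSizes (N M ℓ : ℕ) (N>0 : 0 < N) (M≡N+N : M ≡ N + N) {{_ : NonZero M}} where
  open Correspondence N ℓ N>0
  open Encoding N ℓ N>0
  open Periodic N N>0
  open Lift N M N>0 M≡N+N

  module _ {r : Rep M} (rel : NonCrossingRelation (Lifted r)) where
    open NonCrossingRelation rel
    open RelationLast rel

    blockSize-∑ : ∀ i → blockSize r i ≡ ∑ M (λ x → 𝟙 (sameBlock? r (at x) i))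
    blockSize-∑ i = filter-allFin M (λ j → sameBlock? r j i)

    blockSize-block : ∀ {i j} → SameBlock r i j → blockSize r i ≡ blockSize r j
    blockSize-block {i} {j} eq = trans (blockSize-∑ i) (trans
      (∑-cong M λ x _ → 𝟙-cong (sameBlock? r (at x) i) (sameBlock? r (at x) j) (λ s → trans s eq) (λ s → trans s (sym eq)))
      (sym (blockSize-∑ j)))

    blockSize-at : ∀ b l → blockSize r (at l) ≡ ∑ M (λ x → 𝟙 (lifted? r (b + x) l))
    blockSize-at b l = trans (blockSize-∑ (at l)) (sym (∑-shift M (λ x → 𝟙 (lifted? r x l))
      (λ x → cong (λ i → 𝟙 (sameBlock? r i (at l))) (at-+M x)) b))

    blockSize-shift : ∀ x → blockSize r (at (x + N)) ≡ blockSize r (at x)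
    blockSize-shift x = trans (blockSize-at N (x + N)) (trans
      (∑-cong M λ y _ → 𝟙-cong (lifted? r (N + y) (x + N)) (lifted? r y x)
        (λ s → unshift (subst (λ z → Lifted r z (x + N)) (+-comm N y) s))
        (λ s → subst (λ z → Lifted r z (x + N)) (+-comm y N) (shift s)))
      (sym (blockSize-at 0 x)))

    module _ {L : ℕ → ℕ → ℕ} (chain : LastChain L) (last≡ : ∀ e → last e ≡ L 0 e) where
      open LastChain chain
      open EncodingOf chain

      -- Counted over the full turn from `p`, the lift ending at `L v p` lies in the first half. The
      -- second half could only meet the next lift, which does not begin before `p + N + N`.
      blockSize-token : ∀ {p v} → Token p v → blockSize r (at (L v p)) ≡ enc p v
      blockSize-token {p} {v} t = begin
        blockSize r (at l)                                                         ≡⟨ blockSize-at p l ⟩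
        ∑ M (λ x → 𝟙 (lifted? r (p + x) l))                                        ≡⟨ cong (λ m → ∑ m (λ x → 𝟙 (lifted? r (p + x) l))) M≡N+N ⟩
        ∑ (N + N) (λ x → 𝟙 (lifted? r (p + x) l))                                  ≡⟨ ∑-split N N (λ x → 𝟙 (lifted? r (p + x) l)) ⟩
        ∑ N (λ x → 𝟙 (lifted? r (p + x) l)) + ∑ N (λ x → 𝟙 (lifted? r (p + (N + x)) l))
          ≡⟨ cong₂ _+_ (∑-cong N λ x x<N → 𝟙-cong (lifted? r (p + x) l) (owns? p v (p + x)) (near x<N) (λ (_ , eq) → owned eq))
                       (∑-zero N λ x x<N → 𝟙-no (lifted? r (p + (N + x)) l) (far x<N)) ⟩
        enc p v + 0                                                                ≡⟨ +-identityʳ (enc p v) ⟩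
        enc p v                                                                    ∎
        where
        open ≡-Reasoning
        l : ℕ
        l = L v p
        p≤l : p ≤ l
        p≤l = extensive v p
        l<p+N : l < p + N
        l<p+N = Token.closed t
        fix : last l ≡ l
        fix = trans (last≡ l) (fixed-↓ z≤n (token-fixed t))
        ¬z : ¬ Lifted r l (l + N)
        ¬z z = <⇒≢ (m<m+n l N>0) (trans (sym fix) (lastOf-zero _ z))
        owned : ∀ {e} → L 0 e ≡ l → Lifted r e l
        owned {e} eq = subst (Lifted r e) (trans (last≡ e) eq) (last-related e)
        beyond : ∀ {e} → l < e → last e ≢ l
        beyond l<e eq = <⇒≱ l<e (≤-trans (lastOf-≥ _) (≤-reflexive eq))
        near : ∀ {x} → x < N → Lifted r (p + x) l → Owns p v (p + x)
        near {x} x<N s = t , [ before , after ]′ (≤-<-connex (p + x) l)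
          where
          before : p + x ≤ l → L 0 (p + x) ≡ l
          before e≤l = trans (sym (last≡ (p + x))) (trans (sym (same-last (¬z ∘ zero-transport s) e≤l
            (<-≤-trans l<p+N (+-monoˡ-≤ N (m≤m+n p x))) s)) fix)
          after : l < p + x → L 0 (p + x) ≡ l
          after l<e = contradiction (trans (same-last ¬z (<⇒≤ l<e)
            (<-≤-trans (+-monoʳ-< p x<N) (+-monoˡ-≤ N p≤l)) (sym s)) fix) (beyond l<e)
        far : ∀ {x} → x < N → ¬ Lifted r (p + (N + x)) l
        far {x} x<N s = [ (λ eq → beyond l<e (trans eq fix)) , wrapped ]′ (related⇒last ¬z (<⇒≤ l<e) e< (sym s))
          where
          e : ℕ
          e = p + (N + x)
          l<e : l < e
          l<e = <-≤-trans l<p+N (+-monoʳ-≤ p (m≤m+n N x))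
          e<p : e < p + N + N
          e<p = <-≤-trans (+-monoʳ-< p (+-monoʳ-< N x<N)) (≤-reflexive (sym (+-assoc p N N)))
          e< : e < l + N + N
          e< = <-≤-trans e<p (+-monoˡ-≤ N (+-monoˡ-≤ N p≤l))
          wrapped : last (l + N + N) ≡ last e → ⊥
          wrapped eq = <⇒≱ e<p (owns-≥ (token-+N (token-+N t) , (begin
            L 0 e                  ≡⟨ last≡ e ⟨
            last e                 ≡⟨ eq ⟨
            last (l + N + N)       ≡⟨ trans (last-periodic (l + N)) (cong (_+ N) (last-periodic l)) ⟩
            last l + N + N         ≡⟨ cong (λ z → z + N + N) fix ⟩
            l + N + N              ≡⟨ trans (periodic v (p + N)) (cong (_+ N) (periodic v p)) ⟨
            L v (p + N + N)        ∎)))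

-- Counting matrices

sumOver : ∀ {A : Set} → (A → ℕ) → List A → ℕ
sumOver f []       = 0
sumOver f (x ∷ xs) = f x + sumOver f xs

module _ {A : Set} where

  sumOver-cong : ∀ {f g : A → ℕ} → (∀ x → f x ≡ g x) → ∀ xs → sumOver f xs ≡ sumOver g xs
  sumOver-cong eq []       = refl
  sumOver-cong eq (x ∷ xs) = cong₂ _+_ (eq x) (sumOver-cong eq xs)

  sumOver-zero : ∀ (xs : List A) → sumOver (λ _ → 0) xs ≡ 0
  sumOver-zero []       = refl
  sumOver-zero (x ∷ xs) = sumOver-zero xs

  sumOver-++ : ∀ (f : A → ℕ) xs ys → sumOver f (xs ++ ys) ≡ sumOver f xs + sumOver f ys
  sumOver-++ f []       ys = refl
  sumOver-++ f (x ∷ xs) ys = trans (cong (f x +_) (sumOver-++ f xs ys)) (sym (+-assoc (f x) _ _))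

  sumOver-map : ∀ {B : Set} (f : A → ℕ) (g : B → A) xs → sumOver f (map g xs) ≡ sumOver (f ∘ g) xs
  sumOver-map f g []       = refl
  sumOver-map f g (x ∷ xs) = cong (f (g x) +_) (sumOver-map f g xs)

  sumOver-concatMap : ∀ {B : Set} (f : A → ℕ) (g : B → List A) xs →
                      sumOver f (concatMap g xs) ≡ sumOver (λ x → sumOver f (g x)) xs
  sumOver-concatMap f g []       = refl
  sumOver-concatMap f g (x ∷ xs) = trans (sumOver-++ f (g x) (concatMap g xs))
    (cong (sumOver f (g x) +_) (sumOver-concatMap f g xs))

  length-filter : ∀ {P : A → Set} (P? : ∀ x → Dec (P x)) xs → length (filter P? xs) ≡ sumOver (𝟙 ∘ P?) xs
  length-filter P? []       = refl
  length-filter P? (x ∷ xs) with P? x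
  ... | yes _ = cong suc (length-filter P? xs)
  ... | no _  = length-filter P? xs

sumOver-allVecs : ∀ {A : Set} m (f : Vec A (suc m) → ℕ) (xs : List A) →
  sumOver f (allVecs xs (suc m)) ≡ sumOver (λ x → sumOver (λ v → f (x ∷ v)) (allVecs xs m)) xs
sumOver-allVecs m f xs = trans (sumOver-concatMap f _ xs) (sumOver-cong (λ x → sumOver-map f (x ∷_) (allVecs xs m)) xs)

sumOver-suc : ∀ n (f : Fin (suc n) → ℕ) → sumOver f (allFin (suc n)) ≡ f zero + sumOver (f ∘ suc) (allFin n)
sumOver-suc n f = cong (f zero +_) (trans (cong (sumOver f) (sym (map-tabulate id suc))) (sumOver-map f suc (allFin n)))

-- Multisets of labels and multinomial coefficients

take : ∀ {n} → Fin n → Vec ℕ n → Maybe (Vec ℕ n)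
take zero    (zero ∷ xs)  = nothing
take zero    (suc x ∷ xs) = just (x ∷ xs)
take (suc m) (x ∷ xs)     = Maybe.map (x ∷_) (take m xs)

-- With a multinomial coefficient for `f` this is the recursive side of the generalised Pascal rule,
-- with one term for each label that can be removed.
predecessors : ∀ {n} → (Vec ℕ n → ℕ) → Vec ℕ n → ℕ
predecessors f []           = 0
predecessors f (zero ∷ xs)  = predecessors (f ∘ (0 ∷_)) xs
predecessors f (suc x ∷ xs) = f (x ∷ xs) + predecessors (f ∘ (suc x ∷_)) xs

maybe-map : ∀ {A B : Set} (f : B → ℕ) (g : A → B) m → maybe′ f 0 (Maybe.map g m) ≡ maybe′ (f ∘ g) 0 m
maybe-map f g (just x) = refl
maybe-map f g nothing  = refl

sumOver-take : ∀ {n} (f : Vec ℕ n → ℕ) bs → sumOver (λ m → maybe′ f 0 (take m bs)) (allFin n) ≡ predecessors f bs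
sumOver-take f [] = refl
sumOver-take {suc n} f (x ∷ xs) = trans (sumOver-suc n (λ m → maybe′ f 0 (take m (x ∷ xs)))) (trans
  (cong (maybe′ f 0 (take zero (x ∷ xs)) +_) (trans
    (sumOver-cong (λ m → maybe-map f (x ∷_) (take m xs)) (allFin n)) (sumOver-take (f ∘ (x ∷_)) xs)))
  (first x))
  where
  first : ∀ x → maybe′ f 0 (take zero (x ∷ xs)) + predecessors (f ∘ (x ∷_)) xs ≡ predecessors f (x ∷ xs)
  first zero    = refl
  first (suc x) = refl

predecessors-cong : ∀ {n} {f g : Vec ℕ n → ℕ} bs → (∀ cs → suc (Vec.sum cs) ≡ Vec.sum bs → f cs ≡ g cs) →
                    predecessors f bs ≡ predecessors g bs
predecessors-cong []           eq = refl
predecessors-cong (zero ∷ xs)  eq = predecessors-cong xs λ cs e → eq (0 ∷ cs) e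
predecessors-cong (suc x ∷ xs) eq = cong₂ _+_ (eq (x ∷ xs) refl)
  (predecessors-cong xs λ cs e → eq (suc x ∷ cs) (trans (cong suc (sym (+-suc x (Vec.sum cs)))) (cong (suc x +_) e)))

predecessors-* : ∀ {n} (f : Vec ℕ n → ℕ) c bs → predecessors (λ cs → f cs * c) bs ≡ predecessors f bs * c
predecessors-* f c []           = refl
predecessors-* f c (zero ∷ xs)  = predecessors-* (f ∘ (0 ∷_)) c xs
predecessors-* f c (suc x ∷ xs) = trans (cong (f (x ∷ xs) * c +_) (predecessors-* (f ∘ (suc x ∷_)) c xs))
  (sym (*-distribʳ-+ c (f (x ∷ xs)) _))

prodFact′ : ∀ {n} → Vec ℕ n → ℕ
prodFact′ bs = prodFact (toList bs)

-- Removing one unit from an entry `x` divides the product of factorials by `x`, so that its term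
-- contributes `x * K`. The factor `c` collects the factorials of the entries already passed.
predecessors-factorial : ∀ {n} (f : Vec ℕ n → ℕ) c K bs →
  (∀ cs → suc (Vec.sum cs) ≡ Vec.sum bs → f cs * (c * prodFact′ cs) ≡ K) →
  predecessors f bs * (c * prodFact′ bs) ≡ Vec.sum bs * K
predecessors-factorial f c K [] h = refl
predecessors-factorial f c K (zero ∷ xs) h = trans
  (cong (λ z → predecessors (f ∘ (0 ∷_)) xs * (c * z)) (+-identityʳ (prodFact′ xs)))
  (predecessors-factorial (f ∘ (0 ∷_)) c K xs
    λ cs e → trans (cong (λ z → f (0 ∷ cs) * (c * z)) (sym (+-identityʳ (prodFact′ cs)))) (h (0 ∷ cs) e))
predecessors-factorial f c K (suc x ∷ xs) h = begin
  (f (x ∷ xs) + rest) * (c * (suc x ! * prodFact′ xs))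
    ≡⟨ rearrange (f (x ∷ xs)) rest c (suc x) (x !) (prodFact′ xs) ⟩
  suc x * (f (x ∷ xs) * (c * (x ! * prodFact′ xs))) + rest * (c * (suc x !) * prodFact′ xs)
    ≡⟨ cong₂ _+_ (cong (suc x *_) (h (x ∷ xs) refl)) (predecessors-factorial (f ∘ (suc x ∷_)) (c * (suc x !)) K xs later) ⟩
  suc x * K + Vec.sum xs * K
    ≡⟨ *-distribʳ-+ K (suc x) (Vec.sum xs) ⟨
  (suc x + Vec.sum xs) * K ∎
  where
  open ≡-Reasoning
  rest : ℕ
  rest = predecessors (f ∘ (suc x ∷_)) xs
  rearrange : ∀ a r c s t p → (a + r) * (c * (s * t * p)) ≡ s * (a * (c * (t * p))) + r * (c * (s * t) * p)
  rearrange = solve-∀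
  later : ∀ cs → suc (Vec.sum cs) ≡ Vec.sum xs → f (suc x ∷ cs) * (c * (suc x !) * prodFact′ cs) ≡ K
  later cs e = trans (cong (f (suc x ∷ cs) *_) (*-assoc c (suc x !) (prodFact′ cs)))
    (h (suc x ∷ cs) (trans (cong suc (sym (+-suc x (Vec.sum cs)))) (cong (suc x +_) e)))

multinomial-unique : ∀ {n} b (bs : Vec ℕ n) m → m * prodFact′ bs ≡ b ! → multinomial b bs ≡ m
multinomial-unique b bs m eq = trans (cong (λ z → _/_ z (prodFact′ bs) {{prodFact≢0 (toList bs)}}) (sym eq))
  (m*n/n≡m m (prodFact′ bs) {{prodFact≢0 (toList bs)}})

sum-zero : ∀ {n} (bs : Vec ℕ n) → Vec.sum bs ≡ 0 → prodFact′ bs ≡ 1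
sum-zero []          eq = refl
sum-zero (zero ∷ bs) eq = trans (+-identityʳ (prodFact′ bs)) (sum-zero bs eq)

multinomial-zero : ∀ {n} (bs : Vec ℕ n) → Vec.sum bs ≡ 0 → multinomial 0 bs ≡ 1
multinomial-zero bs eq = multinomial-unique 0 bs 1 (trans (+-identityʳ (prodFact′ bs)) (sum-zero bs eq))

mutual

  -- `multinomial` is a truncated division; its exactness comes from the Pascal rule, by
  -- simultaneous induction on `b`.
  multinomial-factorial : ∀ {n} b (bs : Vec ℕ n) → Vec.sum bs ≡ b → multinomial b bs * prodFact′ bs ≡ b !
  multinomial-factorial zero    bs eq = cong₂ _*_ (multinomial-zero bs eq) (sum-zero bs eq)
  multinomial-factorial (suc b) bs eq = trans (cong (_* prodFact′ bs) (sym (multinomial-pascal b bs eq))) (pascal-factorial b bs eq)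

  pascal-factorial : ∀ {n} b (bs : Vec ℕ n) → Vec.sum bs ≡ suc b →
                     predecessors (multinomial b) bs * prodFact′ bs ≡ suc b !
  pascal-factorial b bs eq = begin
    predecessors (multinomial b) bs * prodFact′ bs           ≡⟨ cong (predecessors (multinomial b) bs *_) (+-identityʳ (prodFact′ bs)) ⟨
    predecessors (multinomial b) bs * (1 * prodFact′ bs)
      ≡⟨ predecessors-factorial (multinomial b) 1 (b !) bs (λ cs e → trans (cong (multinomial b cs *_) (+-identityʳ (prodFact′ cs)))
           (multinomial-factorial b cs (suc-injective (trans e eq)))) ⟩
    Vec.sum bs * b !                                         ≡⟨ cong (_* b !) eq ⟩
    suc b * b !                                              ∎
    where open ≡-Reasoning

  multinomial-pascal : ∀ {n} b (bs : Vec ℕ n) → Vec.sum bs ≡ suc b → predecessors (multinomial b) bs ≡ multinomial (suc b) bs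
  multinomial-pascal b bs eq = sym (multinomial-unique (suc b) bs _ (pascal-factorial b bs eq))

-- In a matrix of labels, zero is an empty cell and suc m stands for the label 2k(m + 1).

Row : ℕ → ℕ → Set
Row n c = Vec (Fin (suc n)) c

fillRow : ∀ {n c} → Row n c → ℕ → Vec ℕ n → Maybe (Vec ℕ n)
fillRow []            zero    bs = just bs
fillRow []            (suc s) bs = nothing
fillRow (zero ∷ row)  s       bs = fillRow row s bs
fillRow (suc m ∷ row) zero    bs = nothing
fillRow (suc m ∷ row) (suc s) bs = Maybe.maybe′ (fillRow row s) nothing (take m bs)

fill : ∀ {n c ℓ} → Vec (Row n c) ℓ → Vec ℕ ℓ → Vec ℕ n → Maybe (Vec ℕ n)
fill []           []      bs = just bs
fill (row ∷ rows) (s ∷ t) bs = Maybe.maybe′ (fill rows t) nothing (fillRow row s bs)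

maybe-bind : ∀ {A B : Set} (f : B → ℕ) (g : A → Maybe B) m →
             maybe′ f 0 (maybe′ g nothing m) ≡ maybe′ (λ x → maybe′ f 0 (g x)) 0 m
maybe-bind f g (just x) = refl
maybe-bind f g nothing  = refl

sumOver-maybe : ∀ {A B : Set} (f : A → B → ℕ) (m : Maybe B) xs →
                sumOver (λ x → maybe′ (f x) 0 m) xs ≡ maybe′ (λ y → sumOver (λ x → f x y) xs) 0 m
sumOver-maybe f (just y) xs = refl
sumOver-maybe f nothing  xs = sumOver-zero xs

rowSum : ∀ {n} → ℕ → ℕ → (Vec ℕ n → ℕ) → Vec ℕ n → ℕ
rowSum {n} c s f bs = sumOver (λ row → maybe′ f 0 (fillRow row s bs)) (allVecs (allFin (suc n)) c)

rowSum-zero : ∀ {n} c (f : Vec ℕ n → ℕ) bs → rowSum (suc c) 0 f bs ≡ rowSum c 0 f bs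
rowSum-zero {n} c f bs = trans (sumOver-allVecs c _ (allFin (suc n))) (trans (sumOver-suc n _) (trans
  (cong (rowSum c 0 f bs +_) (trans (sumOver-cong (λ m → sumOver-zero (allVecs (allFin (suc n)) c)) (allFin n)) (sumOver-zero (allFin n))))
  (+-identityʳ _)))

rowSum-suc : ∀ {n} c s (f : Vec ℕ n → ℕ) bs →
             rowSum (suc c) (suc s) f bs ≡ rowSum c (suc s) f bs + predecessors (rowSum c s f) bs
rowSum-suc {n} c s f bs = trans (sumOver-allVecs c _ (allFin (suc n))) (trans (sumOver-suc n _)
  (cong (rowSum c (suc s) f bs +_) (trans (sumOver-cong (λ m → trans
      (sumOver-cong (λ row → maybe-bind f (fillRow row s) (take m bs)) (allVecs (allFin (suc n)) c))
      (sumOver-maybe (λ row bs → maybe′ f 0 (fillRow row s bs)) (take m bs) (allVecs (allFin (suc n)) c))) (allFin n))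
    (sumOver-take (rowSum c s f) bs))))

-- The first cell is empty or takes a label: this is Pascal's rule for `c C s`, and
-- `multinomial-pascal` absorbs the choice of the label. `f` and `K` stand for the count of the rows
-- that follow.
rowSum-value : ∀ {n} (f : Vec ℕ n → ℕ) B K → (∀ cs → Vec.sum cs ≡ B → f cs ≡ multinomial B cs * K) →
               ∀ c s bs → Vec.sum bs ≡ s + B → rowSum c s f bs ≡ multinomial (s + B) bs * ((c C s) * K)
rowSum-value f B K h zero zero bs eq = trans (+-identityʳ (f bs)) (trans (h bs eq)
  (cong (multinomial B bs *_) (sym (+-identityʳ K))))
rowSum-value f B K h zero (suc s) bs eq = sym (*-zeroʳ (multinomial (suc s + B) bs))
rowSum-value f B K h (suc c) zero bs eq = trans (rowSum-zero c f bs) (rowSum-value f B K h c zero bs eq)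
rowSum-value f B K h (suc c) (suc s) bs eq = begin
  rowSum (suc c) (suc s) f bs
    ≡⟨ rowSum-suc c s f bs ⟩
  rowSum c (suc s) f bs + predecessors (rowSum c s f) bs
    ≡⟨ cong₂ _+_ (rowSum-value f B K h c (suc s) bs eq)
         (predecessors-cong bs λ cs e → rowSum-value f B K h c s cs (suc-injective (trans e eq))) ⟩
  multinomial (suc s + B) bs * ((c C suc s) * K) + predecessors (λ cs → multinomial (s + B) cs * ((c C s) * K)) bs
    ≡⟨ cong (multinomial (suc s + B) bs * ((c C suc s) * K) +_) (trans (predecessors-* (multinomial (s + B)) ((c C s) * K) bs)
         (cong (_* ((c C s) * K)) (multinomial-pascal (s + B) bs eq))) ⟩
  multinomial (suc s + B) bs * ((c C suc s) * K) + multinomial (suc s + B) bs * ((c C s) * K)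
    ≡⟨ collect (multinomial (suc s + B) bs) (c C suc s) (c C s) K ⟩
  multinomial (suc s + B) bs * (((c C s) + (c C suc s)) * K)
    ≡⟨ cong (λ z → multinomial (suc s + B) bs * (z * K)) (nCk+nC[k+1]≡[n+1]C[k+1] c s) ⟩
  multinomial (suc s + B) bs * ((suc c C suc s) * K) ∎
  where
  open ≡-Reasoning
  collect : ∀ m x y k → m * (x * k) + m * (y * k) ≡ m * ((y + x) * k)
  collect = solve-∀

isJust? : ∀ {A : Set} (m : Maybe A) → Dec (Is-just m)
isJust? (just x) = yes (just tt)
isJust? nothing  = no λ ()

fills : ∀ {n} c ℓ → List (Vec (Row n c) ℓ)
fills {n} c ℓ = allVecs (allVecs (allFin (suc n)) c) ℓ

count-fills : ∀ {n} c ℓ (t : Vec ℕ ℓ) (bs : Vec ℕ n) → Vec.sum bs ≡ Vec.sum t →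
  length (filter (λ V → isJust? (fill V t bs)) (fills c ℓ)) ≡
  multinomial (Vec.sum t) bs * product (map (λ s → c C s) (toList t))
count-fills c ℓ t bs eq = trans (length-filter (λ V → isJust? (fill V t bs)) (fills c ℓ)) (value ℓ t bs eq)
  where
  value : ∀ ℓ (t : Vec ℕ ℓ) bs → Vec.sum bs ≡ Vec.sum t → sumOver (λ V → 𝟙 (isJust? (fill V t bs))) (fills c ℓ) ≡
          multinomial (Vec.sum t) bs * product (map (λ s → c C s) (toList t))
  value zero    []      bs eq = trans (sym (multinomial-zero bs eq)) (sym (*-identityʳ (multinomial 0 bs)))
  value (suc ℓ) (s ∷ t) bs eq = trans (sumOver-allVecs ℓ _ (allVecs (allFin _) c)) (trans
    (sumOver-cong (λ row → trans (sumOver-cong (λ V → unfold V (fillRow row s bs)) (fills c ℓ))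
      (sumOver-maybe (λ V cs → 𝟙 (isJust? (fill V t cs))) (fillRow row s bs) (fills c ℓ))) (allVecs (allFin _) c))
    (rowSum-value _ (Vec.sum t) (product (map (λ s → c C s) (toList t))) (λ cs e → value ℓ t cs e) c s bs eq))
    where
    unfold : ∀ V m → 𝟙 (isJust? (maybe′ (fill V t) nothing m)) ≡ maybe′ (λ cs → 𝟙 (isJust? (fill V t cs))) 0 m
    unfold V (just cs) = refl
    unfold V nothing   = refl

-- Additive statistics of matrices

onCell : ∀ {n} → (Fin n → ℕ) → Fin (suc n) → ℕ
onCell w zero    = 0
onCell w (suc m) = w m

rowTotal : ∀ {n c} → (Fin n → ℕ) → Row n c → ℕ
rowTotal w row = Vec.sum (Vec.map (onCell w) row)

total : ∀ {n c ℓ} → (Fin n → ℕ) → Vec (Row n c) ℓ → ℕ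
total w V = Vec.sum (Vec.map (rowTotal w) V)

supports : ∀ {n c ℓ} → Vec (Row n c) ℓ → Vec ℕ ℓ
supports V = Vec.map (rowTotal λ _ → 1) V

-- By `fill-additive`, such a statistic of `bs` splits into its total over the matrix and its value
-- on the labels left over.
Additive : ∀ {n} → (Vec ℕ n → ℕ) → (Fin n → ℕ) → Set
Additive φ w = ∀ m bs cs → take m bs ≡ just cs → φ bs ≡ w m + φ cs

take-just : ∀ {n x xs} (m : Fin n) {ys} → take (suc m) (x ∷ xs) ≡ just ys → ∃ λ zs → take m xs ≡ just zs × ys ≡ x ∷ zs
take-just {xs = xs} m eq with take m xs
take-just m refl | just zs = zs , refl , refl

fillRow-support : ∀ {n c} (row : Row n c) s bs {cs} → fillRow row s bs ≡ just cs → rowTotal (λ _ → 1) row ≡ s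
fillRow-support []            zero    bs eq = refl
fillRow-support (zero ∷ row)  s       bs eq = fillRow-support row s bs eq
fillRow-support (suc m ∷ row) (suc s) bs eq with take m bs
... | just bs′ = cong suc (fillRow-support row s bs′ eq)

fillRow-additive : ∀ {n c} {φ : Vec ℕ n → ℕ} {w} → Additive φ w → (row : Row n c) → ∀ s bs {cs} →
                   fillRow row s bs ≡ just cs → φ bs ≡ rowTotal w row + φ cs
fillRow-additive add []            zero    bs refl = refl
fillRow-additive add (zero ∷ row)  s       bs eq = fillRow-additive add row s bs eq
fillRow-additive {φ = φ} {w} add (suc m ∷ row) (suc s) bs {cs} eq with take m bs in eq′
... | just bs′ = trans (add m bs bs′ eq′) (trans (cong (w m +_) (fillRow-additive add row s bs′ eq)) (sym (+-assoc (w m) _ (φ cs))))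

fill-supports : ∀ {n c ℓ} (V : Vec (Row n c) ℓ) t bs {cs} → fill V t bs ≡ just cs → supports V ≡ t
fill-supports []        []      bs eq = refl
fill-supports (row ∷ V) (s ∷ t) bs eq with fillRow row s bs in eq′
... | just bs′ = cong₂ _∷_ (fillRow-support row s bs eq′) (fill-supports V t bs′ eq)

fill-additive : ∀ {n c ℓ} {φ : Vec ℕ n → ℕ} {w} → Additive φ w → (V : Vec (Row n c) ℓ) → ∀ t bs {cs} →
                fill V t bs ≡ just cs → φ bs ≡ total w V + φ cs
fill-additive add []        []      bs refl = refl
fill-additive {φ = φ} {w} add (row ∷ V) (s ∷ t) bs {cs} eq with fillRow row s bs in eq′
... | just bs′ = trans (fillRow-additive add row s bs eq′) (trans (cong (rowTotal w row +_) (fill-additive add V t bs′ eq))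
                   (sym (+-assoc (rowTotal w row) _ (φ cs))))

is : ∀ {n} → Fin n → Fin n → ℕ
is m m′ = 𝟙 (toℕ m′ ≟ toℕ m)

lookup-additive : ∀ {n} (m₀ : Fin n) → Additive (λ bs → lookup bs m₀) (is m₀)
lookup-additive zero     zero    (suc x ∷ xs) _ refl = refl
lookup-additive (suc m₀) zero    (suc x ∷ xs) _ refl = refl
lookup-additive zero     (suc m) (x ∷ xs) ys eq with zs , eq′ , refl ← take-just m eq = refl
lookup-additive (suc m₀) (suc m) (x ∷ xs) ys eq with zs , eq′ , refl ← take-just m eq = trans
  (lookup-additive m₀ m xs zs eq′)
  (cong (_+ lookup zs m₀) (𝟙-cong (toℕ m ≟ toℕ m₀) (suc (toℕ m) ≟ suc (toℕ m₀)) (cong suc) suc-injective))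

sum-additive : ∀ {n} → Additive {n} Vec.sum (λ _ → 1)
sum-additive zero    (suc x ∷ xs) _  refl = refl
sum-additive (suc m) (x ∷ xs)     ys eq with zs , eq′ , refl ← take-just m eq =
  trans (cong (x +_) (sum-additive m xs zs eq′)) (+-suc x (Vec.sum zs))

weighted : ∀ {n} → ℕ → Vec ℕ n → ℕ
weighted c []       = 0
weighted c (x ∷ xs) = c * x + weighted (suc c) xs

weighted-additive : ∀ {n} c → Additive {n} (weighted c) (λ m → c + toℕ m)
weighted-additive c zero    (suc x ∷ xs) _  refl =
  trans (cong (_+ weighted (suc c) xs) (*-suc c x)) (trans (+-assoc c (c * x) _) (cong (_+ (c * x + weighted (suc c) xs)) (sym (+-identityʳ c))))
weighted-additive c (suc m) (x ∷ xs)     ys eq with zs , eq′ , refl ← take-just m eq =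
  trans (cong (c * x +_) (weighted-additive (suc c) m xs zs eq′))
    (lia 4 (λ a c m w → ⊢ a :+ (con 1 :+ c :+ m :+ w) :≡ c :+ (con 1 :+ m) :+ (a :+ w)) (c * x) c (toℕ m) (weighted (suc c) zs))

weightedSum≡ : ∀ {n} (bs : Vec ℕ n) → weightedSum bs ≡ weighted 1 bs
weightedSum≡ bs = shifted 0 bs
  where
  shifted : ∀ {n} c (bs : Vec ℕ n) → Vec.sum (Vec.tabulate (λ j → suc (c + toℕ j) * lookup bs j)) ≡ weighted (suc c) bs
  shifted c []       = refl
  shifted c (x ∷ xs) = cong₂ _+_ (cong (λ z → suc z * x) (+-identityʳ c))
    (trans (cong Vec.sum (tabulate-cong λ j → cong (λ z → suc z * lookup xs j) (+-suc c (toℕ j)))) (shifted (suc c) xs))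

sum≤weighted : ∀ {n} c (bs : Vec ℕ n) → Vec.sum bs ≤ weighted (suc c) bs
sum≤weighted c []       = z≤n
sum≤weighted c (x ∷ xs) = +-mono-≤ (m≤m+n x (c * x)) (sum≤weighted (suc c) xs)

take-positive : ∀ {n} (m : Fin n) bs → 0 < lookup bs m → ∃ λ cs → take m bs ≡ just cs
take-positive zero    (suc x ∷ xs) pos = x ∷ xs , refl
take-positive (suc m) (x ∷ xs)     pos with zs , eq ← take-positive m xs pos = x ∷ zs , cong (Maybe.map (x ∷_)) eq

-- Taking a label lowers its stock and the remaining demand for it alike, so the hypothesis passes
-- to the rest of the row.
fillRow-exists : ∀ {n c} (row : Row n c) bs → (∀ m → rowTotal (is m) row ≤ lookup bs m) →
                 ∃ λ cs → fillRow row (rowTotal (λ _ → 1) row) bs ≡ just cs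
fillRow-exists []            bs h = bs , refl
fillRow-exists (zero ∷ row)  bs h = fillRow-exists row bs h
fillRow-exists (suc m ∷ row) bs h =
  let bs′ , eq = take-positive m bs (≤-trans (≤-trans (≤-reflexive (sym (𝟙-yes (toℕ m ≟ toℕ m) refl))) (m≤m+n (is m m) _)) (h m))
      cs , eq′ = fillRow-exists row bs′ λ m₀ → +-cancelˡ-≤ (is m₀ m) _ _ (≤-trans (h m₀) (≤-reflexive (lookup-additive m₀ m bs bs′ eq)))
  in cs , trans (cong (Maybe.maybe′ (fillRow row (rowTotal (λ _ → 1) row)) nothing) eq) eq′

fill-exists : ∀ {n c ℓ} (V : Vec (Row n c) ℓ) bs → (∀ m → total (is m) V ≤ lookup bs m) →
              ∃ λ cs → fill V (supports V) bs ≡ just cs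
fill-exists []        bs h = bs , refl
fill-exists (row ∷ V) bs h =
  let bs′ , eq = fillRow-exists row bs λ m → ≤-trans (m≤m+n _ _) (h m)
      cs , eq′ = fill-exists V bs′ λ m → +-cancelˡ-≤ (rowTotal (is m) row) _ _ (≤-trans (h m)
                   (≤-reflexive (fillRow-additive (lookup-additive m) row (rowTotal (λ _ → 1) row) bs eq)))
  in cs , trans (cong (Maybe.maybe′ (fill V (supports V)) nothing) eq) eq′

lookup≤sum : ∀ {n} (bs : Vec ℕ n) m → lookup bs m ≤ Vec.sum bs
lookup≤sum (x ∷ xs) zero    = m≤m+n x _
lookup≤sum (x ∷ xs) (suc m) = ≤-trans (lookup≤sum xs m) (m≤n+m _ x)

sum-map-∑ : ∀ {A : Set} {c} (f : A → ℕ) (row : Vec A c) (g : ℕ → ℕ) → (∀ i → f (lookup row i) ≡ g (toℕ i)) →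
            Vec.sum (Vec.map f row) ≡ ∑ c g
sum-map-∑ f []        g eq = refl
sum-map-∑ f (x ∷ row) g eq = cong₂ _+_ (eq zero) (sum-map-∑ f row (g ∘ suc) (eq ∘ suc))

-- Counting by correspondences between lists without repetitions

-- Pigeonhole for a relation in place of a function: the partner of the first element is cut out of
-- `ys`, and injectivity prevents it from being the partner of another.
length-≤ : ∀ {A B : Set} (R : A → B → Set) xs ys → Unique xs →
           (∀ {x} → x ∈ xs → ∃ λ y → y ∈ ys × R x y) →
           (∀ {x x′ y} → x ∈ xs → x′ ∈ xs → y ∈ ys → R x y → R x′ y → x ≡ x′) → length xs ≤ length ys
length-≤ R []       ys _          image inj = z≤n
length-≤ R (x ∷ xs) ys (x∉ ∷ uniq) image inj
  with y , y∈ , c ← image (here refl)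
  with ys₁ , ys₂ , refl ← ∈-∃++ y∈ = ≤-trans (s≤s (length-≤ R xs (ys₁ ++ ys₂) uniq image′ inj′)) (≤-reflexive count)
  where
  widen : ∀ {z} → z ∈ ys₁ ++ ys₂ → z ∈ ys₁ ++ [ y ] ++ ys₂
  widen z∈ = [ ∈-++⁺ˡ , ∈-++⁺ʳ ys₁ ∘ there ]′ (∈-++⁻ ys₁ z∈)
  image′ : ∀ {x′} → x′ ∈ xs → ∃ λ z → z ∈ ys₁ ++ ys₂ × R x′ z
  image′ {x′} x′∈ with z , z∈ , c′ ← image (there x′∈) with ∈-++⁻ ys₁ z∈
  ... | inj₁ z∈₁          = z , ∈-++⁺ˡ z∈₁ , c′
  ... | inj₂ (there z∈₂)  = z , ∈-++⁺ʳ ys₁ z∈₂ , c′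
  ... | inj₂ (here refl)  = contradiction (inj (here refl) (there x′∈) z∈ c c′) (All.lookup x∉ x′∈)
  inj′ : ∀ {x₁ x₂ z} → x₁ ∈ xs → x₂ ∈ xs → z ∈ ys₁ ++ ys₂ → R x₁ z → R x₂ z → x₁ ≡ x₂
  inj′ x₁∈ x₂∈ z∈ = inj (there x₁∈) (there x₂∈) (widen z∈)
  count : suc (length (ys₁ ++ ys₂)) ≡ length (ys₁ ++ [ y ] ++ ys₂)
  count = trans (cong suc (length-++ ys₁)) (trans (sym (+-suc (length ys₁) (length ys₂))) (sym (length-++ ys₁)))

length-≡ : ∀ {A B : Set} (R : A → B → Set) xs ys → Unique xs → Unique ys →
           (∀ {x} → x ∈ xs → ∃ λ y → y ∈ ys × R x y) →
           (∀ {y} → y ∈ ys → ∃ λ x → x ∈ xs × R x y) →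
           (∀ {x x′ y} → x ∈ xs → x′ ∈ xs → y ∈ ys → R x y → R x′ y → x ≡ x′) →
           (∀ {x y y′} → x ∈ xs → y ∈ ys → y′ ∈ ys → R x y → R x y′ → y ≡ y′) → length xs ≡ length ys
length-≡ R xs ys uniq uniq′ image image′ inj inj′ = ≤-antisym
  (length-≤ R xs ys uniq image inj)
  (length-≤ (flip R) ys xs uniq′ image′ λ y∈ y′∈ x∈ → inj′ x∈ y∈ y′∈)

concatMap-product : ∀ {A B C : Set} (f : A → B → C) xs ys →
                    concatMap (λ x → map (f x) ys) xs ≡ cartesianProductWith f xs ys
concatMap-product f []       ys = refl
concatMap-product f (x ∷ xs) ys = cong (map (f x) ys ++_) (concatMap-product f xs ys)

allVecs-unique : ∀ {A : Set} {xs : List A} m → Unique xs → Unique (allVecs xs m)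
allVecs-unique zero    uniq = [] ∷ []
allVecs-unique {xs = xs} (suc m) uniq = subst Unique (sym (concatMap-product _∷_ xs (allVecs xs m)))
  (cartesianProductWith⁺ _∷_ ∷-injective uniq (allVecs-unique m uniq))

allVecs-complete : ∀ {A : Set} {xs : List A} → (∀ x → x ∈ xs) → ∀ {m} (v : Vec A m) → v ∈ allVecs xs m
allVecs-complete all []      = here refl
allVecs-complete {xs = xs} all {suc m} (x ∷ v) = subst ((x ∷ v) ∈_) (sym (concatMap-product _∷_ xs (allVecs xs m)))
  (∈-cartesianProductWith⁺ _∷_ (all x) (allVecs-complete all v))

-- Rank jumps

-- The pairs of blocks of a partition in the chain number the sum of the jumps still to come, whence
-- the subtraction from `n`.
ranks : ℕ → List ℕ → List ℕ
ranks n []       = []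
ranks n (u ∷ us) = n ∸ ListAction.sum (u ∷ us) ∷ ranks n us

rankJumps-ranks : ∀ n us → ListAction.sum us ≤ n → rankJumps n (ranks n us) ≡ n ∸ ListAction.sum us ∷ us
rankJumps-ranks n us le = jumps 0 us le
  where
  -- `c` is the rank of the preceding partition, 0 before the first.
  jumps : ∀ c us → ListAction.sum us ≤ n → zipWith _∸_ (ranks n us ++ [ n ]) (c ∷ ranks n us) ≡ n ∸ ListAction.sum us ∸ c ∷ us
  jumps c []       le = refl
  jumps c (u ∷ us) le = cong (n ∸ ListAction.sum (u ∷ us) ∸ c ∷_) (trans
    (jumps (n ∸ ListAction.sum (u ∷ us)) us le′)
    (cong (_∷ us) (difference (n ∸ (u + ListAction.sum us)) (n ∸ ListAction.sum us) (m+[n∸m]≡n le) (m+[n∸m]≡n le′))))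
    where
    le′ : ListAction.sum us ≤ n
    le′ = ≤-trans (m≤n+m (ListAction.sum us) u) le
    difference : ∀ x y → u + ListAction.sum us + x ≡ n → ListAction.sum us + y ≡ n → y ∸ x ≡ u
    difference x y eq eq′ = trans (cong (_∸ x) (lia 5 (λ u s x y n → u :+ s :+ x :≡ n ⇒ s :+ y :≡ n ⇒ ⊢ y :≡ u :+ x)
      u (ListAction.sum us) x y n eq eq′)) (m+n∸n≡m u x)

tailSum : ∀ {ℓ} → Vec ℕ ℓ → Fin ℓ → ℕ
tailSum (u ∷ us) Fin.zero    = u + Vec.sum us
tailSum (u ∷ us) (Fin.suc i) = tailSum us i

sum-toList : ∀ {ℓ} (us : Vec ℕ ℓ) → ListAction.sum (Vec.toList us) ≡ Vec.sum us
sum-toList []       = refl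
sum-toList (u ∷ us) = cong (u +_) (sum-toList us)

ranks-toList : ∀ {A : Set} {ℓ} n (f : A → ℕ) (xs : Vec A ℓ) (us : Vec ℕ ℓ) →
               (∀ i → f (Vec.lookup xs i) ≡ n ∸ tailSum us i) → map f (Vec.toList xs) ≡ ranks n (Vec.toList us)
ranks-toList n f []       []       eq = refl
ranks-toList n f (x ∷ xs) (u ∷ us) eq = cong₂ _∷_
  (trans (eq Fin.zero) (cong (λ s → n ∸ (u + s)) (sym (sum-toList us)))) (ranks-toList n f xs us (eq ∘ Fin.suc))

sum-∑ : ∀ {ℓ} (us : Vec ℕ ℓ) (g : ℕ → ℕ) → (∀ i → Vec.lookup us i ≡ g (toℕ i)) → Vec.sum us ≡ ∑ ℓ g
sum-∑ []       g eq = refl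
sum-∑ (u ∷ us) g eq = cong₂ _+_ (eq Fin.zero) (sum-∑ us (g ∘ suc) (eq ∘ Fin.suc))

tailSum-∑ : ∀ {ℓ} (us : Vec ℕ ℓ) (g : ℕ → ℕ) → (∀ i → Vec.lookup us i ≡ g (toℕ i)) →
            ∀ i → tailSum us i ≡ ∑ (ℓ ∸ toℕ i) (λ x → g (toℕ i + x))
tailSum-∑ (u ∷ us) g eq Fin.zero    = sum-∑ (u ∷ us) g eq
tailSum-∑ (u ∷ us) g eq (Fin.suc i) = tailSum-∑ us (g ∘ suc) (eq ∘ Fin.suc) i

-- Divisibility of unions of blocks

∑-∣ : ∀ d n f → (∀ x → x < n → d ∣ f x) → d ∣ ∑ n f
∑-∣ d zero    f h = d ∣0
∑-∣ d (suc n) f h = ∣m∣n⇒∣m+n (h 0 z<s) (∑-∣ d n (f ∘ suc) λ x x<n → h (suc x) (s<s x<n))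

module _ {M : ℕ} .{{_ : NonZero M}} {r : Rep M} (part : IsSetPartition r) where

  -- Grouping the union by representatives makes every nonempty group a whole block.
  union-divisible : ∀ d {S : Fin M → Set} (S? : ∀ i → Dec (S i)) → (∀ {i j} → SameBlock r i j → S i → S j) →
                    (∀ i → S i → d ∣ blockSize r i) → d ∣ ∑ M (λ x → 𝟙 (S? (at x)))
  union-divisible d {S} S? block h = subst (d ∣_) (sym by-leader) (∑-∣ d M _ λ y y<M → column y y<M (isRepr? r (at y) ×-dec S? (at y)))
    where
    led? : ∀ x y → Dec (S (at x) × toℕ (blk r (at x)) ≡ y)
    led? x y = S? (at x) ×-dec (toℕ (blk r (at x)) ≟ y)
    by-leader : ∑ M (λ x → 𝟙 (S? (at x))) ≡ ∑ M (λ y → ∑ M (λ x → 𝟙 (led? x y)))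
    by-leader = trans (∑-cong M λ x _ → row x (S? (at x))) (∑-swap M M (λ x y → 𝟙 (led? x y)))
      where
      row : ∀ x → Dec (S (at x)) → 𝟙 (S? (at x)) ≡ ∑ M (λ y → 𝟙 (led? x y))
      row x (yes s) = trans (𝟙-yes (S? (at x)) s)
        (sym (∑-𝟙-unique M (led? x) (toℕ<n (blk r (at x))) (s , refl) λ y _ (_ , eq) → sym eq))
      row x (no ¬s) = trans (𝟙-no (S? (at x)) ¬s) (sym (∑-zero M λ y _ → 𝟙-no (led? x y) (¬s ∘ proj₁)))
    column : ∀ y → y < M → Dec (IsRepr r (at y) × S (at y)) → d ∣ ∑ M (λ x → 𝟙 (led? x y))
    column y y<M (yes (repr , s)) = subst (d ∣_)
      (trans (filter-allFin M (λ j → sameBlock? r j (at y))) (∑-cong M λ x _ → 𝟙-cong (sameBlock? r (at x) (at y)) (led? x y)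
        (λ eq → block (sym eq) s , trans (cong toℕ (trans eq repr)) (toℕ-at-< y<M))
        (λ (_ , eq) → trans (toℕ-injective (trans eq (sym (toℕ-at-< y<M)))) (sym repr))))
      (h (at y) s)
    column y y<M (no ¬led) = subst (d ∣_) (sym (∑-zero M λ x _ → 𝟙-no (led? x y) λ (s , eq) →
      let at-y : blk r (at x) ≡ at y
          at-y = toℕ-injective (trans eq (sym (toℕ-at-< y<M)))
      in ¬led (trans (cong (blk r) (sym at-y)) (trans (proj₁ part (at x)) at-y) ,
               block (trans (sym (proj₁ part (at x))) (cong (blk r) at-y)) s))) (d ∣0)

  -- A coarser block is a union of finer ones. So divisibility needs checking only for the first
  -- partition of a multichain.
  coarser-divisible : ∀ d {s : Rep M} → Refines r s → BlocksDivisibleBy r d → BlocksDivisibleBy s d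
  coarser-divisible d {s} ref h i = subst (d ∣_) (sym (filter-allFin M (λ j → sameBlock? s j i)))
    (union-divisible d (λ j → sameBlock? s j i) (λ {j} {j′} eq same → trans (sym (ref j j′ eq)) same) λ j _ → h j)

-- The correspondence between multichains and matrices

module Congruence (N ℓ : ℕ) (N>0 : 0 < N) where
  open Correspondence N ℓ N>0
  open Encoding N ℓ N>0

  dec-cong-≤ : ∀ {a b} (code : Code a) (code′ : Code b) → (∀ p v → a p v ≡ b p v) →
               ∀ j e → Decoding.dec code j e ≤ Decoding.dec code′ j e
  dec-cong-≤ {a} {b} code code′ eq j e = by-cases (m≤n⇒m<n∨m≡n (B.dec-bounded j e))
    where
    module A = Decoding code
    module B = Decoding code′
    present : ∀ {p v} → 0 < b p v → 0 < a p v
    present {p} {v} = subst (0 <_) (sym (eq p v))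
    opened≡ : ∀ p v d → A.opened p v d ≡ B.opened p v d
    opened≡ p v d = cong₂ _+_ (∑-cong (suc v) λ w _ → eq p w) (∑-cong d λ i _ → ∑-cong ℓ λ w _ → eq (p + suc i) w)
    span≡ : ∀ {p v} → 0 < b p v → A.span p v ≡ B.span p v
    span≡ {p} {v} pr = ≤-antisym
      (A.span-≤ p v (≤-trans (≤-reflexive (opened≡ p v (B.span p v))) (B.opened-length pr)))
      (B.span-≤ p v (≤-trans (≤-reflexive (sym (opened≡ p v (A.span p v)))) (A.opened-length (present pr))))
    by-cases : B.dec j e < e + N ⊎ B.dec j e ≡ e + N → A.dec j e ≤ B.dec j e
    by-cases (inj₂ e≡) = ≤-trans (A.dec-bounded j e) (≤-reflexive (sym e≡))
    by-cases (inj₁ c)  =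
      let Decode.covers {p} {v} j≤v pr p≤e closes = B.dec-covers c
      in A.dec-≤ (B.dec j e) j≤v (present pr) p≤e (m≤m+n e _) (trans (cong (p +_) (span≡ pr)) closes)

  dec-cong : ∀ {a b} (code : Code a) (code′ : Code b) → (∀ p v → a p v ≡ b p v) →
             ∀ j e → Decoding.dec code j e ≡ Decoding.dec code′ j e
  dec-cong code code′ eq j e = ≤-antisym (dec-cong-≤ code code′ eq j e) (dec-cong-≤ code′ code (λ p v → sym (eq p v)) j e)

  module _ {L L′ : ℕ → ℕ → ℕ} (eq : ∀ j e → L j e ≡ L′ j e) where

    token-cong : ∀ {p v} → Encode.Token L p v → Encode.Token L′ p v
    token-cong {p} {v} (Encode.token c j f) = Encode.token (subst (_< p + N) (eq v p) c)
      (λ e → j (trans (eq (suc v) p) (trans e (sym (eq v p)))))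
      λ x x< e → f x x< (trans (eq v x) (trans e (cong (_+ N) (sym (eq v p)))))

    owns-cong : ∀ {p v e} → Encode.Owns L p v e → Encode.Owns L′ p v e
    owns-cong {p} {v} {e} (t , o) = token-cong t , trans (sym (eq 0 e)) (trans o (eq v p))

  enc-cong : ∀ {L L′ : ℕ → ℕ → ℕ} → (∀ j e → L j e ≡ L′ j e) → ∀ p v → Encode.enc L p v ≡ Encode.enc L′ p v
  enc-cong {L} {L′} eq p v = ∑-cong N λ i _ → 𝟙-cong (Encode.owns? L p v (p + i)) (Encode.owns? L′ p v (p + i))
    (owns-cong eq) (owns-cong λ j e → sym (eq j e))

-- The one-block partition, standing for the levels from `ℓ` on.
trivialRelation : ∀ N (N>0 : 0 < N) → Periodic.NonCrossingRelation N N>0 (λ _ _ → ⊤)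
trivialRelation N N>0 = record
  { _~?_ = λ _ _ → yes tt ; ~-refl = tt ; ~-sym = id ; ~-trans = λ _ _ → tt
  ; wrap = tt ; shift = id ; noncross = λ _ _ _ _ _ _ → tt }

module Multichains (N M ℓ : ℕ) (N>0 : 0 < N) (M≡N+N : M ≡ N + N) {{_ : NonZero M}} where
  open Correspondence N ℓ N>0
  open Periodic N N>0
  open Lift N M N>0 M≡N+N
  open FamilyChain N ℓ N>0

  lastIn : Rep M → ℕ → ℕ
  lastIn r = lastOf (lifted? r)

  record Multichain (πs : Vec (Rep M) ℓ) : Set where
    field
      partition   : ∀ i → IsSetPartition (lookup πs i)
      noncross    : ∀ i → NonCrossing (lookup πs i)
      rotation    : ∀ i x y → SameBlock (lookup πs i) x y → SameBlock (lookup πs i) (rotate N x) (rotate N y)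
      refinement  : ∀ i j → suc (toℕ i) ≡ toℕ j → Refines (lookup πs i) (lookup πs j)

  module Lasts {πs : Vec (Rep M) ℓ} (mc : Multichain πs) where
    open Multichain mc

    liftedAt : ∀ i → NonCrossingRelation (Lifted (lookup πs i))
    liftedAt i = liftedRelation {lookup πs i} (noncross i) (rotation i)

    refines-≤ : ∀ m {i j} → toℕ i + m ≡ toℕ j → Refines (lookup πs i) (lookup πs j)
    refines-≤ zero {i} {j} eq x y same =
      subst (λ j → SameBlock (lookup πs j) x y) (toℕ-injective (trans (sym (+-identityʳ (toℕ i))) eq)) same
    refines-≤ (suc m) {i} {j} eq x y same = refines-≤ m {fromℕ< 1+i<ℓ} {j}
      (trans (cong (_+ m) (toℕ-fromℕ< 1+i<ℓ)) eq′) x y (refinement i (fromℕ< 1+i<ℓ) (sym (toℕ-fromℕ< 1+i<ℓ)) x y same)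
      where
      eq′ : suc (toℕ i) + m ≡ toℕ j
      eq′ = trans (sym (+-suc (toℕ i) m)) eq
      1+i<ℓ : suc (toℕ i) < ℓ
      1+i<ℓ = ≤-<-trans (≤-trans (m≤m+n _ m) (≤-reflexive eq′)) (toℕ<n j)

    Level : ∀ {j} → Dec (j < ℓ) → ℕ → ℕ → Set
    Level (yes j<ℓ) = Lifted (lookup πs (fromℕ< j<ℓ))
    Level (no _)    = λ _ _ → ⊤

    levelRelation : ∀ {j} (d : Dec (j < ℓ)) → NonCrossingRelation (Level d)
    levelRelation (yes j<ℓ) = liftedAt (fromℕ< j<ℓ)
    levelRelation (no _)    = trivialRelation N N>0

    level-mono : ∀ {i j e f} (d : Dec (i < ℓ)) (d′ : Dec (j < ℓ)) → i ≤ j → Level d e f → Level d′ e f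
    level-mono d         (no _)    i≤j _ = tt
    level-mono (no i≮ℓ)  (yes j<ℓ) i≤j _ = contradiction (≤-<-trans i≤j j<ℓ) i≮ℓ
    level-mono {i} {j} {e} {f} (yes i<ℓ) (yes j<ℓ) i≤j same =
      refines-≤ (j ∸ i) (trans (cong (_+ (j ∸ i)) (toℕ-fromℕ< i<ℓ)) (trans (m+[n∸m]≡n i≤j) (sym (toℕ-fromℕ< j<ℓ))))
        (at e) (at f) same

    level-top : ∀ {j e} (d : Dec (j < ℓ)) → ℓ ≤ j → Level d e (e + N)
    level-top (yes j<ℓ) ℓ≤j = contradiction ℓ≤j (<⇒≱ j<ℓ)
    level-top (no _)    ℓ≤j = tt

    last : ℕ → ℕ → ℕ
    last j = RelationLast.last (levelRelation (j <? ℓ))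

    lastChain : LastChain last
    lastChain = family-chain (λ j → levelRelation (j <? ℓ)) (λ {i} {j} → level-mono (i <? ℓ) (j <? ℓ)) (λ {j} → level-top (j <? ℓ))

    last-at : ∀ i e → last (toℕ i) e ≡ lastIn (lookup πs i) e
    last-at i e = by-cases (toℕ i <? ℓ)
      where
      by-cases : (d : Dec (toℕ i < ℓ)) → RelationLast.last (levelRelation d) e ≡ lastIn (lookup πs i) e
      by-cases (yes i<ℓ) = cong (λ i → lastIn (lookup πs i) e) (fromℕ<-toℕ i i<ℓ)
      by-cases (no i≮ℓ)  = contradiction (toℕ<n i) i≮ℓ

  same-lasts : ∀ {r s : Rep M} (rel : NonCrossingRelation (Lifted r)) (rel′ : NonCrossingRelation (Lifted s)) →
               (∀ e → RelationLast.last rel e ≡ RelationLast.last rel′ e) → ∀ i j → SameBlock r i j → SameBlock s i j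
  same-lasts {r} {s} rel rel′ eq i j same = [ forward i j same , (λ le → sym (forward j i (sym same) le)) ]′ (≤-total (toℕ i) (toℕ j))
    where
    forward : ∀ i j → SameBlock r i j → toℕ i ≤ toℕ j → SameBlock s i j
    forward i j same le = subst₂ (SameBlock s) (at-toℕ i) (at-toℕ j) (related-by-last rel rel′ eq le
      (<-≤-trans (toℕ<n j) (≤-trans (m≤n+m M (toℕ i)) (≤-reflexive (trans (cong (toℕ i +_) M≡N+N) (sym (+-assoc (toℕ i) N N))))))
      (subst₂ (SameBlock r) (sym (at-toℕ i)) (sym (at-toℕ j)) same))

  -- Last elements determine the relations, and taking least elements as representatives makes the
  -- vectors canonical.
  multichain-unique : ∀ {πs πs′} → Multichain πs → Multichain πs′ →
                      (∀ i e → lastIn (lookup πs i) e ≡ lastIn (lookup πs′ i) e) → πs ≡ πs′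
  multichain-unique {πs} {πs′} mc mc′ eq = lookup-ext λ i → rep-unique (Multichain.partition mc i) (Multichain.partition mc′ i)
    (same-lasts {lookup πs i} {lookup πs′ i} (Lasts.liftedAt mc i) (Lasts.liftedAt mc′ i) (eq i))
    (same-lasts {lookup πs′ i} {lookup πs i} (Lasts.liftedAt mc′ i) (Lasts.liftedAt mc i) (λ e → sym (eq i e)))

  module FromChain {L : ℕ → ℕ → ℕ} (chain : LastChain L) where
    open Keys N M ℓ N>0 M≡N+N
    open LastKeys chain

    partitionAt : ℕ → Rep M
    partitionAt j = FromKey.rep M (key j)

    partitions : Vec (Rep M) ℓ
    partitions = tabulate (partitionAt ∘ toℕ)

    key-at : ∀ j x → key j (toℕ (at {M} x)) ≡ key j x
    key-at j x = trans (cong (key j) (toℕ-at x)) (sym (key-% j x))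

    lifted⇒key : ∀ {j e f} → Lifted (partitionAt j) e f → key j e ≡ key j f
    lifted⇒key {j} {e} {f} same = trans (sym (key-at j e)) (trans (FromKey.same⇒key M (key j) same) (key-at j f))

    key⇒lifted : ∀ {j e f} → key j e ≡ key j f → Lifted (partitionAt j) e f
    key⇒lifted {j} {e} {f} eq = FromKey.key⇒same M (key j) (trans (key-at j e) (trans eq (sym (key-at j f))))

    relationAt : ∀ j → NonCrossingRelation (Lifted (partitionAt j))
    relationAt j = record
      { _~?_     = lifted? (partitionAt j)
      ; ~-refl   = refl
      ; ~-sym    = sym
      ; ~-trans  = trans
      ; wrap     = λ {e} → key⇒lifted {j} {e} (K.wrap {e})
      ; shift    = λ {e} {f} s → key⇒lifted {j} {e + N} {f + N} (K.shift (lifted⇒key {j} {e} {f} s))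
      ; noncross = λ {a} {b} {c} {d} a<b b<c c<d d< ac bd → key⇒lifted {j} {a} {b}
          (K.noncross a<b b<c c<d d< (lifted⇒key {j} {a} {c} ac) (lifted⇒key {j} {b} {d} bd))
      }
      where module K = NonCrossingRelation (keyRelation j)

    at-level : (P : Rep M → Set) → (∀ j → P (partitionAt j)) → ∀ i → P (lookup partitions i)
    at-level P p i = subst P (sym (lookup∘tabulate (partitionAt ∘ toℕ) i)) (p (toℕ i))

    Invariant : Rep M → Set
    Invariant r = ∀ x y → (SameBlock r x y → SameBlock r (rotate N x) (rotate N y)) ×
                          (SameBlock r (rotate N x) (rotate N y) → SameBlock r x y)

    invariantAt : ∀ i → Invariant (lookup partitions i)
    invariantAt = at-level Invariant λ j → invariant {partitionAt j} (relationAt j)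

    multichain : Multichain partitions
    multichain = record
      { partition  = at-level IsSetPartition λ j → FromKey.rep-partition M (key j)
      ; noncross   = at-level NonCrossing λ j → noncrossing {partitionAt j} (relationAt j)
      ; rotation   = λ i x y → proj₁ (invariantAt i x y)
      ; refinement = λ i i′ eq → subst₂ Refines (sym (lookup∘tabulate (partitionAt ∘ toℕ) i)) (sym (lookup∘tabulate (partitionAt ∘ toℕ) i′))
          λ x y same → FromKey.key⇒same M (key (toℕ i′)) (key-coarser (≤-trans (n≤1+n _) (≤-reflexive eq)) (FromKey.same⇒key M (key (toℕ i)) same))
      }

    lastIn-partitions : ∀ i e → lastIn (lookup partitions i) e ≡ L (toℕ i) e
    lastIn-partitions i e = trans (cong (λ r → lastIn r e) (lookup∘tabulate (partitionAt ∘ toℕ) i)) (trans same (key-recovers (toℕ i) e))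
      where
      j : ℕ
      j = toℕ i
      same : lastIn (partitionAt j) e ≡ RelationLast.last (keyRelation j) e
      same = ≤-antisym
        (last-monotone (relationAt j) (keyRelation j) (λ {e} {f} → lifted⇒key {j} {e} {f}) e)
        (last-monotone (keyRelation j) (relationAt j) (λ {e} {f} → key⇒lifted {j} {e} {f}) e)

-- Matrices as functions of position and level

module Cells {n ℓ : ℕ} (N : ℕ) .{{_ : NonZero N}} (V : Vec (Row n N) ℓ) where

  cellAt : ∀ {v} → Dec (v < ℓ) → ℕ → ℕ
  cellAt (yes v<ℓ) p = toℕ (lookup (lookup V (fromℕ< v<ℓ)) (at p))
  cellAt (no _)    p = 0

  abstract

    cell : ℕ → ℕ → ℕ
    cell p v = cellAt (v <? ℓ) p

    cell-lookup : ∀ q i → cell (toℕ q) (toℕ i) ≡ toℕ (lookup (lookup V i) q)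
    cell-lookup q i = by-cases (toℕ i <? ℓ)
      where
      by-cases : (d : Dec (toℕ i < ℓ)) → cellAt d (toℕ q) ≡ toℕ (lookup (lookup V i) q)
      by-cases (yes i<ℓ) = cong₂ (λ i q → toℕ (lookup (lookup V i) q)) (fromℕ<-toℕ i i<ℓ) (at-toℕ q)
      by-cases (no i≮ℓ)  = contradiction (toℕ<n i) i≮ℓ

    cell-+N : ∀ p v → cell (p + N) v ≡ cell p v
    cell-+N p v = by-cases (v <? ℓ)
      where
      by-cases : (d : Dec (v < ℓ)) → cellAt d (p + N) ≡ cellAt d p
      by-cases (yes v<ℓ) = cong (λ q → toℕ (lookup (lookup V (fromℕ< v<ℓ)) q)) (at-+M p)
      by-cases (no _)    = refl

    cell-top : ∀ {v} p → ℓ ≤ v → cell p v ≡ 0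
    cell-top {v} p ℓ≤v = by-cases (v <? ℓ)
      where
      by-cases : (d : Dec (v < ℓ)) → cellAt d p ≡ 0
      by-cases (yes v<ℓ) = contradiction ℓ≤v (<⇒≱ v<ℓ)
      by-cases (no _)    = refl

  rowTotal-∑ : ∀ w i (g : ℕ → ℕ) → (∀ x → onCell w x ≡ g (toℕ x)) →
               rowTotal w (lookup V i) ≡ ∑ N (λ p → g (cell p (toℕ i)))
  rowTotal-∑ w i g eq = sum-map-∑ (onCell w) (lookup V i) (λ p → g (cell p (toℕ i)))
    λ q → trans (eq (lookup (lookup V i) q)) (cong g (sym (cell-lookup q i)))

  total-∑ : ∀ w (g : ℕ → ℕ) → (∀ x → onCell w x ≡ g (toℕ x)) →
            total w V ≡ ∑ ℓ (λ v → ∑ N (λ p → g (cell p v)))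
  total-∑ w g eq = sum-map-∑ (rowTotal w) V _ λ i → rowTotal-∑ w i g eq

-- Ranks, types and block sizes read off the matrix

module Main (n k ℓ : ℕ) (k>0 : 0 < k) where

  N M : ℕ
  N = 2 * k * n + k
  M = Mof k n

  N>0 : 0 < N
  N>0 = ≤-trans k>0 (m≤n+m k (2 * k * n))

  M≡N+N : M ≡ N + N
  M≡N+N = halves k n
    where
    halves : ∀ k n → 2 * k * (2 * n + 1) ≡ 2 * k * n + k + (2 * k * n + k)
    halves = solve-∀

  instance
    N≢0 : NonZero N
    N≢0 = >-nonZero N>0
    M≢0 : NonZero M
    M≢0 = >-nonZero (≤-trans N>0 (≤-trans (m≤m+n N N) (≤-reflexive (sym M≡N+N))))
    2k≢0 : NonZero (2 * k)
    2k≢0 = >-nonZero (≤-trans k>0 (m≤m+n k (k + 0)))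

  open Correspondence N ℓ N>0
  open Encoding N ℓ N>0
  open RoundTrips N ℓ N>0
  open Congruence N ℓ N>0
  open TokenCounts N ℓ N>0
  open Periodic N N>0
  open Lift N M N>0 M≡N+N
  open Multichains N M ℓ N>0 M≡N+N
  open Representatives N M N>0 M≡N+N
  open BlockSizes N M ℓ N>0 M≡N+N

  Matrix : Set
  Matrix = Vec (Row n N) ℓ

  open Cells {n} {ℓ} N using (cell; cell-lookup; cell-+N; cell-top; rowTotal-∑; total-∑)

  weight : Matrix → ℕ → ℕ → ℕ
  weight V p v = 2 * k * cell V p v

  -- The indices of the labels placed sum to at most `weightedSum bs ≤ n`, so the labels total at
  -- most `2 * k * n ≤ N`.
  weight-code : ∀ V t (bs : Vec ℕ n) {cs} → weightedSum bs ≤ n → fill V t bs ≡ just cs → Code (weight V)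
  weight-code V t bs {cs} bounded eq = record
    { periodic = λ p v → cong (2 * k *_) (cell-+N V p v)
    ; top      = λ p ℓ≤v → trans (cong (2 * k *_) (cell-top V p ℓ≤v)) (*-zeroʳ (2 * k))
    ; light    = begin
        ∑ N (λ p → ∑ ℓ (λ v → 2 * k * cell V p v))      ≡⟨ ∑-swap N ℓ (λ p v → 2 * k * cell V p v) ⟩
        ∑ ℓ (λ v → ∑ N (λ p → 2 * k * cell V p v))      ≡⟨ ∑-cong ℓ (λ v _ → ∑-* N (2 * k) (λ p → cell V p v)) ⟩
        ∑ ℓ (λ v → 2 * k * ∑ N (λ p → cell V p v))      ≡⟨ ∑-* ℓ (2 * k) (λ v → ∑ N (λ p → cell V p v)) ⟩
        2 * k * ∑ ℓ (λ v → ∑ N (λ p → cell V p v))      ≡⟨ cong (2 * k *_) (total-∑ V (λ m → 1 + toℕ m) id value) ⟨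
        2 * k * total (λ m → 1 + toℕ m) V               ≤⟨ *-monoʳ-≤ (2 * k) (m≤m+n _ (weighted 1 cs)) ⟩
        2 * k * (total (λ m → 1 + toℕ m) V + weighted 1 cs)
          ≡⟨ cong (2 * k *_) (trans (weightedSum≡ bs) (fill-additive (weighted-additive 1) V t bs eq)) ⟨
        2 * k * weightedSum bs                          ≤⟨ *-monoʳ-≤ (2 * k) bounded ⟩
        2 * k * n                                       ≤⟨ m≤m+n (2 * k * n) k ⟩
        N                                               ∎
    }
    where
    open ≤-Reasoning
    value : ∀ (x : Fin (suc n)) → onCell (λ m → 1 + toℕ m) x ≡ toℕ x
    value Fin.zero    = refl
    value (Fin.suc m) = refl

  module Statistics {πs : Vec (Rep M) ℓ} (mc : Multichain πs) (V : Matrix)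
                    (coded : ∀ p v → Encode.enc (Lasts.last mc) p v ≡ weight V p v) where
    open Multichain mc
    open Lasts mc
    open EncodingOf lastChain

    token⇒cell : ∀ {p v} → Token p v → 0 < cell V p v
    token⇒cell {p} {v} t = n≢0⇒n>0 λ eq → <⇒≢ (token⇒present t) (sym (trans (coded p v)
      (trans (cong (2 * k *_) eq) (*-zeroʳ (2 * k)))))

    cell⇒token : ∀ {p v} → 0 < cell V p v → Token p v
    cell⇒token {p} {v} pos = present⇒token (≤-trans (*-mono-≤ (≤-trans k>0 (m≤m+n k (k + 0))) pos) (≤-reflexive (sym (coded p v))))

    lookup-supports : ∀ i → lookup (supports V) i ≡ ∑ N (λ p → 𝟙 (0 <? cell V p (toℕ i)))
    lookup-supports i = trans (lookup-map i (rowTotal λ _ → 1) V) (rowTotal-∑ V (λ _ → 1) i (λ x → 𝟙 (0 <? x)) nonempty)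
      where
      nonempty : ∀ (x : Fin (suc n)) → onCell (λ _ → 1) x ≡ 𝟙 (0 <? toℕ x)
      nonempty Fin.zero    = refl
      nonempty (Fin.suc m) = refl

    -- Each pair has one end below `N`, and modulo `N` an end in partition `i` is the end of exactly
    -- one token of level at least `i`, that is of one nonempty cell in the rows from `i` on.
    numPairs≡ : ∀ i → numPairs k n (lookup πs i) ≡ tailSum (supports V) i
    numPairs≡ i = begin
      numPairs k n r
        ≡⟨ cong (_/ 2) (trans (filter-allFin M (nonFixedRepr? k n r)) (trans
             (∑-cong M λ x _ → 𝟙-cong (nonFixedRepr? k n r (at x)) (nonFixed? r (at x) ×-dec yes tt) (_, tt) proj₁)
             (sym (filter-allFin M (λ i → nonFixed? r i ×-dec yes tt))))) ⟩
      length (filter (λ i → nonFixed? r i ×-dec yes tt) (allFin M)) / 2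
        ≡⟨ count-pairs {r} (partition i) (liftedAt i) (λ _ → yes tt) _ _ ⟩
      ∑ N (λ y → 𝟙 ((lastIn r y ≟ y) ×-dec yes tt))
        ≡⟨ ∑-cong N (λ y _ → cong (λ l → 𝟙 ((l ≟ y) ×-dec yes tt)) (sym (last-at i y))) ⟩
      ∑ N (λ y → 𝟙 ((last (toℕ i) y ≟ y) ×-dec yes tt))
        ≡⟨ ends-from lastChain (λ _ → yes tt) _ _ (ℓ ∸ toℕ i) (toℕ i) (m+[n∸m]≡n (<⇒≤ (toℕ<n i))) ⟩
      ∑ (ℓ ∸ toℕ i) (λ v → ∑ N (λ p → 𝟙 (token? p (toℕ i + v) ×-dec yes tt)))
        ≡⟨ ∑-cong (ℓ ∸ toℕ i) (λ v _ → ∑-cong N λ p _ → 𝟙-cong (token? p (toℕ i + v) ×-dec yes tt) (0 <? cell V p (toℕ i + v))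
             (token⇒cell ∘ proj₁) (λ pos → cell⇒token pos , tt)) ⟩
      ∑ (ℓ ∸ toℕ i) (λ v → ∑ N (λ p → 𝟙 (0 <? cell V p (toℕ i + v))))
        ≡⟨ tailSum-∑ (supports V) (λ v → ∑ N (λ p → 𝟙 (0 <? cell V p v))) lookup-supports i ⟨
      tailSum (supports V) i ∎
      where
      open ≡-Reasoning
      r : Rep M
      r = lookup πs i

    module _ (i : Fin ℓ) (i≡0 : toℕ i ≡ 0) where

      private
        r : Rep M
        r = lookup πs i

      first-last : ∀ e → lastIn r e ≡ last 0 e
      first-last e = trans (sym (last-at i e)) (cong (λ j → last j e) i≡0)

      size-weight : ∀ {p v} → Token p v → blockSize r (at (last v p)) ≡ weight V p v
      size-weight {p} {v} t = trans (blockSize-token {r} (liftedAt i) lastChain first-last t) (coded p v)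

      -- The count of ends is restricted to blocks of a given size in the first partition; by
      -- `blockSize-token` that size is the label of the cell.
      typeCount≡ : ∀ m → typeCount k n r (suc (toℕ m)) ≡ total (is m) V
      typeCount≡ m = begin
        typeCount k n r (suc (toℕ m))
          ≡⟨ count-pairs {r} (partition i) (liftedAt i) Q? (λ {x} {y} eq q → trans (sym (blockSize-block {r} (liftedAt i) {x} {y} eq)) q)
               (λ {x} q → trans (blockSize-shift {r} (liftedAt i) x) q) ⟩
        ∑ N (λ y → 𝟙 ((lastIn r y ≟ y) ×-dec Q? (at y)))
          ≡⟨ ∑-cong N (λ y _ → cong (λ l → 𝟙 ((l ≟ y) ×-dec Q? (at y))) (first-last y)) ⟩
        ∑ N (λ y → 𝟙 ((last 0 y ≟ y) ×-dec Q? (at y)))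
          ≡⟨ ends-from lastChain (λ y → Q? (at y)) (λ {y} q → trans (blockSize-shift {r} (liftedAt i) y) q)
               (λ {y} q → trans (sym (blockSize-shift {r} (liftedAt i) y)) q) ℓ 0 refl ⟩
        ∑ ℓ (λ v → ∑ N (λ p → 𝟙 (token? p v ×-dec Q? (at (last v p)))))
          ≡⟨ ∑-cong ℓ (λ v _ → ∑-cong N λ p _ → 𝟙-cong (token? p v ×-dec Q? (at (last v p))) (cell V p v ≟ suc (toℕ m))
               (λ (t , q) → *-cancelˡ-≡ (cell V p v) (suc (toℕ m)) (2 * k) (trans (sym (size-weight t)) q))
               (λ eq → let t = cell⇒token (≤-trans z<s (≤-reflexive (sym eq))) in t , trans (size-weight t) (cong (2 * k *_) eq))) ⟩
        ∑ ℓ (λ v → ∑ N (λ p → 𝟙 (cell V p v ≟ suc (toℕ m))))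
          ≡⟨ total-∑ V (is m) (λ x → 𝟙 (x ≟ suc (toℕ m))) indicator ⟨
        total (is m) V ∎
        where
        open ≡-Reasoning
        Q? : ∀ x → Dec (blockSize r x ≡ 2 * k * suc (toℕ m))
        Q? x = blockSize r x ≟ 2 * k * suc (toℕ m)
        indicator : ∀ (x : Fin (suc n)) → onCell (is m) x ≡ 𝟙 (toℕ x ≟ suc (toℕ m))
        indicator Fin.zero     = refl
        indicator (Fin.suc m′) = 𝟙-cong (toℕ m′ ≟ toℕ m) (suc (toℕ m′) ≟ suc (toℕ m)) (cong suc) suc-injective

      -- A block other than its rotation has a token, whose label, a multiple of `2 * k`, is its
      -- size. The element is first moved up by `N`, as `owner` requires.
      closed-size : ∀ x → ¬ SameBlock r (rotate N x) x → 2 * k ∣ blockSize r x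
      closed-size x nf = subst (2 * k ∣_) (trans (sym (size-weight t)) (trans (cong (λ l → blockSize r (at l)) end)
            (trans (blockSize-block {r} (liftedAt i) (sym (RelationLast.last-related (liftedAt i) e)))
              (trans (blockSize-shift {r} (liftedAt i) (toℕ x)) (cong (blockSize r) (at-toℕ x))))))
          (m∣m*n (cell V p v))
        where
        e : ℕ
        e = toℕ x + N
        nonzero-e : ¬ Lifted r e (e + N)
        nonzero-e z = nf (trans (cong (blk r) (trans (cong (rotate N) (sym (at-toℕ x))) (rotate-at N (toℕ x))))
          (trans z (cong (blk r) (trans (at-+2N (toℕ x)) (at-toℕ x)))))
        closed : last 0 e < e + N
        closed = subst (_< e + N) (first-last e) (lastOf< (lifted? r) nonzero-e)
        own : ∃₂ λ p v → Owns p v e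
        own = owner (m≤n+m N (toℕ x)) closed
        p v : ℕ
        p = proj₁ own
        v = proj₁ (proj₂ own)
        t : Token p v
        t = proj₁ (proj₂ (proj₂ own))
        end : last v p ≡ lastIn r e
        end = trans (sym (proj₂ (proj₂ (proj₂ own)))) (sym (first-last e))

      -- No label records the invariant block; its size is what the other blocks leave of
      -- `M = 2 * k * (2 * n + 1)`, a difference of multiples of `2 * k`.
      divisible : BlocksDivisibleBy r (2 * k)
      divisible x = by-cases (sameBlock? r (rotate N x) x)
        where
        open RelationLast (liftedAt i) using (zero-unique; zero-transport)
        Z : Fin M → Set
        Z y = SameBlock r (rotate N y) y
        Z? : ∀ y → Dec (Z y)
        Z? y = sameBlock? r (rotate N y) y
        Z-block : ∀ {y y′} → SameBlock r y y′ → Z y → Z y′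
        Z-block {y} {y′} eq z = trans (sym (rotation i y y′ eq)) (trans z eq)
        zero-lift : ∀ {y} → Z y → Lifted r (toℕ y) (toℕ y + N)
        zero-lift {y} z = sym (subst₂ (SameBlock r)
          (trans (cong (rotate N) (sym (at-toℕ y))) (rotate-at N (toℕ y))) (sym (at-toℕ y)) z)
        same-zero : ∀ {y y′} → Z y → Z y′ → SameBlock r y y′
        same-zero {y} {y′} z z′ = [ forward z z′ , (λ le → sym (forward z′ z le)) ]′ (≤-total (toℕ y) (toℕ y′))
          where
          forward : ∀ {y y′} → Z y → Z y′ → toℕ y ≤ toℕ y′ → SameBlock r y y′
          forward {y} {y′} z z′ le = subst₂ (SameBlock r) (at-toℕ y) (at-toℕ y′)
            (zero-unique (zero-lift z) (zero-lift z′) le (<-≤-trans (toℕ<n y′) (≤-trans (m≤n+m M (toℕ y))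
              (≤-reflexive (trans (cong (toℕ y +_) M≡N+N) (sym (+-assoc (toℕ y) N N)))))))
        whole : ∑ M (λ y → 𝟙 (¬? (Z? (at y)))) + ∑ M (λ y → 𝟙 (Z? (at y))) ≡ M
        whole = trans (sym (∑-+ M (λ y → 𝟙 (¬? (Z? (at y)))) (λ y → 𝟙 (Z? (at y)))))
          (∑-one M λ y _ → one (Z? (at y)))
          where
          one : ∀ {A : Set} (d : Dec A) → 𝟙 (¬? d) + 𝟙 d ≡ 1
          one (yes _) = refl
          one (no _)  = refl
        zero-part : 2 * k ∣ ∑ M (λ y → 𝟙 (Z? (at y)))
        zero-part = ∣m+n∣m⇒∣n (subst (2 * k ∣_) (sym whole) (m∣m*n (2 * n + 1)))
          (union-divisible {r = r} (partition i) (2 * k) (λ y → ¬? (Z? y)) (λ {y} {y′} eq ¬z z → ¬z (Z-block {y′} {y} (sym eq) z)) closed-size)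
        by-cases : Dec (Z x) → 2 * k ∣ blockSize r x
        by-cases (no ¬z) = closed-size x ¬z
        by-cases (yes z) = subst (2 * k ∣_) (sym (trans (filter-allFin M (λ j → sameBlock? r j x))
          (∑-cong M λ y _ → 𝟙-cong (sameBlock? r (at y) x) (Z? (at y)) (λ eq → Z-block (sym eq) z) (λ z′ → same-zero z′ z)))) zero-part

    all-divisible : ∀ i₀ → toℕ i₀ ≡ 0 → ∀ i → BlocksDivisibleBy (lookup πs i) (2 * k)
    all-divisible i₀ eq i = coarser-divisible {r = lookup πs i₀} (partition i₀) (2 * k) {lookup πs i}
      (refines-≤ (toℕ i) (cong (_+ toℕ i) eq)) (divisible i₀ eq)

toList-unique : ∀ {A : Set} {n} (xs ys : Vec A n) → toList xs ≡ toList ys → xs ≡ ys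
toList-unique []       []       eq = refl
toList-unique (x ∷ xs) (y ∷ ys) eq = cong₂ _∷_ (∷-injectiveˡ eq) (toList-unique xs ys (∷-injectiveʳ eq))

is-just⇒∃ : ∀ {A : Set} {m : Maybe A} → Is-just m → ∃ λ x → m ≡ just x
is-just⇒∃ {m = just x} _ = x , refl

∃⇒is-just : ∀ {A : Set} {m : Maybe A} {x} → m ≡ just x → Is-just m
∃⇒is-just refl = just tt

-- The bijection for prescribed type and rank jumps

module Bijection (n k ℓ : ℕ) (k>0 : 0 < k) (ℓ>0 : 0 < ℓ) (bs : Vec ℕ n) (t : Vec ℕ ℓ)
                 (light : weightedSum bs ≤ n) (balanced : sum bs ≡ sum t) where

  open Main n k ℓ k>0
  open Correspondence N ℓ N>0
  open Encoding N ℓ N>0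
  open RoundTrips N ℓ N>0
  open Congruence N ℓ N>0
  open Periodic N N>0
  open Lift N M N>0 M≡N+N
  open Multichains N M ℓ N>0 M≡N+N
  open BlockSizes N M ℓ N>0 M≡N+N
  open Cells {n} {ℓ} N using (cell; cell-lookup; cell-+N; cell-top)

  s : Vec ℕ (suc ℓ)
  s = (n ∸ sum bs) ∷ t

  i₀ : Fin ℓ
  i₀ = fromℕ< ℓ>0

  i₀≡0 : toℕ i₀ ≡ 0
  i₀≡0 = toℕ-fromℕ< ℓ>0

  sum≤n : sum bs ≤ n
  sum≤n = ≤-trans (sum≤weighted 0 bs) (≤-trans (≤-reflexive (sym (weightedSum≡ bs))) light)

  Fills : Matrix → Set
  Fills V = ∃ λ cs → fill V t bs ≡ just cs

  code-of : ∀ {V} → Fills V → Code (weight V)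
  code-of {V} (_ , eq) = weight-code V t bs light eq

  -- Quantifying over the witness that `weight V` is a code makes this a relation between plain
  -- vectors; for the matrices that are counted, `code-of` provides one.
  Matches : Vec (Rep M) ℓ → Matrix → Set
  Matches πs V = (code : Code (weight V)) → ∀ i e → lastIn (lookup πs i) e ≡ Decoding.dec code (toℕ i) e

  multichain-of : ∀ {πs} → IsMultichain k n ℓ πs → Multichain πs
  multichain-of (valid , ref) = record
    { partition  = λ i → proj₁ (valid i)
    ; noncross   = λ i → proj₁ (proj₂ (valid i))
    ; rotation   = λ i x y → proj₁ (proj₂ (proj₂ (proj₂ (valid i))) x y)
    ; refinement = ref
    }

  last≡dec : ∀ {πs V} (mc : Multichain πs) (code : Code (weight V)) →
             (∀ i e → lastIn (lookup πs i) e ≡ Decoding.dec code (toℕ i) e) → ∀ j e → Lasts.last mc j e ≡ Decoding.dec code j e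
  last≡dec mc code matches j e = by-cases (j <? ℓ)
    where
    by-cases : Dec (j < ℓ) → Lasts.last mc j e ≡ Decoding.dec code j e
    by-cases (yes j<ℓ) = subst (λ j → Lasts.last mc j e ≡ Decoding.dec code j e) (toℕ-fromℕ< j<ℓ)
      (trans (Lasts.last-at mc (fromℕ< j<ℓ) e) (matches (fromℕ< j<ℓ) e))
    by-cases (no j≮ℓ)  = trans (LastChain.top (Lasts.lastChain mc) e (≮⇒≥ j≮ℓ))
      (sym (LastChain.top (Decoding.lastChain code) e (≮⇒≥ j≮ℓ)))

  rank-jumps : ∀ {πs V} (mc : Multichain πs) → (∀ p v → Encode.enc (Lasts.last mc) p v ≡ weight V p v) →
               sum (supports V) ≤ n → multichainRankJumps k n ℓ πs ≡ n ∸ sum (supports V) ∷ toList (supports V)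
  rank-jumps {πs} {V} mc coded le = begin
    rankJumps n (map (rank k n) (toList πs))
      ≡⟨ cong (rankJumps n) (ranks-toList n (rank k n) πs (supports V) λ i → cong (n ∸_) (Statistics.numPairs≡ mc V coded i)) ⟩
    rankJumps n (ranks n (toList (supports V)))
      ≡⟨ rankJumps-ranks n (toList (supports V)) (≤-trans (≤-reflexive (sum-toList (supports V))) le) ⟩
    n ∸ List.foldr _+_ 0 (toList (supports V)) ∷ toList (supports V)
      ≡⟨ cong (λ z → n ∸ z ∷ toList (supports V)) (sum-toList (supports V)) ⟩
    n ∸ sum (supports V) ∷ toList (supports V) ∎
    where open ≡-Reasoning

  module Encoded {πs : Vec (Rep M) ℓ} (counted : Counted k n ℓ (sum bs) bs s πs) where

    mc : Multichain πs
    mc = multichain-of (proj₁ counted)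

    open Lasts mc
    open EncodingOf lastChain

    enc-divisible : ∀ p v → 2 * k ∣ enc p v
    enc-divisible p v = by-cases (token? p v)
      where
      by-cases : Dec (Token p v) → 2 * k ∣ enc p v
      by-cases (yes tk) = subst (2 * k ∣_)
        (blockSize-token {lookup πs i₀} (liftedAt i₀) lastChain (λ e → trans (sym (last-at i₀ e)) (cong (λ j → last j e) i₀≡0)) tk)
        (proj₁ (proj₂ (proj₂ (proj₁ (proj₁ counted) i₀))) (at (last v p)))
      by-cases (no ¬tk) = subst (2 * k ∣_) (sym (n<1⇒n≡0 (≰⇒> (¬tk ∘ present⇒token)))) ((2 * k) ∣0)

    entry< : ∀ p v → enc p v / (2 * k) < suc n
    entry< p v = m<n*o⇒m/o<n (begin-strict
      enc p v                      ≤⟨ ∑-mono N (λ i _ → 𝟙≤1 (owns? p v (p + i))) ⟩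
      ∑ N (λ _ → 1)                ≡⟨ ∑-one N (λ _ _ → refl) ⟩
      -- A label is at most `N`, which falls short of `2 * k * (n + 1)` by `k`; so its index is at
      -- most `n`.
      2 * k * n + k                <⟨ +-monoʳ-< (2 * k * n) (m<m+n k (≤-trans k>0 (m≤m+n k 0))) ⟩
      2 * k * n + 2 * k            ≡⟨ +-comm (2 * k * n) (2 * k) ⟩
      2 * k + 2 * k * n            ≡⟨ cong (2 * k +_) (*-comm (2 * k) n) ⟩
      suc n * (2 * k)              ∎)
      where open ≤-Reasoning

    matrix : Matrix
    matrix = tabulate λ i → tabulate λ q → fromℕ< (entry< (toℕ q) (toℕ i))

    matrix-entry : ∀ i q → toℕ (lookup (lookup matrix i) q) ≡ enc (toℕ q) (toℕ i) / (2 * k)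
    matrix-entry i q = trans (cong toℕ (trans (cong (λ row → lookup row q) (lookup∘tabulate _ i)) (lookup∘tabulate _ q)))
      (toℕ-fromℕ< (entry< (toℕ q) (toℕ i)))

    coded : ∀ p v → enc p v ≡ weight matrix p v
    coded p v = by-cases (v <? ℓ)
      where
      open ≡-Reasoning
      by-cases : Dec (v < ℓ) → enc p v ≡ weight matrix p v
      by-cases (no v≮ℓ) = trans (enc-top p (≮⇒≥ v≮ℓ))
        (sym (trans (cong (2 * k *_) (cell-top matrix p (≮⇒≥ v≮ℓ))) (*-zeroʳ (2 * k))))
      by-cases (yes v<ℓ) = begin
        enc p v                                    ≡⟨ periodic-% N (λ p → enc p v) (λ p → enc-periodic p v) p ⟩
        enc (p % N) v                              ≡⟨ m*[n/m]≡n (enc-divisible (p % N) v) ⟨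
        2 * k * (enc (p % N) v / (2 * k))          ≡⟨ cong (2 * k *_) (cong₂ (λ p v → enc p v / (2 * k)) (sym q≡) (sym i≡)) ⟩
        2 * k * (enc (toℕ q) (toℕ i) / (2 * k))    ≡⟨ cong (2 * k *_) (trans (cell-lookup matrix q i) (matrix-entry i q)) ⟨
        2 * k * cell matrix (toℕ q) (toℕ i)        ≡⟨ cong (2 * k *_) (cong₂ (cell matrix) q≡ i≡) ⟩
        2 * k * cell matrix (p % N) v              ≡⟨ cong (2 * k *_) (periodic-% N (λ p → cell matrix p v) (λ p → cell-+N matrix p v) p) ⟨
        2 * k * cell matrix p v                    ∎
        where
        i : Fin ℓ
        i = fromℕ< v<ℓ
        q : Fin N
        q = at p
        i≡ : toℕ i ≡ v
        i≡ = toℕ-fromℕ< v<ℓ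
        q≡ : toℕ q ≡ p % N
        q≡ = toℕ-at p

    open Statistics mc matrix coded

    contents : ∀ m → total (is m) matrix ≡ lookup bs m
    contents m = begin
      total (is m) matrix                                ≡⟨ typeCount≡ i₀ i₀≡0 m ⟨
      typeCount k n (lookup πs i₀) (suc (toℕ m))         ≡⟨ lookup∘tabulate _ m ⟨
      lookup (typeVec k n (lookup πs i₀)) m              ≡⟨ cong (λ v → lookup v m) (proj₂ (proj₂ (proj₂ counted) i₀ i₀≡0)) ⟩
      lookup bs m                                        ∎
      where open ≡-Reasoning

    -- The row counts are first taken from the matrix itself. That they equal `t` is learnt from
    -- `rank-jumps`, whose truncated differences need `supports≤`, which in turn rests on this
    -- filling.
    filled : ∃ λ cs → fill matrix (supports matrix) bs ≡ just cs
    filled = fill-exists matrix bs (λ m → ≤-reflexive (contents m))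

    supports≤ : sum (supports matrix) ≤ n
    supports≤ = ≤-trans (≤-trans (m≤m+n _ _)
      (≤-reflexive (sym (fill-additive sum-additive matrix (supports matrix) bs (proj₂ filled))))) sum≤n

    supports≡ : supports matrix ≡ t
    supports≡ = toList-unique (supports matrix) t (∷-injectiveʳ
      (trans (sym (rank-jumps {πs} {matrix} mc coded supports≤)) (proj₁ (proj₂ counted))))

    fills-matrix : Fills matrix
    fills-matrix = proj₁ filled , subst (λ t → fill matrix t bs ≡ just (proj₁ filled)) supports≡ (proj₂ filled)

    matches : Matches πs matrix
    matches code i e = begin
      lastIn (lookup πs i) e               ≡⟨ last-at i e ⟨
      last (toℕ i) e                       ≡⟨ DecodeEncode.dec-enc lastChain light′ (toℕ i) e ⟨
      Decoding.dec (DecodeEncode.enc-code lastChain light′) (toℕ i) e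
        ≡⟨ dec-cong (DecodeEncode.enc-code lastChain light′) code coded (toℕ i) e ⟩
      Decoding.dec code (toℕ i) e          ∎
      where
      open ≡-Reasoning
      light′ : ∑ N (λ p → ∑ ℓ (enc p)) ≤ N
      light′ = ≤-trans (≤-reflexive (∑-cong N λ p _ → ∑-cong ℓ λ v _ → coded p v)) (Code.light code)

  module Decoded {V : Matrix} (fills-V : Fills V) where

    code : Code (weight V)
    code = code-of {V} fills-V

    chain : LastChain (Decoding.dec code)
    chain = Decoding.lastChain code

    open FromChain chain

    matches : Matches partitions V
    matches code′ i e = trans (lastIn-partitions i e) (dec-cong code code′ (λ _ _ → refl) (toℕ i) e)

    coded : ∀ p v → Encode.enc (Lasts.last multichain) p v ≡ weight V p v
    coded p v = trans (enc-cong (last≡dec {V = V} multichain code (matches code)) p v) (EncodeDecode.enc-dec code p v)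

    open Statistics multichain V coded

    supports≡ : supports V ≡ t
    supports≡ = fill-supports V t bs (proj₂ fills-V)

    leftover : Vec ℕ n
    leftover = proj₁ fills-V

    -- By `balanced` there are exactly as many labels as cells to be filled.
    leftover-sum : sum leftover ≡ 0
    leftover-sum = +-cancelˡ-≡ (sum t) _ _ (begin
      sum t + sum leftover               ≡⟨ cong (λ u → sum u + sum leftover) (sym supports≡) ⟩
      sum (supports V) + sum leftover    ≡⟨ fill-additive sum-additive V t bs (proj₂ fills-V) ⟨
      sum bs                             ≡⟨ balanced ⟩
      sum t                              ≡⟨ +-identityʳ (sum t) ⟨
      sum t + 0                          ∎)
      where open ≡-Reasoning

    types : ∀ i → toℕ i ≡ 0 → typeVec k n (lookup partitions i) ≡ bs
    types i i≡0 = lookup-ext λ m → begin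
      lookup (typeVec k n (lookup partitions i)) m         ≡⟨ lookup∘tabulate _ m ⟩
      typeCount k n (lookup partitions i) (suc (toℕ m))    ≡⟨ typeCount≡ i i≡0 m ⟩
      total (is m) V                                       ≡⟨ +-identityʳ _ ⟨
      total (is m) V + 0                                   ≡⟨ cong (total (is m) V +_) (n≤0⇒n≡0 (≤-trans (lookup≤sum leftover m) (≤-reflexive leftover-sum))) ⟨
      total (is m) V + lookup leftover m                   ≡⟨ fill-additive (lookup-additive m) V t bs (proj₂ fills-V) ⟨
      lookup bs m                                          ∎
      where open ≡-Reasoning

    jumps : multichainRankJumps k n ℓ partitions ≡ toList s
    jumps = trans (rank-jumps {partitions} {V} multichain coded
        (≤-trans (≤-reflexive (trans (cong sum supports≡) (sym balanced))) sum≤n))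
      (cong₂ (λ a u → n ∸ a ∷ toList u) (trans (cong sum supports≡) (sym balanced)) supports≡)

    counted : Counted k n ℓ (sum bs) bs s partitions
    counted =
      ((λ i → Multichain.partition multichain i , Multichain.noncross multichain i ,
              all-divisible i₀ i₀≡0 i , invariantAt i) , Multichain.refinement multichain) ,
      jumps , λ i i≡0 → cong sum (types i i≡0) , types i i≡0

  -- Both matrices decode to the last elements of one multichain, and encoding recovers each from
  -- its decoding.
  matches-unique : ∀ {πs V V′} → Multichain πs → Fills V → Fills V′ → Matches πs V → Matches πs V′ → V ≡ V′
  matches-unique {πs} {V} {V′} mc f f′ m m′ = lookup-ext λ i → lookup-ext λ q → toℕ-injective (begin
    toℕ (lookup (lookup V i) q)     ≡⟨ cell-lookup V q i ⟨
    cell V (toℕ q) (toℕ i)          ≡⟨ *-cancelˡ-≡ _ _ (2 * k) (weights (toℕ q) (toℕ i)) ⟩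
    cell V′ (toℕ q) (toℕ i)         ≡⟨ cell-lookup V′ q i ⟩
    toℕ (lookup (lookup V′ i) q)    ∎)
    where
    open ≡-Reasoning
    c : Code (weight V)
    c = code-of {V} f
    c′ : Code (weight V′)
    c′ = code-of {V′} f′
    same-dec : ∀ j e → Decoding.dec c j e ≡ Decoding.dec c′ j e
    same-dec j e = trans (sym (last≡dec {V = V} mc c (m c) j e)) (last≡dec {V = V′} mc c′ (m′ c′) j e)
    weights : ∀ p v → weight V p v ≡ weight V′ p v
    weights p v = trans (sym (EncodeDecode.enc-dec c p v)) (trans (enc-cong same-dec p v) (EncodeDecode.enc-dec c′ p v))

  chains : List (Vec (Rep M) ℓ)
  chains = filter (counted? k n ℓ (sum bs) bs s) (allVecs (allVecs (allFin M) M) ℓ)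

  matrices : List Matrix
  matrices = filter (λ V → isJust? (fill V t bs)) (fills N ℓ)

  chain⁻ : ∀ {πs} → πs ∈ chains → Counted k n ℓ (sum bs) bs s πs
  chain⁻ πs∈ = proj₂ (∈-filter⁻ (counted? k n ℓ (sum bs) bs s) {xs = allVecs (allVecs (allFin M) M) ℓ} πs∈)

  chain⁺ : ∀ {πs} → Counted k n ℓ (sum bs) bs s πs → πs ∈ chains
  chain⁺ {πs} c = ∈-filter⁺ (counted? k n ℓ (sum bs) bs s) (allVecs-complete (allVecs-complete ∈-allFin) πs) c

  matrix⁻ : ∀ {V} → V ∈ matrices → Fills V
  matrix⁻ V∈ = is-just⇒∃ (proj₂ (∈-filter⁻ (λ V → isJust? (fill V t bs)) {xs = fills N ℓ} V∈))

  matrix⁺ : ∀ {V} → Fills V → V ∈ matrices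
  matrix⁺ {V} (_ , eq) = ∈-filter⁺ (λ V → isJust? (fill V t bs)) (allVecs-complete (allVecs-complete ∈-allFin) V) (∃⇒is-just eq)

  same-number : length chains ≡ length matrices
  same-number = length-≡ Matches chains matrices
    (filter⁺ (counted? k n ℓ (sum bs) bs s) (allVecs-unique ℓ (allVecs-unique M (allFin⁺ M))))
    (filter⁺ (λ V → isJust? (fill V t bs)) (allVecs-unique ℓ (allVecs-unique N (allFin⁺ (suc n)))))
    (λ {πs} πs∈ → let c = chain⁻ πs∈ in Encoded.matrix c , matrix⁺ (Encoded.fills-matrix c) , Encoded.matches c)
    (λ {V} V∈ → let f = matrix⁻ V∈ in
      FromChain.partitions (Decoded.chain {V} f) , chain⁺ (Decoded.counted {V} f) , Decoded.matches {V} f)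
    (λ {πs} {πs′} {V} πs∈ πs′∈ V∈ m m′ → let c = code-of {V} (matrix⁻ V∈) in
      multichain-unique (multichain-of (proj₁ (chain⁻ πs∈))) (multichain-of (proj₁ (chain⁻ πs′∈)))
        λ i e → trans (m c i e) (sym (m′ c i e)))
    (λ {πs} {V} {V′} πs∈ V∈ V′∈ → matches-unique {πs} {V} {V′} (multichain-of (proj₁ (chain⁻ πs∈))) (matrix⁻ V∈) (matrix⁻ V′∈))

theorem6p2 : (n k ℓ : ℕ) → 1 ≤ n → 1 ≤ k → 1 ≤ ℓ →
    (b : ℕ) (bs : Vec ℕ n) (s : Vec ℕ (suc ℓ)) →
    sum bs ≡ b → weightedSum bs ≤ n → sum s ≡ n → head s ≡ n ∸ b →
    numMultichains k n ℓ b bs s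
    ≡ multinomial b bs * product (map (λ x → (2 * k * n + k) C x) (toList (tail s)))
theorem6p2 n k ℓ n>0 k>0 ℓ>0 .(sum bs) bs (.(n ∸ sum bs) ∷ t) refl light total-s refl = begin
  numMultichains k n ℓ (sum bs) bs (n ∸ sum bs ∷ t)      ≡⟨ same-number ⟩
  length matrices                                        ≡⟨ count-fills N ℓ t bs balanced ⟩
  multinomial (sum t) bs * product (map (N C_) (toList t)) ≡⟨ cong (λ b → multinomial b bs * product (map (N C_) (toList t))) balanced ⟨
  multinomial (sum bs) bs * product (map (N C_) (toList t)) ∎
  where
  open ≡-Reasoning
  sum≤ : sum bs ≤ n
  sum≤ = ≤-trans (sum≤weighted 0 bs) (≤-trans (≤-reflexive (sym (weightedSum≡ bs))) light)
  -- The jumps total `n` and the first is `n ∸ b`, so the others sum to `b`; the difference is not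
  -- truncated, as `b ≤ weightedSum bs ≤ n`.
  balanced : sum bs ≡ sum t
  balanced = +-cancelˡ-≡ (n ∸ sum bs) _ _ (trans (m∸n+n≡m sum≤) (sym total-s))
  open Main n k ℓ k>0 using (N)
  open Bijection n k ℓ k>0 ℓ>0 bs t light balanced
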